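{- Let $\pi:\widetilde{\Gamma}\to\Gamma$ be a dilated double cover of metric graphs, with $\Gamma$ connected. Let $m_d(\widetilde{\Gamma}/\Gamma)$, $n_d(\widetilde{\Gamma}/\Gamma)$ and $d(\widetilde{\Gamma}/\Gamma)$ be respectively the numbers of edges, vertices, and connected components of the dilation subgraph $\Gamma_{\mathrm{dil}}$. Then the volume of the tropical Prym variety of $\pi$ is given by \[ \mathrm{Vol}^2(\mathrm{Prym}(\widetilde{\Gamma}/\Gamma))=2^{m_d(\widetilde{\Gamma}/\Gamma)-n_d(\widetilde{\Gamma}/\Gamma)+d(\widetilde{\Gamma}/\Gamma)}\,\frac{\mathrm{Vol}^2(\mathrm{Jac}(\widetilde{\Gamma}))}{\mathrm{Vol}^2(\mathrm{Jac}(\Gamma))}. \]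
   Context: **Graphs.** A graph $G$ has a finite non-empty vertex set $V(G)$, a finite set $H(G)$ of half-edges with a root map $r:H(G)\to V(G)$ and a fixed-point-free involution on $H(G)$ whose orbits $e=\{h,h'\}$ are the edges; $E(G)$ is the set of edges. Loops and multiple edges are allowed. The genus of a connected graph is $g(G)=b_1(G)=\#E(G)-\#V(G)+1$ (there are no vertex weights). A metric graph $\Gamma$ is a graph together with a positive length $\ell(e)$ for each edge $e$; a choice of underlying graph (model) is always fixed, and we write $V(\Gamma),E(\Gamma)$, etc. **Double covers.** A double cover $\pi:\widetilde{\Gamma}\to\Gamma$ consists of maps $V(\widetilde{\Gamma})\to V(\Gamma)$ and $H(\widetilde{\Gamma})\to H(\Gamma)$ commuting with the root maps and the edge involutions, and a degree function $d_\pi:V(\widetilde{\Gamma})\cup E(\widetilde{\Gamma})\to\mathbb{Z}_{>0}$ (the degree of a half-edge is that of its edge) such that: (i) for every $\widetilde{v}\in V(\widetilde{\Gamma})$ and every half-edge $h$ rooted at $\pi(\widetilde{v})$, $d_\pi(\widetilde{v})$ is the sum of $d_\pi(\widetilde{h})$ over the half-edges $\widetilde{h}$ rooted at $\widetilde{v}$ with $\pi(\widetilde{h})=h$; (ii) the degrees of the preimages of each vertex and each half-edge of $\Gamma$ sum to $2$; (iii) $\ell(\pi(\widetilde{e}))=d_\pi(\widetilde{e})\,\ell(\widetilde{e})$ for all $\widetilde{e}\in E(\widetilde{\Gamma})$. A vertex or edge of $\Gamma$ is dilated if it has a single preimage (of degree $2$), and undilated if it has two preimages (each of degree $1$). The dilated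 vertices and edges form the dilation subgraph $\Gamma_{\mathrm{dil}}\subset\Gamma$. The cover is dilated if $\Gamma_{\mathrm{dil}}\neq\emptyset$; when $\Gamma$ is connected, $\widetilde{\Gamma}$ is then connected too. **Jacobians.** Fix orientations compatible with $\pi$. $H_1(\Gamma,\mathbb{Z})\subset\mathbb{Z}^{E(\Gamma)}$ is the simplicial homology, with edge length pairing $\left[\sum a_e e,\sum b_e e\right]_\Gamma=\sum a_e b_e\ell(e)$; similarly for $\widetilde{\Gamma}$. The Jacobian $\mathrm{Jac}(\Gamma)$ is the real torus $\mathrm{Hom}(H_1(\Gamma,\mathbb{Z}),\mathbb{R})/H_1(\Gamma,\mathbb{Z})$ (embedding via the pairing), principally polarized by the identity of $H_1(\Gamma,\mathbb{Z})$, and its volume is given by $\mathrm{Vol}^2(\mathrm{Jac}(\Gamma))=\det\big([\gamma_i,\gamma_j]_\Gamma\big)$ for any $\mathbb{Z}$-basis $(\gamma_i)$ of $H_1(\Gamma,\mathbb{Z})$ (equal to $1$ if $g(\Gamma)=0$); similarly for $\widetilde{\Gamma}$. **The Prym variety.** The maps $\pi_*:H_1(\widetilde{\Gamma},\mathbb{Z})\to H_1(\Gamma,\mathbb{Z})$ and $\pi^*:H_1(\Gamma,\mathbb{Z})\to H_1(\widetilde{\Gamma},\mathbb{Z})$ are induced by $\pi_*(\widetilde{e})=\pi(\widetilde{e})$, and by $\pi^*(e)=2\widetilde{e}$ if $e$ is dilated with preimage $\widetilde{e}$, $\pi^*(e)=\widetilde{e}^++\widetilde{e}^-$ if $e$ is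 undilated with preimages $\widetilde{e}^\pm$. Let $h=g(\widetilde{\Gamma})-g(\Gamma)$, let $K'=\ker\pi_*$, and let $K$ be the quotient of $\mathrm{coker}\,\pi^*$ by its torsion subgroup; both are free abelian of rank $h$. The pairing $[\cdot,\cdot]_{\widetilde{\Gamma}}$ induces a well-defined non-degenerate pairing $[\cdot,\cdot]_P:K\times K'\to\mathbb{R}$. The tropical Prym variety $\mathrm{Prym}(\widetilde{\Gamma}/\Gamma)$ is the real torus $\mathrm{Hom}(K,\mathbb{R})/K'$ with this integral structure and with a principal polarization, i.e. an isomorphism $\zeta:K'\to K$ such that $(\lambda,\mu)_P=[\zeta(\lambda),\mu]_P$ is symmetric and positive definite on $K'$. Its volume is defined by $\mathrm{Vol}^2=\det\big((\lambda_i,\lambda_j)_P\big)$ for any basis $\lambda_1,\ldots,\lambda_h$ of $K'$. Since $\zeta$ is an isomorphism of lattices, this number does not depend on $\zeta$ and equals \[ \mathrm{Vol}^2(\mathrm{Prym}(\widetilde{\Gamma}/\Gamma))=\left|\det\big([\kappa_i,\lambda_j]_P\big)_{1\le i,j\le h}\right| \] for any bases $\kappa_1,\ldots,\kappa_h$ of $K$ and $\lambda_1,\ldots,\lambda_h$ of $K'$; this formula is to be taken as the definition of $\mathrm{Vol}^2(\mathrm{Prym}(\widetilde{\Gamma}/\Gamma))$ (it equals $1$ if $h=0$). -}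

module Defs where

open import Algebra.Bundles using (CommutativeMonoid; CommutativeRing; Semiring)
import Algebra.Definitions.RawMonoid as RawMonoid
import Algebra.Definitions.RawSemiring as RawSemiring
open import Algebra.Structures using (IsCommutativeRing)
open import Data.Bool.Base using (if_then_else_)
open import Data.Fin.Base using (Fin; zero; suc; toℕ; punchIn)
import Data.Fin.Properties as Fin
open import Data.Integer.Base as ℤ using (ℤ; +_; -[1+_]; 0ℤ)
import Data.Integer.Properties as ℤ
open import Data.Nat.Base as ℕ using (ℕ; zero; suc)
import Data.Nat.Properties as ℕ
open import Data.Product.Base using (Σ; Σ-syntax; ∃; ∃-syntax; _×_; proj₁)
open import Data.Sum.Base using (_⊎_)
open import Function.Base using (_∘_)
open import Function.Bundles using (_⇔_)
open import Function.Definitions using (StrictlySurjective)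
open import Level using (_⊔_) renaming (suc to lsuc)
open import Relation.Binary.Construct.Closure.ReflexiveTransitive using (Star)
open import Relation.Binary.Core using (Rel)
open import Relation.Binary.Definitions using (tri<; tri≈; tri>)
open import Relation.Binary.PropositionalEquality.Core using (_≡_; _≢_)
open import Relation.Binary.Structures using (IsStrictTotalOrder)
open import Relation.Nullary using (¬_; does; _×-dec_)
open import Relation.Unary using (Pred; Decidable; _∈_; _∩_)

module FiniteSum {c ℓ} (M : CommutativeMonoid c ℓ) where
  open CommutativeMonoid M using (Carrier; ε; rawMonoid)
  open RawMonoid rawMonoid public using (sum)

  sumOver : ∀ {n p} {P : Pred (Fin n) p} → Decidable P → (Fin n → Carrier) → Carrier
  sumOver P? f = sum (λ i → if does (P? i) then f i else ε)

module ℕΣ = FiniteSum ℕ.+-0-commutativeMonoid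
module ℤΣ = FiniteSum ℤ.+-0-commutativeMonoid

count : ∀ {n p} {P : Pred (Fin n) p} → Decidable P → ℕ
count P? = ℕΣ.sumOver P? (λ _ → 1)

-- `f` exhibits `Fin n` as the quotient of `A` by `_∼_`.  Used to speak about
-- edge sets and sets of connected components without quotient types.
IsQuotient : ∀ {a r} {A : Set a} {n : ℕ} → Rel A r → (A → Fin n) → Set (a ⊔ r)
IsQuotient _∼_ f = StrictlySurjective _≡_ f × (∀ x y → f x ≡ f y ⇔ x ∼ y)

-- The scalars: ℝ (read classically) is the intended instance.
record OrderedField c ℓ₁ ℓ₂ : Set (lsuc (c ⊔ ℓ₁ ⊔ ℓ₂)) where
  infix  9 _⁻¹
  infix  8 -_
  infixl 7 _*_
  infixl 6 _+_
  infix  4 _≈_ _<_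
  field
    Carrier            : Set c
    _≈_                : Rel Carrier ℓ₁
    _<_                : Rel Carrier ℓ₂
    _+_ _*_            : Carrier → Carrier → Carrier
    -_                 : Carrier → Carrier
    0# 1#              : Carrier
    -- Total; its value at 0# is left unspecified.
    _⁻¹                : Carrier → Carrier
    isCommutativeRing  : IsCommutativeRing _≈_ _+_ _*_ -_ 0# 1#
    isStrictTotalOrder : IsStrictTotalOrder _≈_ _<_
    0<1                : 0# < 1#
    +-monoˡ-<          : ∀ z {x y} → x < y → x + z < y + z
    *-pos              : ∀ {x y} → 0# < x → 0# < y → 0# < x * y
    ⁻¹-cong            : ∀ {x y} → x ≈ y → x ⁻¹ ≈ y ⁻¹
    ⁻¹-inverseʳ        : ∀ {x} → ¬ (x ≈ 0#) → x * x ⁻¹ ≈ 1#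

  commutativeRing : CommutativeRing c ℓ₁
  commutativeRing = record { isCommutativeRing = isCommutativeRing }

  open CommutativeRing commutativeRing public
    using (+-commutativeMonoid; semiring)
  open RawSemiring (Semiring.rawSemiring semiring) public using (_^_) renaming (_×_ to _×ℕ_)
  open FiniteSum +-commutativeMonoid public using (sum)
  open IsStrictTotalOrder isStrictTotalOrder public using (compare)

  infixl 7 _/_
  infixr 8 _·_ _^ℤ_

  _/_ : Carrier → Carrier → Carrier
  x / y = x * y ⁻¹

  2# : Carrier
  2# = 1# + 1#

  ∣_∣ : Carrier → Carrier
  ∣ x ∣ with compare x 0#
  ... | tri< _ _ _ = - x
  ... | tri≈ _ _ _ = x
  ... | tri> _ _ _ = x

  _·_ : ℤ → Carrier → Carrier
  (+ n)    · x = n ×ℕ x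
  -[1+ n ] · x = - (suc n ×ℕ x)

  _^ℤ_ : Carrier → ℤ → Carrier
  x ^ℤ (+ n)    = x ^ n
  x ^ℤ -[1+ n ] = (x ^ suc n) ⁻¹

  -- Laplace expansion along the first row; the empty determinant is 1#.
  det : ∀ {n} → (Fin n → Fin n → Carrier) → Carrier
  det {zero}  M = 1#
  det {suc n} M = sum λ j →
    (- 1#) ^ toℕ j * (M zero j * det (λ r s → M (suc r) (punchIn j s)))

record Graph : Set where
  field
    #V #H #E : ℕ

  V : Set
  V = Fin #V

  H : Set
  H = Fin #H

  E : Set
  E = Fin #E

  field
    nonEmpty     : 0 ℕ.< #V
    root         : H → V
    inv          : H → H
    involutive   : ∀ h → inv (inv h) ≡ h
    no-fixed     : ∀ h → inv h ≢ h
    edge         : H → E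
    edgeQuotient : IsQuotient (λ h h′ → h′ ≡ h ⊎ h′ ≡ inv h) edge

  Connected : Set
  Connected = ∀ u v → Star (λ x y → ∃[ h ] root h ≡ x × root (inv h) ≡ y) u v

-- The chosen half-edge of `e` sits at its tail: `e` runs from `tail e` to `head e`.
record Orientation (G : Graph) : Set where
  open Graph G
  field
    start      : E → H
    edge-start : ∀ e → edge (start e) ≡ e

  tail head : E → V
  tail = root ∘ start
  head = root ∘ inv ∘ start

combination : ∀ {m n} → (Fin n → ℤ) → (Fin n → Fin m → ℤ) → Fin m → ℤ
combination c b e = ℤΣ.sum (λ i → c i ℤ.* b i e)

IsZero : ∀ {m} → Pred (Fin m → ℤ) _
IsZero x = ∀ e → x e ≡ 0ℤ

-- For subgroups N ⊆ L of ℤᵐ: the classes of the `b i` form a ℤ-basis of L / N.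
record IsBasis {m n : ℕ} {ℓ ℓ′} (L : Pred (Fin m → ℤ) ℓ) (N : Pred (Fin m → ℤ) ℓ′)
               (b : Fin n → Fin m → ℤ) : Set (ℓ ⊔ ℓ′) where
  field
    member      : ∀ i → b i ∈ L
    spanning    : ∀ x → x ∈ L → ∃[ c ] (λ e → x e ℤ.- combination c b e) ∈ N
    independent : ∀ c → combination c b ∈ N → IsZero c

module Homology {G : Graph} (o : Orientation G) where
  open Graph G
  open Orientation o

  ∂ : (E → ℤ) → V → ℤ
  ∂ a v = ℤΣ.sumOver (λ e → head e Fin.≟ v) a ℤ.- ℤΣ.sumOver (λ e → tail e Fin.≟ v) a

  H₁ : Pred (E → ℤ) _
  H₁ a = IsZero (∂ a)

module _ {c ℓ₁ ℓ₂} (F : OrderedField c ℓ₁ ℓ₂) where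
  open OrderedField F

  record MetricGraph : Set (c ⊔ ℓ₂) where
    field
      graph : Graph
    open Graph graph public
    field
      length     : E → Carrier
      length-pos : ∀ e → 0# < length e

  pairing : (Γ : MetricGraph) (a b : MetricGraph.E Γ → ℤ) → Carrier
  pairing Γ a b = sum (λ e → (a e ℤ.* b e) · MetricGraph.length Γ e)

  IsBasisOfH₁ : (Γ : MetricGraph) → Orientation (MetricGraph.graph Γ) →
                ∀ {n} → (Fin n → MetricGraph.E Γ → ℤ) → Set
  IsBasisOfH₁ Γ o γ = IsBasis (Homology.H₁ o) IsZero γ

  -- Meaningful when γ is a basis of H₁(Γ,ℤ).
  jacVol² : (Γ : MetricGraph) → ∀ {n} → (Fin n → MetricGraph.E Γ → ℤ) → Carrier
  jacVol² Γ γ = det (λ i j → pairing Γ (γ i) (γ j))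

  record DoubleCover (Γ̃ Γ : MetricGraph) : Set ℓ₁ where
    private
      module S = MetricGraph Γ̃
      module T = MetricGraph Γ
    field
      onV      : S.V → T.V
      onH      : S.H → T.H
      onE      : S.E → T.E   -- determined by onH, as S.edge is surjective
      onE-edge : ∀ h̃ → onE (S.edge h̃) ≡ T.edge (onH h̃)
      onV-root : ∀ h̃ → onV (S.root h̃) ≡ T.root (onH h̃)
      onH-inv  : ∀ h̃ → onH (S.inv h̃) ≡ T.inv (onH h̃)

      degV     : S.V → ℕ
      degE     : S.E → ℕ
      degV-pos : ∀ ṽ → 0 ℕ.< degV ṽ
      degE-pos : ∀ ẽ → 0 ℕ.< degE ẽ

      harmonic : ∀ ṽ h → T.root h ≡ onV ṽ →
                 degV ṽ ≡ ℕΣ.sumOver (λ h̃ → S.root h̃ Fin.≟ ṽ ×-dec onH h̃ Fin.≟ h)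
                                     (degE ∘ S.edge)
      degree-V : ∀ v → ℕΣ.sumOver (λ ṽ → onV ṽ Fin.≟ v) degV ≡ 2
      degree-H : ∀ h → ℕΣ.sumOver (λ h̃ → onH h̃ Fin.≟ h) (degE ∘ S.edge) ≡ 2
      dilation : ∀ ẽ → T.length (onE ẽ) ≈ degE ẽ ×ℕ S.length ẽ

    DilatedV : Pred T.V _
    DilatedV v = count (λ ṽ → onV ṽ Fin.≟ v) ≡ 1

    DilatedE : Pred T.E _
    DilatedE e = count (λ ẽ → onE ẽ Fin.≟ e) ≡ 1

    dilatedV? : Decidable DilatedV
    dilatedV? v = count (λ ṽ → onV ṽ Fin.≟ v) ℕ.≟ 1

    dilatedE? : Decidable DilatedE
    dilatedE? e = count (λ ẽ → onE ẽ Fin.≟ e) ℕ.≟ 1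

    Dilated : Set
    Dilated = ∃ DilatedV ⊎ ∃ DilatedE

    #dilatedV #dilatedE : ℕ
    #dilatedV = count dilatedV?
    #dilatedE = count dilatedE?

    -- Adjacency in the dilation subgraph.  Both ends of a dilated edge are dilated, and
    -- adjacency is symmetric, so `Star _—_` is the relation of lying in one component.
    _—_ : Rel (∃ DilatedV) _
    u — v = ∃[ h ] DilatedE (T.edge h) × T.root h ≡ proj₁ u × T.root (T.inv h) ≡ proj₁ v

    -- The dilation subgraph has exactly d connected components.
    HasDilatedComponents : ℕ → Set
    HasDilatedComponents d = Σ[ f ∈ (∃ DilatedV → Fin d) ] IsQuotient (Star _—_) f

    Compatible : Orientation S.graph → Orientation T.graph → Set
    Compatible õ o = ∀ ẽ → onH (Orientation.start õ ẽ) ≡ Orientation.start o (onE ẽ)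

    -- On chains written with respect to compatible orientations.
    π⁎ : (S.E → ℤ) → T.E → ℤ
    π⁎ a e = ℤΣ.sumOver (λ ẽ → onE ẽ Fin.≟ e) a

    π* : (T.E → ℤ) → S.E → ℤ
    π* b ẽ = if does (dilatedE? (onE ẽ)) then + 2 ℤ.* b (onE ẽ) else b (onE ẽ)

  module Prym {Γ̃ Γ : MetricGraph} (π : DoubleCover Γ̃ Γ)
              (õ : Orientation (MetricGraph.graph Γ̃))
              (o : Orientation (MetricGraph.graph Γ)) where
    open DoubleCover π
    open Homology

    Kerπ⁎ : Pred (MetricGraph.E Γ̃ → ℤ) _
    Kerπ⁎ = H₁ õ ∩ (λ x → IsZero (π⁎ x))

    -- Cycles whose class in coker π* is torsion.
    TorsionInCoker : Pred (MetricGraph.E Γ̃ → ℤ) _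
    TorsionInCoker x = x ∈ H₁ õ ×
      ∃[ k ] ∃[ y ] k ≢ 0ℤ × y ∈ H₁ o × (∀ ẽ → k ℤ.* x ẽ ≡ π* y ẽ)

    IsBasisOfK′ : ∀ {n} → (Fin n → MetricGraph.E Γ̃ → ℤ) → Set
    IsBasisOfK′ l = IsBasis Kerπ⁎ IsZero l

    -- K = (coker π*) / torsion is H₁(Γ̃,ℤ) / TorsionInCoker; its elements are given
    -- by representing cycles.
    IsBasisOfK : ∀ {n} → (Fin n → MetricGraph.E Γ̃ → ℤ) → Set
    IsBasisOfK κ = IsBasis (H₁ õ) TorsionInCoker κ

    -- Meaningful when κ, l are bases of K, K′ (then n is forced to be their common
    -- rank, the difference of the genera of Γ̃ and Γ); the pairing on K × K′ is the one
    -- induced by the edge length pairing of Γ̃.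
    prymVol² : ∀ {n} → (κ l : Fin n → MetricGraph.E Γ̃ → ℤ) → Carrier
    prymVol² κ l = ∣ det (λ i j → pairing Γ̃ (κ i) (l j)) ∣

{-# OPTIONS --safe #-}
module Submission where

-- Let L̃ = H₁(Γ̃) and L = H₁(Γ), let l be a basis of K′, κ of K, t of the cycles that are
-- torsion in coker π*, and γ of L.  As the cover is dilated, π⁎ : L̃ → L is onto: every edge
-- lifts, and its lift is closed up by lifting walks to a dilated vertex, which has a single
-- preimage.  With lifts σ of γ, both (t , κ) and (σ , l) are bases of L̃, and t is orthogonal
-- to l since π* and π⁎ are adjoint.  So Vol²(Jac Γ̃) = ± det[t , σ] · det[κ , l].
--
-- Fundamental cycles z of a spanning forest grown from the dilated edges first form a basis
-- of L whose first r = m_d - n_d + d members are supported on dilated edges.  A torsion cycle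
-- is half of some π* y; t consists of π* z / 2 for these r cycles and of π* z for the others.
-- Adjointness gives 2 [t , σ] = [z , γ] in the first r rows and [t , σ] = [z , γ] in the
-- others, so 2 ^ r · det[t , σ] = ± Vol²(Jac Γ).  The signs disappear because Gram
-- determinants of cycle bases are positive.

open import Defs
open import Algebra.Bundles using (CommutativeMonoid; CommutativeRing)
import Algebra.Properties.CommutativeMonoid.Sum as MonoidSum
import Algebra.Properties.CommutativeSemigroup as CommutativeSemigroupProperties
import Algebra.Properties.Monoid.Mult as Mult
import Algebra.Properties.Ring as RingProperties
import Algebra.Properties.Semiring.Mult as SemiringMult
import Algebra.Properties.Semiring.Sum as SemiringSum
import Algebra.Solver.Ring as RingSolver
open import Algebra.Solver.Ring.AlmostCommutativeRing using (_-Raw-AlmostCommutative⟶_; fromCommutativeRing)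
open import Data.Bool.Base using (Bool; true; false; if_then_else_; _∨_)
import Data.Bool.Properties as Bool
open import Data.Empty using (⊥; ⊥-elim)
open import Data.Fin.Base as Fin using (Fin; zero; suc; toℕ; fromℕ<; punchIn; punchOut; splitAt; _↑ˡ_; _↑ʳ_)
import Data.Fin.Properties as Fin
open import Data.Integer.Base as ℤ using (ℤ; +_; -[1+_]; 0ℤ; 1ℤ; -1ℤ; _⊖_)
import Data.Integer.Properties as ℤ
open import Data.Integer.Tactic.RingSolver using () renaming (solve to solve-ℤ)
open import Data.List.Base using (List; []; _∷_; allFin; filter)
open import Data.List.Membership.Propositional using () renaming (_∈_ to _∈ˡ_)
open import Data.List.Membership.Propositional.Properties using (∈-filter⁺; ∈-filter⁻; ∈-allFin)
open import Data.List.Relation.Unary.Any using (here; there)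
open import Data.Maybe.Base as Maybe using ()
open import Data.Nat.Base as ℕ using (ℕ; zero; suc)
import Data.Nat.Properties as ℕ
open import Data.Product.Base using (∃; ∃-syntax; _×_; _,_; proj₁; proj₂)
open import Data.Sum.Base using (_⊎_; inj₁; inj₂; [_,_]; [_,_]′)
open import Data.Unit.Base using (⊤; tt)
open import Data.Vec.Functional using (_++_) renaming (_∷_ to _∷ᵥ_)
import Data.Vec.Functional.Properties as Vector
open import Function.Base using (_∘_; id)
open import Function.Bundles using (Equivalence)
open import Level using (_⊔_)
open import Relation.Binary.Construct.Closure.ReflexiveTransitive as Star using (Star; _◅_; _◅◅_)
open import Relation.Binary.Definitions using (tri<; tri≈; tri>)
open import Relation.Binary.PropositionalEquality.Core as ≡ using (_≡_; _≢_)
open import Relation.Binary.PropositionalEquality.Properties using (module ≡-Reasoning)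
import Relation.Binary.Reasoning.Setoid as SetoidReasoning
open import Relation.Binary.Structures using (IsStrictTotalOrder)
open import Relation.Nullary using (Dec; ¬_; does; yes; no; _×-dec_; ¬?)
open import Relation.Nullary.Decidable using (dec-true; dec-false; dec⇒maybe)
open import Relation.Unary using (Pred; Decidable; _∈_; _⊆_)

-- Dilation is what makes `π⁎` onto: for a connected cover without dilated points its image has
-- index 2 in H₁(Γ). A walk lifts from any starting point, but the end of the lift is only known up
-- to the fibre; over a dilated vertex the fibre is one point. The forest is grown in two stages for
-- the sake of divisibility. A torsion cycle x satisfies 2x = π*(π⁎ x), so `π⁎ x` is even on
-- undilated edges, with no parity condition on dilated ones. Fundamental cycles have the identity
-- as coefficient matrix on the edges off the forest, so the coordinates of `π⁎ x` are its values
-- there. Those that belong to undilated edges are even, which is why π* z need not be halved for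
-- these z. The number r is the first Betti number of the dilation subgraph. The given bases are
-- arbitrary, so each change of basis costs an unknown unit of ℤ. Determinants are therefore
-- compared up to sign only, and positivity settles the sign at the end. Multiplicativity of `det`
-- comes from a uniqueness principle: an alternating multilinear function of the rows that vanishes
-- at the identity is zero.

-- Listings of finite subsets, and finite sums.

record Enumeration {m p} (P : Pred (Fin m) p) (k : ℕ) : Set p where
  field
    at        : Fin k → Fin m
    at-∈      : ∀ i → P (at i)
    injective : ∀ {i j} → at i ≡ at j → i ≡ j
    index     : ∀ x → P x → ∃[ i ] at i ≡ x

enumerate : ∀ {m p} {P : Pred (Fin m) p} (P? : Decidable P) → Enumeration P (count P?)
enumerate {zero} P? = record
  { at = λ () ; at-∈ = λ () ; injective = λ { {()} } ; index = λ () }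
enumerate {suc m} {P = P} P? with P? zero | enumerate {P = P ∘ suc} (P? ∘ suc)
... | yes p | e = record
  { at        = λ { zero → zero ; (suc i) → suc (at i) }
  ; at-∈      = λ { zero → p ; (suc i) → at-∈ i }
  ; injective = λ { {zero}  {zero}  _  → ≡.refl
                  ; {suc i} {suc j} eq → ≡.cong suc (injective (Fin.suc-injective eq)) }
  ; index     = λ { zero _ → zero , ≡.refl
                  ; (suc x) q → let i , eq = index x q in suc i , ≡.cong suc eq }
  }
  where open Enumeration e
... | no ¬p | e = record
  { at        = suc ∘ at
  ; at-∈      = at-∈
  ; injective = injective ∘ Fin.suc-injective
  ; index     = λ { zero q → ⊥-elim (¬p q)
                  ; (suc x) q → let i , eq = index x q in i , ≡.cong suc eq }
  }
  where open Enumeration e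

Enumeration-≤ : ∀ {m p k k′} {P : Pred (Fin m) p} →
                Enumeration P k → Enumeration P k′ → k ℕ.≤ k′
Enumeration-≤ a b = Fin.injective⇒≤ {f = proj₁ ∘ position} λ {i} {j} eq →
    A.injective (≡.trans (≡.sym (proj₂ (position i)))
                         (≡.trans (≡.cong B.at eq) (proj₂ (position j))))
  where
  module A = Enumeration a
  module B = Enumeration b
  position : ∀ i → ∃[ j ] B.at j ≡ A.at i
  position i = B.index (A.at i) (A.at-∈ i)

Enumeration-unique : ∀ {m p k k′} {P : Pred (Fin m) p} →
                     Enumeration P k → Enumeration P k′ → k ≡ k′
Enumeration-unique a b = ℕ.≤-antisym (Enumeration-≤ a b) (Enumeration-≤ b a)

module SumProperties {c ℓ} (M : CommutativeMonoid c ℓ) where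
  open CommutativeMonoid M
  open FiniteSum M public
  open MonoidSum M public using (sum-cong-≋; ∑-comm; ∑-distrib-+; sum-replicate-zero)

  sum-zero : ∀ {n} {f : Fin n → Carrier} → (∀ i → f i ≈ ε) → sum f ≈ ε
  sum-zero {n} f≈ε = trans (sum-cong-≋ f≈ε) (sum-replicate-zero n)

  sum-single : ∀ {n} {f : Fin n → Carrier} j → (∀ i → i ≢ j → f i ≈ ε) → sum f ≈ f j
  sum-single zero    f≈ε =
    trans (∙-congˡ (sum-zero λ i → f≈ε (suc i) λ ())) (identityʳ _)
  sum-single (suc j) f≈ε =
    trans (∙-cong (f≈ε zero λ ()) (sum-single j λ i i≢j → f≈ε (suc i) (i≢j ∘ Fin.suc-injective)))
          (identityˡ _)

  sum-↑ : ∀ m {n} (f : Fin (m ℕ.+ n) → Carrier) →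
          sum f ≈ sum (f ∘ (_↑ˡ n)) ∙ sum (f ∘ (m ↑ʳ_))
  sum-↑ zero    f = sym (identityˡ _)
  sum-↑ (suc m) f = trans (∙-congˡ (sum-↑ m (f ∘ suc))) (sym (assoc _ _ _))

  module _ {p} {P : Set p} {x : Carrier} where
    if-yes : (P? : Dec P) → P → (if does P? then x else ε) ≈ x
    if-yes P? q rewrite dec-true P? q = refl

    if-no : (P? : Dec P) → ¬ P → (if does P? then x else ε) ≈ ε
    if-no P? ¬q rewrite dec-false P? ¬q = refl

  if-zero : ∀ (b : Bool) {x} → x ≈ ε → (if b then x else ε) ≈ ε
  if-zero true  eq = eq
  if-zero false eq = refl

  if-cong-∈ : ∀ {p} {P : Set p} (P? : Dec P) {x y} → (P → x ≈ y) →
              (if does P? then x else ε) ≈ (if does P? then y else ε)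
  if-cong-∈ (yes p) eq = eq p
  if-cong-∈ (no _)  eq = refl

  sumOver-cong : ∀ {n p} {P : Pred (Fin n) p} (P? : Decidable P) {f g : Fin n → Carrier} →
                 (∀ i → P i → f i ≈ g i) → sumOver P? f ≈ sumOver P? g
  sumOver-cong P? eq = sum-cong-≋ λ i → if-cong-∈ (P? i) (eq i)

  sumOver-single : ∀ {n p} {P : Pred (Fin n) p} (P? : Decidable P) (f : Fin n → Carrier) {j} →
                   P j → (∀ i → P i → i ≡ j) → sumOver P? f ≈ f j
  sumOver-single P? f {j} Pj unique =
    trans (sum-single j λ i i≢j → if-no (P? i) (i≢j ∘ unique i)) (if-yes (P? j) Pj)

  sumOver-≟ : ∀ {n} (f : Fin n → Carrier) j → sumOver (λ i → j Fin.≟ i) f ≈ f j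
  sumOver-≟ f j = sumOver-single (j Fin.≟_) f ≡.refl (λ _ → ≡.sym)

  sum-fibres : ∀ {m n} (p : Fin m → Fin n) (f : Fin m → Carrier) →
               sum (λ v → sumOver (λ x → p x Fin.≟ v) f) ≈ sum f
  sum-fibres p f = trans (∑-comm λ v x → if does (p x Fin.≟ v) then f x else ε) (sum-cong-≋ λ x → sumOver-≟ (λ _ → f x) (p x))

  -- Sum over the fibres of `at`. By injectivity the fibre over a point of `P` is a singleton; over
  -- any other point both the fibre sum and `f x` are zero.
  sum-reindex : ∀ {m k p} {P : Pred (Fin m) p} (e : Enumeration P k) (f : Fin m → Carrier) →
                (∀ x → P x ⊎ f x ≈ ε) → sum (f ∘ Enumeration.at e) ≈ sum f
  sum-reindex e f f≈ε = trans (sym (sum-fibres at _)) (sum-cong-≋ fibre)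
    where
    open Enumeration e
    fibre : ∀ x → sumOver (λ i → at i Fin.≟ x) (f ∘ at) ≈ f x
    fibre x with f≈ε x
    ... | inj₁ Px with index x Px
    ...   | i , ≡.refl = sumOver-single (λ j → at j Fin.≟ at i) (f ∘ at) ≡.refl (λ _ → injective)
    fibre x | inj₂ fx≈ε =
      trans (sum-zero λ i → trans (if-cong-∈ (at i Fin.≟ x) λ { ≡.refl → fx≈ε })
                                  (if-zero (does (at i Fin.≟ x)) refl))
            (sym fx≈ε)

module ℕS = SumProperties ℕ.+-0-commutativeMonoid

module _ {m p q r} {P : Pred (Fin m) p} {Q : Pred (Fin m) q} {R : Pred (Fin m) r}
         (P? : Decidable P) (Q? : Decidable Q) (R? : Decidable R) where

  count-⊎ : (∀ x → R x → P x ⊎ Q x) → (∀ x → P x → R x) → (∀ x → Q x → R x) →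
            (∀ x → P x → Q x → ⊥) → count R? ≡ count P? ℕ.+ count Q?
  count-⊎ split left right disjoint = ≡.trans (ℕS.sum-cong-≋ indicator) (ℕS.∑-distrib-+ (λ x → if does (P? x) then 1 else 0) (λ x → if does (Q? x) then 1 else 0))
    where
    indicator : ∀ x → (if does (R? x) then 1 else 0) ≡
                      (if does (P? x) then 1 else 0) ℕ.+ (if does (Q? x) then 1 else 0)
    indicator x with R? x | P? x | Q? x
    ... | _     | yes p | yes q = ⊥-elim (disjoint x p q)
    ... | yes _ | yes _ | no _  = ≡.refl
    ... | yes _ | no _  | yes _ = ≡.refl
    ... | yes z | no ¬p | no ¬q with split x z
    ...   | inj₁ p = ⊥-elim (¬p p)
    ...   | inj₂ q = ⊥-elim (¬q q)
    indicator x | no ¬z | yes p | no _  = ⊥-elim (¬z (left x p))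
    indicator x | no ¬z | no _  | yes q = ⊥-elim (¬z (right x q))
    indicator x | no _  | no _  | no _  = ≡.refl

count-unique : ∀ {m p} {P : Pred (Fin m) p} (P? : Decidable P) → count P? ≡ 1 →
               ∀ {x y} → P x → P y → x ≡ y
count-unique {P = P} P? eq {x} {y} Px Py =
  ≡.trans (≡.sym (proj₂ i)) (≡.trans (≡.cong at (Fin1-unique (proj₁ i) (proj₁ j))) (proj₂ j))
  where
  open Enumeration (≡.subst (Enumeration P) eq (enumerate P?))
  i = index x Px
  j = index y Py
  Fin1-unique : (a b : Fin 1) → a ≡ b
  Fin1-unique zero zero = ≡.refl

count-single : ∀ {m p} {P : Pred (Fin m) p} (P? : Decidable P) {x} →
               P x → (∀ y → P y → y ≡ x) → count P? ≡ 1
count-single P? Px unique = ℕS.sumOver-single P? (λ _ → 1) Px unique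

-- Arithmetic in an ordered field, and the integers inside it.

module FieldProperties {c ℓ₁ ℓ₂} (F : OrderedField c ℓ₁ ℓ₂) where
  open OrderedField F public hiding (sum)
  open CommutativeRing commutativeRing public
    using (refl; sym; trans; reflexive; setoid; +-cong; +-congˡ; +-congʳ; *-cong; *-congˡ; *-congʳ;
           -‿cong; +-identityˡ; +-identityʳ; *-identityˡ; *-identityʳ; +-assoc; +-comm;
           *-assoc; +-commutativeSemigroup; *-comm; zeroˡ; zeroʳ; -‿inverseʳ; distribʳ; ring; +-monoid)
  open IsStrictTotalOrder isStrictTotalOrder public
    using (_≟_; <-resp-≈; irrefl; asym) renaming (trans to <-trans)
  open SumProperties +-commutativeMonoid public
  open SemiringSum semiring public using (*-distribˡ-sum; *-distribʳ-sum)
  open RingProperties ring public using (-‿distribˡ-*; -0#≈0#; -‿involutive; -‿+-comm)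
  open SetoidReasoning setoid public
  open CommutativeSemigroupProperties +-commutativeSemigroup using (interchange)
  private
    module × = Mult +-monoid
    module ×1 = SemiringMult semiring

  -- The ring map from ℤ. Through it integer multiples become products, which brings the edge length
  -- pairing within reach of matrix algebra and of the ring solver.
  ι : ℤ → Carrier
  ι k = k · 1#

  ·≈ι* : ∀ k x → k · x ≈ ι k * x
  ·≈ι* (+ n)    x = trans (×.×-congʳ n (sym (*-identityˡ x))) (sym (×1.×-assoc-* n 1# x))
  ·≈ι* -[1+ n ] x = trans (-‿cong (trans (×.×-congʳ (suc n) (sym (*-identityˡ x)))
                                         (sym (×1.×-assoc-* (suc n) 1# x))))
                          (-‿distribˡ-* _ _)

  ι-⊖ : ∀ m n → ι (m ⊖ n) ≈ m ×ℕ 1# + - (n ×ℕ 1#)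
  ι-⊖ m       zero    = sym (trans (+-congˡ -0#≈0#) (+-identityʳ _))
  ι-⊖ zero    (suc n) = sym (+-identityˡ _)
  ι-⊖ (suc m) (suc n) = begin
    ι (suc m ⊖ suc n)                              ≡⟨ ≡.cong ι (ℤ.[1+m]⊖[1+n]≡m⊖n m n) ⟩
    ι (m ⊖ n)                                      ≈⟨ ι-⊖ m n ⟩
    m ×ℕ 1# + - (n ×ℕ 1#)                          ≈⟨ shift 1# _ _ ⟩
    1# + m ×ℕ 1# + - (1# + n ×ℕ 1#)                ∎
    where
    shift : ∀ x y z → y + - z ≈ x + y + - (x + z)
    shift x y z = begin
      y + - z                     ≈⟨ +-identityˡ _ ⟨
      0# + (y + - z)              ≈⟨ +-congʳ (-‿inverseʳ x) ⟨
      (x + - x) + (y + - z)       ≈⟨ interchange x (- x) y (- z) ⟩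
      (x + y) + (- x + - z)       ≈⟨ +-congˡ (-‿+-comm x z) ⟩
      x + y + - (x + z)           ∎

  ι-+ : ∀ j k → ι (j ℤ.+ k) ≈ ι j + ι k
  ι-+ (+ m)    (+ n)    = ×.×-homo-+ 1# m n
  ι-+ (+ m)    -[1+ n ] = ι-⊖ m (suc n)
  ι-+ -[1+ m ] (+ n)    = trans (ι-⊖ n (suc m)) (+-comm _ _)
  ι-+ -[1+ m ] -[1+ n ] = begin
    - (suc (suc (m ℕ.+ n)) ×ℕ 1#)            ≈⟨ -‿cong (+-congˡ (+-congˡ (×.×-homo-+ 1# m n))) ⟩
    - (1# + (1# + (m ×ℕ 1# + n ×ℕ 1#)))      ≈⟨ -‿cong (trans (sym (+-assoc _ _ _)) (interchange _ _ _ _)) ⟩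
    - ((1# + m ×ℕ 1#) + (1# + n ×ℕ 1#))      ≈⟨ -‿+-comm _ _ ⟨
    - (1# + m ×ℕ 1#) + - (1# + n ×ℕ 1#)      ∎

  ι-neg : ∀ k → ι (ℤ.- k) ≈ - ι k
  ι-neg (+ zero)  = sym -0#≈0#
  ι-neg (+ suc n) = refl
  ι-neg -[1+ n ]  = sym (-‿involutive _)

  ι-1 : ι 1ℤ ≈ 1#
  ι-1 = +-identityʳ 1#

  ι-ℕ* : ∀ m k → ι (+ m ℤ.* k) ≈ ι (+ m) * ι k
  ι-ℕ* zero k    = trans (reflexive (≡.cong ι (ℤ.*-zeroˡ k))) (sym (zeroˡ _))
  ι-ℕ* (suc m) k = begin
    ι (+ suc m ℤ.* k)             ≡⟨ ≡.cong ι (ℤ.suc-* (+ m) k) ⟩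
    ι (k ℤ.+ + m ℤ.* k)           ≈⟨ ι-+ k (+ m ℤ.* k) ⟩
    ι k + ι (+ m ℤ.* k)           ≈⟨ +-cong (sym (*-identityˡ _)) (ι-ℕ* m k) ⟩
    1# * ι k + ι (+ m) * ι k      ≈⟨ distribʳ _ _ _ ⟨
    ι (+ suc m) * ι k             ∎

  ι-* : ∀ j k → ι (j ℤ.* k) ≈ ι j * ι k
  ι-* (+ m) k    = ι-ℕ* m k
  ι-* -[1+ m ] k = begin
    ι (ℤ.- (+ suc m) ℤ.* k)       ≡⟨ ≡.cong ι (ℤ.neg-distribˡ-* (+ suc m) k) ⟨
    ι (ℤ.- (+ suc m ℤ.* k))       ≈⟨ ι-neg (+ suc m ℤ.* k) ⟩
    - ι (+ suc m ℤ.* k)           ≈⟨ -‿cong (ι-ℕ* (suc m) k) ⟩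
    - (ι (+ suc m) * ι k)         ≈⟨ -‿distribˡ-* _ _ ⟩
    ι -[1+ m ] * ι k              ∎

  ι-morphism : ℤ.+-*-rawRing -Raw-AlmostCommutative⟶ fromCommutativeRing commutativeRing
  ι-morphism = record
    { ⟦_⟧ = ι ; +-homo = ι-+ ; *-homo = ι-* ; -‿homo = ι-neg ; 0-homo = refl ; 1-homo = ι-1 }

  open RingSolver ℤ.+-*-rawRing (fromCommutativeRing commutativeRing) ι-morphism
    (λ j k → Maybe.map (reflexive ∘ ≡.cong ι) (dec⇒maybe (j ℤ.≟ k))) public
    using (solve; _:=_; _:+_; _:*_; :-_; con)

  <-respʳ : ∀ {x y z} → y ≈ z → x < y → x < z
  <-respʳ = proj₁ <-resp-≈

  <-respˡ : ∀ {x y z} → y ≈ z → y < x → z < x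
  <-respˡ = proj₂ <-resp-≈

  <⇒≉ : ∀ {x y} → x < y → ¬ (x ≈ y)
  <⇒≉ x<y x≈y = irrefl x≈y x<y

  1≉0 : ¬ (1# ≈ 0#)
  1≉0 = <⇒≉ 0<1 ∘ sym

  +-pos : ∀ {x y} → 0# < x → 0# < y → 0# < x + y
  +-pos {x} {y} 0<x 0<y = <-trans 0<y (<-respˡ (+-identityˡ y) (+-monoˡ-< y 0<x))

  neg-pos : ∀ {x} → x < 0# → 0# < - x
  neg-pos {x} x<0 = <-respʳ (+-identityˡ (- x)) (<-respˡ (-‿inverseʳ x) (+-monoˡ-< (- x) x<0))

  pos-neg : ∀ {x} → 0# < x → - x < 0#
  pos-neg {x} 0<x = <-respʳ (-‿inverseʳ x) (<-respˡ (+-identityˡ (- x)) (+-monoˡ-< (- x) 0<x))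

  square-pos : ∀ {x} → ¬ (x ≈ 0#) → 0# < x * x
  square-pos {x} x≉0 with compare x 0#
  ... | tri< x<0 _ _ = <-respʳ (solve 1 (λ x → (:- x) :* (:- x) := x :* x) refl x) (*-pos (neg-pos x<0) (neg-pos x<0))
  ... | tri≈ _ x≈0 _ = ⊥-elim (x≉0 x≈0)
  ... | tri> _ _ 0<x = *-pos 0<x 0<x

  ⁻¹-pos : ∀ {x} → 0# < x → 0# < x ⁻¹
  ⁻¹-pos {x} 0<x with compare (x ⁻¹) 0#
  ... | tri> _ _ 0<x⁻¹ = 0<x⁻¹
  ... | tri≈ _ eq _ = ⊥-elim (1≉0 (trans (sym (⁻¹-inverseʳ (<⇒≉ 0<x ∘ sym))) (trans (*-congˡ eq) (zeroʳ x))))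
  ... | tri< x⁻¹<0 _ _ = ⊥-elim (asym 0<1 (<-respˡ eq (pos-neg (*-pos 0<x (neg-pos x⁻¹<0)))))
    where
    eq = trans (solve 2 (λ x y → :- (x :* (:- y)) := x :* y) refl x (x ⁻¹)) (⁻¹-inverseʳ (<⇒≉ 0<x ∘ sym))

  ^-pos : ∀ {x} n → 0# < x → 0# < x ^ n
  ^-pos zero    0<x = 0<1
  ^-pos (suc n) 0<x = *-pos 0<x (^-pos n 0<x)

  0<2 : 0# < 2#
  0<2 = +-pos 0<1 0<1

  sum-nonneg : ∀ {n} (f : Fin n → Carrier) → (∀ i → 0# < f i ⊎ f i ≈ 0#) → 0# < sum f ⊎ sum f ≈ 0#
  sum-nonneg {zero}  f f≥0 = inj₂ refl
  sum-nonneg {suc n} f f≥0 with f≥0 zero | sum-nonneg (f ∘ suc) (f≥0 ∘ suc)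
  ... | inj₁ p | inj₁ q = inj₁ (+-pos p q)
  ... | inj₁ p | inj₂ q = inj₁ (<-respʳ (sym (trans (+-congˡ q) (+-identityʳ _))) p)
  ... | inj₂ p | inj₁ q = inj₁ (<-respʳ (sym (trans (+-congʳ p) (+-identityˡ _))) q)
  ... | inj₂ p | inj₂ q = inj₂ (trans (+-cong p q) (+-identityˡ 0#))

  sum-pos : ∀ {n} (f : Fin n → Carrier) → (∀ i → 0# < f i ⊎ f i ≈ 0#) → ∀ j → 0# < f j → 0# < sum f
  sum-pos {suc n} f f≥0 zero 0<f with sum-nonneg (f ∘ suc) (f≥0 ∘ suc)
  ... | inj₁ q = +-pos 0<f q
  ... | inj₂ q = <-respʳ (sym (trans (+-congˡ q) (+-identityʳ _))) 0<f
  sum-pos {suc n} f f≥0 (suc j) 0<f with f≥0 zero | sum-pos (f ∘ suc) (f≥0 ∘ suc) j 0<f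
  ... | inj₁ p | q = +-pos p q
  ... | inj₂ p | q = <-respʳ (sym (trans (+-congʳ p) (+-identityˡ _))) q

  *-cancelˡ : ∀ {x y z} → ¬ (x ≈ 0#) → x * y ≈ x * z → y ≈ z
  *-cancelˡ {x} {y} {z} x≉0 eq = begin
    y                ≈⟨ inv y ⟨
    x ⁻¹ * (x * y)   ≈⟨ *-congˡ eq ⟩
    x ⁻¹ * (x * z)   ≈⟨ inv z ⟩
    z                ∎
    where
    inv : ∀ y → x ⁻¹ * (x * y) ≈ y
    inv y = begin
      x ⁻¹ * (x * y)   ≈⟨ *-assoc _ _ _ ⟨
      x ⁻¹ * x * y     ≈⟨ *-congʳ (trans (*-comm _ _) (⁻¹-inverseʳ x≉0)) ⟩
      1# * y           ≈⟨ *-identityˡ y ⟩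
      y                ∎

  IsSign : Carrier → Set ℓ₁
  IsSign u = u ≈ 1# ⊎ u ≈ - 1#

  -1*-1≈1 : - 1# * - 1# ≈ 1#
  -1*-1≈1 = trans (solve 1 (λ x → (:- x) :* (:- x) := x :* x) refl 1#) (*-identityˡ 1#)

  sign-* : ∀ {u v} → IsSign u → IsSign v → IsSign (u * v)
  sign-* (inj₁ p) (inj₁ q) = inj₁ (trans (*-cong p q) (*-identityˡ 1#))
  sign-* (inj₁ p) (inj₂ q) = inj₂ (trans (*-cong p q) (*-identityˡ (- 1#)))
  sign-* (inj₂ p) (inj₁ q) = inj₂ (trans (*-cong p q) (*-identityʳ (- 1#)))
  sign-* (inj₂ p) (inj₂ q) = inj₁ (trans (*-cong p q) -1*-1≈1)

  sign-square : ∀ {u} → IsSign u → u * u ≈ 1#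
  sign-square (inj₁ p) = trans (*-cong p p) (*-identityˡ 1#)
  sign-square (inj₂ p) = trans (*-cong p p) -1*-1≈1

  ∣sign*∣ : ∀ {u x y} → IsSign u → 0# < y → x ≈ u * y → ∣ x ∣ ≈ y
  ∣sign*∣ {u} {x} {y} (inj₁ u≈1) 0<y eq with compare x 0# | trans eq (trans (*-congʳ u≈1) (*-identityˡ y))
  ... | tri< x<0 _ _ | x≈y = ⊥-elim (asym 0<y (<-respˡ x≈y x<0))
  ... | tri≈ _ _ _   | x≈y = x≈y
  ... | tri> _ _ _   | x≈y = x≈y
  ∣sign*∣ {u} {x} {y} (inj₂ u≈-1) 0<y eq with compare x 0# | trans eq (trans (*-congʳ u≈-1) (trans (sym (-‿distribˡ-* 1# y)) (-‿cong (*-identityˡ y))))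
  ... | tri< _ _ _   | x≈-y = trans (-‿cong x≈-y) (-‿involutive y)
  ... | tri≈ _ x≈0 _ | x≈-y = ⊥-elim (<⇒≉ (pos-neg 0<y) (trans (sym x≈-y) x≈0))
  ... | tri> _ _ 0<x | x≈-y = ⊥-elim (asym 0<x (<-respˡ (sym x≈-y) (pos-neg 0<y)))

  ι-sum : ∀ {n} (f : Fin n → ℤ) → ι (ℤΣ.sum f) ≈ sum (ι ∘ f)
  ι-sum {zero}  f = refl
  ι-sum {suc n} f = trans (ι-+ (f zero) _) (+-congˡ (ι-sum (f ∘ suc)))

  ι-pos : ∀ n → 0# < ι (+ suc n)
  ι-pos zero    = <-respʳ (sym (+-identityʳ 1#)) 0<1
  ι-pos (suc n) = +-pos 0<1 (ι-pos n)

  ι-2 : ι (+ 2) ≈ 2#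
  ι-2 = +-congˡ (+-identityʳ 1#)

  ι2≉0 : ¬ (ι (+ 2) ≈ 0#)
  ι2≉0 eq = <⇒≉ (ι-pos 1) (sym eq)

  -- An ordered field has characteristic zero. This is how equations between integral determinants
  -- are brought back to ℤ.
  ι-injective₀ : ∀ k → ι k ≈ 0# → k ≡ 0ℤ
  ι-injective₀ (+ zero)  _  = ≡.refl
  ι-injective₀ (+ suc n) eq = ⊥-elim (<⇒≉ (ι-pos n) (sym eq))
  ι-injective₀ -[1+ n ]  eq = ⊥-elim (<⇒≉ (pos-neg (ι-pos n)) eq)

  ι-injective : ∀ j k → ι j ≈ ι k → j ≡ k
  ι-injective j k eq = ℤ.i-j≡0⇒i≡j j k (ι-injective₀ (j ℤ.- k) (begin
    ι (j ℤ.- k)        ≈⟨ ι-+ j (ℤ.- k) ⟩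
    ι j + ι (ℤ.- k)    ≈⟨ +-cong eq (ι-neg k) ⟩
    ι k + - ι k        ≈⟨ -‿inverseʳ _ ⟩
    0#                 ∎))

  IsInteger : Carrier → Set ℓ₁
  IsInteger x = ∃[ k ] x ≈ ι k

  integer-sum : ∀ {n} {f : Fin n → Carrier} → (∀ i → IsInteger (f i)) → IsInteger (sum f)
  integer-sum f∈ = ℤΣ.sum (proj₁ ∘ f∈) , trans (sum-cong-≋ (proj₂ ∘ f∈)) (sym (ι-sum (proj₁ ∘ f∈)))

  integer-* : ∀ {x y} → IsInteger x → IsInteger y → IsInteger (x * y)
  integer-* (j , p) (k , q) = j ℤ.* k , trans (*-cong p q) (sym (ι-* j k))

  integer-1 : IsInteger 1#
  integer-1 = 1ℤ , sym ι-1

  integer-neg : ∀ {x} → IsInteger x → IsInteger (- x)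
  integer-neg (k , p) = ℤ.- k , trans (-‿cong p) (sym (ι-neg k))

  integer-^ : ∀ {x} n → IsInteger x → IsInteger (x ^ n)
  integer-^ zero    p = integer-1
  integer-^ (suc n) p = integer-* p (integer-^ n p)

  -- The units of ℤ are 1 and -1: by injectivity of `ι` the equation holds in ℤ, and absolute values
  -- reduce it to a product of naturals equal to 1.
  integer-unit : ∀ {x y} → IsInteger x → IsInteger y → x * y ≈ 1# → IsSign x
  integer-unit {x} {y} (j , p) (k , q) eq
    with ℕ.m*n≡1⇒m≡1 ℤ.∣ j ∣ ℤ.∣ k ∣ (≡.trans (≡.sym (ℤ.abs-* j k)) (≡.cong ℤ.∣_∣ j*k≡1))
    where
    j*k≡1 : j ℤ.* k ≡ 1ℤ
    j*k≡1 = ι-injective (j ℤ.* k) 1ℤ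
      (trans (ι-* j k) (trans (*-cong (sym p) (sym q)) (trans eq (sym ι-1))))
  integer-unit {x} (+ .1 , p)        _ _ | ≡.refl = inj₁ (trans p ι-1)
  integer-unit {x} (-[1+ .0 ] , p)   _ _ | ≡.refl = inj₂ (trans p (-‿cong ι-1))

-- Determinants

-- `(punchIn j k , swapColumn j k)` is the pair of columns `(j , punchIn j k)` deleted in
-- the opposite order.
swapColumn : ∀ {n} → Fin (suc n) → Fin n → Fin n
swapColumn zero    zero    = zero
swapColumn zero    (suc k) = zero
swapColumn (suc j) zero    = j
swapColumn (suc j) (suc k) = suc (swapColumn j k)

punchIn-swapColumn : ∀ {n} (j : Fin (suc n)) (k : Fin n) → punchIn (punchIn j k) (swapColumn j k) ≡ j
punchIn-swapColumn zero    zero    = ≡.refl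
punchIn-swapColumn zero    (suc k) = ≡.refl
punchIn-swapColumn (suc j) zero    = ≡.refl
punchIn-swapColumn (suc j) (suc k) = ≡.cong suc (punchIn-swapColumn j k)

-- Deleting two columns in either order leaves the same columns in the same order, so the two minors
-- coincide.
punchIn-punchIn : ∀ {n} (j : Fin (suc (suc n))) (k : Fin (suc n)) (s : Fin n) →
                  punchIn (punchIn j k) (punchIn (swapColumn j k) s) ≡ punchIn j (punchIn k s)
punchIn-punchIn zero    zero    s       = ≡.refl
punchIn-punchIn zero    (suc k) s       = ≡.refl
punchIn-punchIn (suc j) zero    s       = ≡.refl
punchIn-punchIn (suc j) (suc k) zero    = ≡.refl
punchIn-punchIn (suc j) (suc k) (suc s) = ≡.cong suc (punchIn-punchIn j k s)

punchIn-↑ˡ : ∀ {n} m (j : Fin (suc n)) (s : Fin n) → punchIn (j ↑ˡ m) (s ↑ˡ m) ≡ punchIn j s ↑ˡ m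
punchIn-↑ˡ m zero    s       = ≡.refl
punchIn-↑ˡ m (suc j) zero    = ≡.refl
punchIn-↑ˡ m (suc j) (suc s) = ≡.cong suc (punchIn-↑ˡ m j s)

punchIn-↑ʳ : ∀ n {m} (j : Fin (suc n)) (s : Fin m) → punchIn (j ↑ˡ m) (n ↑ʳ s) ≡ suc n ↑ʳ s
punchIn-↑ʳ n       zero    s = ≡.refl
punchIn-↑ʳ (suc n) (suc j) s = ≡.cong suc (punchIn-↑ʳ n j s)

module Determinants {c ℓ₁ ℓ₂} (F : OrderedField c ℓ₁ ℓ₂) where
  open FieldProperties F

  Matrix : ℕ → ℕ → Set c
  Matrix n m = Fin n → Fin m → Carrier

  infix 4 _≋_
  _≋_ : ∀ {n m} → Matrix n m → Matrix n m → Set ℓ₁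
  A ≋ B = ∀ r s → A r s ≈ B r s

  infixl 7 _⊛_
  _⊛_ : ∀ {n m k} → Matrix n m → Matrix m k → Matrix n k
  (A ⊛ B) r s = sum (λ j → A r j * B j s)

  δ : ∀ {n} → Matrix n n
  δ i j = if does (i Fin.≟ j) then 1# else 0#

  sum-δ : ∀ {n} (f : Fin n → Carrier) i → sum (λ j → δ i j * f j) ≈ f i
  sum-δ f i = trans (sum-single i λ j j≢i → trans (*-congʳ (if-no (i Fin.≟ j) (j≢i ∘ ≡.sym))) (zeroˡ _))
                    (trans (*-congʳ (if-yes (i Fin.≟ i) ≡.refl)) (*-identityˡ _))

  sum-δʳ : ∀ {n} (f : Fin n → Carrier) i → sum (λ j → f j * δ j i) ≈ f i
  sum-δʳ f i = trans (sum-single i λ j j≢i → trans (*-congˡ (if-no (j Fin.≟ i) j≢i)) (zeroʳ _))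
                     (trans (*-congˡ (if-yes (i Fin.≟ i) ≡.refl)) (*-identityʳ _))

  sum-linear : ∀ {n} x y (f g : Fin n → Carrier) →
               sum (λ j → x * f j + y * g j) ≈ x * sum f + y * sum g
  sum-linear x y f g = begin
    sum (λ j → x * f j + y * g j)                  ≈⟨ ∑-distrib-+ (λ j → x * f j) (λ j → y * g j) ⟩
    sum (λ j → x * f j) + sum (λ j → y * g j)      ≈⟨ +-cong (*-distribˡ-sum x f) (*-distribˡ-sum y g) ⟨
    x * sum f + y * sum g                          ∎

  ⊛-assoc : ∀ {n m k l} (A : Matrix n m) (B : Matrix m k) (C : Matrix k l) → A ⊛ B ⊛ C ≋ A ⊛ (B ⊛ C)
  ⊛-assoc A B C r s = begin
    sum (λ j → sum (λ i → A r i * B i j) * C j s)     ≈⟨ sum-cong-≋ (λ j → *-distribʳ-sum (C j s) (λ i → A r i * B i j)) ⟩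
    sum (λ j → sum (λ i → A r i * B i j * C j s))     ≈⟨ ∑-comm (λ j i → A r i * B i j * C j s) ⟩
    sum (λ i → sum (λ j → A r i * B i j * C j s))     ≈⟨ sum-cong-≋ (λ i → sum-cong-≋ λ j → *-assoc (A r i) (B i j) (C j s)) ⟩
    sum (λ i → sum (λ j → A r i * (B i j * C j s)))   ≈⟨ sum-cong-≋ (λ i → *-distribˡ-sum (A r i) (λ j → B i j * C j s)) ⟨
    sum (λ i → A r i * sum (λ j → B i j * C j s))     ∎

  at-≡ : ∀ {m} {f g : Fin m → Carrier} → f ≡ g → ∀ s → f s ≈ g s
  at-≡ ≡.refl s = refl

  -- Additivity and homogeneity in a row are bundled into one linear combination. Matrices are
  -- compared entrywise, so respect for `≋` has to be a field.
  record Multilinear {n m} (χ : Matrix n m → Carrier) : Set (c ⊔ ℓ₁) where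
    field
      cong   : ∀ {A B} → A ≋ B → χ A ≈ χ B
      linear : ∀ i x y {A B C} → (∀ s → A i s ≈ x * B i s + y * C i s) →
               (∀ r → r ≢ i → ∀ s → A r s ≈ B r s) → (∀ r → r ≢ i → ∀ s → A r s ≈ C r s) →
               χ A ≈ x * χ B + y * χ C

    zero-row : ∀ i {A} → (∀ s → A i s ≈ 0#) → χ A ≈ 0#
    zero-row i {A} A≈0 = trans
      (linear i 0# 0# {A} {A} {A} (λ s → trans (A≈0 s) (sym 0*+0*)) (λ _ _ _ → refl) (λ _ _ _ → refl))
      0*+0*
      where
      0*+0* : ∀ {x y} → 0# * x + 0# * y ≈ 0#
      0*+0* = trans (+-cong (zeroˡ _) (zeroˡ _)) (+-identityˡ 0#)

    -- Put the sum of the two rows into both places and expand; the terms with equal rows vanish.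
    -- The alternating property is asked for the pair `i`, `j` alone, because `det-alternating-<`
    -- uses the lemma for rows 0 and 1 before other pairs are known.
    antisymmetric : ∀ {i j} → i ≢ j → (∀ {A} → (∀ s → A i s ≈ A j s) → χ A ≈ 0#) →
                    ∀ {A B} → (∀ s → A i s ≈ B j s) → (∀ s → A j s ≈ B i s) →
                    (∀ r → r ≢ i → r ≢ j → ∀ s → A r s ≈ B r s) → χ A ≈ - χ B
    antisymmetric {i} {j} i≢j alternating {A} {B} Ai Aj Ar = begin
      χ A                                     ≈⟨ cong A≈X ⟩
      χ (X u v)                               ≈⟨ solve 2 (λ a b → a := (a :+ b) :+ :- b) refl _ _ ⟩
      χ (X u v) + χ (X v u) + - χ (X v u)     ≈⟨ +-congʳ sum≈0 ⟩
      0# + - χ (X v u)                        ≈⟨ +-identityˡ _ ⟩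
      - χ (X v u)                             ≈⟨ -‿cong (cong X≈B) ⟩
      - χ B                                   ∎
      where
      u = A i
      v = A j
      w = λ s → u s + v s
      X : (Fin m → Carrier) → (Fin m → Carrier) → Matrix n m
      X p q r = if does (r Fin.≟ i) then p else if does (r Fin.≟ j) then q else A r
      X-i : ∀ p q → X p q i ≡ p
      X-i p q rewrite dec-true (i Fin.≟ i) ≡.refl = ≡.refl
      X-j : ∀ p q → X p q j ≡ q
      X-j p q rewrite dec-false (j Fin.≟ i) (i≢j ∘ ≡.sym) | dec-true (j Fin.≟ j) ≡.refl = ≡.refl
      A≈X : A ≋ X u v
      A≈X r with r Fin.≟ i | r Fin.≟ j
      ... | yes ≡.refl | _          = λ s → refl
      ... | no _       | yes ≡.refl = λ s → refl
      ... | no _       | no _       = λ s → refl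
      X≈B : X v u ≋ B
      X≈B r with r Fin.≟ i | r Fin.≟ j
      ... | yes ≡.refl | _          = Aj
      ... | no _       | yes ≡.refl = Ai
      ... | no r≢i     | no r≢j     = Ar r r≢i r≢j
      X≈0 : ∀ p → χ (X p p) ≈ 0#
      X≈0 p = alternating (at-≡ (≡.trans (X-i p p) (≡.sym (X-j p p))))
      1*+1* : ∀ x y → 1# * x + 1# * y ≈ x + y
      1*+1* x y = +-cong (*-identityˡ x) (*-identityˡ y)
      other-j : ∀ p q q′ r → r ≢ j → ∀ s → X p q r s ≈ X p q′ r s
      other-j p q q′ r r≢j with r Fin.≟ i | r Fin.≟ j
      ... | yes _ | _       = λ s → refl
      ... | no _  | yes r≡j = ⊥-elim (r≢j r≡j)
      ... | no _  | no _    = λ s → refl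
      other-i : ∀ p p′ q r → r ≢ i → ∀ s → X p q r s ≈ X p′ q r s
      other-i p p′ q r r≢i with r Fin.≟ i
      ... | yes r≡i = ⊥-elim (r≢i r≡i)
      ... | no _    = λ s → refl
      split-i : ∀ q → χ (X w q) ≈ χ (X u q) + χ (X v q)
      split-i q = trans (linear i 1# 1#
        (λ s → trans (at-≡ (X-i w q) s) (sym (trans (1*+1* _ _) (+-cong (at-≡ (X-i u q) s) (at-≡ (X-i v q) s)))))
        (other-i w u q) (other-i w v q)) (1*+1* _ _)
      split-j : ∀ p → χ (X p w) ≈ χ (X p u) + χ (X p v)
      split-j p = trans (linear j 1# 1#
        (λ s → trans (at-≡ (X-j p w) s) (sym (trans (1*+1* _ _) (+-cong (at-≡ (X-j p u) s) (at-≡ (X-j p v) s)))))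
        (other-j p w u) (other-j p w v)) (1*+1* _ _)
      sum≈0 : χ (X u v) + χ (X v u) ≈ 0#
      sum≈0 = begin
        χ (X u v) + χ (X v u)
          ≈⟨ +-cong (+-identityˡ _) (+-identityʳ _) ⟨
        (0# + χ (X u v)) + (χ (X v u) + 0#)
          ≈⟨ +-cong (+-congʳ (X≈0 u)) (+-congˡ (X≈0 v)) ⟨
        (χ (X u u) + χ (X u v)) + (χ (X v u) + χ (X v v))
          ≈⟨ +-cong (split-j u) (split-j v) ⟨
        χ (X u w) + χ (X v w)
          ≈⟨ split-i w ⟨
        χ (X w w)
          ≈⟨ X≈0 w ⟩
        0# ∎

  open Multilinear

  multilinear-tail : ∀ {n m} {χ : Matrix (suc n) m → Carrier} v → Multilinear χ → Multilinear (χ ∘ (v ∷ᵥ_))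
  multilinear-tail v χ-lin .cong A≋B = χ-lin .cong λ { zero s → refl ; (suc r) → A≋B r }
  multilinear-tail v χ-lin .linear i x y eq B C = χ-lin .linear (suc i) x y eq (other B) (other C)
    where
    other : ∀ {A B} → (∀ r → r ≢ i → ∀ s → A r s ≈ B r s) →
            ∀ r → r ≢ suc i → ∀ s → (v ∷ᵥ A) r s ≈ (v ∷ᵥ B) r s
    other eq zero    _  s = refl
    other eq (suc r) ne s = eq r (ne ∘ ≡.cong suc) s

  combination-row-zero : ∀ {n m k} {χ : Matrix (suc n) m → Carrier} → Multilinear χ →
    ∀ (a : Fin k → Carrier) (w : Fin k → Fin m → Carrier) R → (∀ j → χ (w j ∷ᵥ R) ≈ 0#) →
    ∀ v → (∀ s → v s ≈ sum (λ j → a j * w j s)) → χ (v ∷ᵥ R) ≈ 0#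
  combination-row-zero {k = zero}  χ-lin a w R χ≈0 v eq = zero-row χ-lin zero eq
  combination-row-zero {k = suc k} {χ} χ-lin a w R χ≈0 v eq = begin
    χ (v ∷ᵥ R)
      ≈⟨ χ-lin .linear zero (a zero) 1# (λ s → trans (eq s) (+-congˡ (sym (*-identityˡ _))))
           (λ { zero ne → ⊥-elim (ne ≡.refl) ; (suc r) _ s → refl })
           (λ { zero ne → ⊥-elim (ne ≡.refl) ; (suc r) _ s → refl }) ⟩
    a zero * χ (w zero ∷ᵥ R) + 1# * χ (v′ ∷ᵥ R)
      ≈⟨ +-cong (*-congˡ (χ≈0 zero)) (*-congˡ (combination-row-zero χ-lin (a ∘ suc) (w ∘ suc) R (χ≈0 ∘ suc) v′ λ s → refl)) ⟩
    a zero * 0# + 1# * 0#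
      ≈⟨ +-cong (zeroʳ _) (zeroʳ _) ⟩
    0# + 0#
      ≈⟨ +-identityˡ 0# ⟩
    0# ∎
    where
    v′ : Fin _ → Carrier
    v′ s = sum (λ j → a (suc j) * w (suc j) s)

  -- Expanding every row in the standard basis reduces any matrix to those whose rows are basis
  -- vectors.
  multilinear-zero : ∀ {n m} {χ : Matrix n m → Carrier} → Multilinear χ →
                     (∀ (s : Fin n → Fin m) → χ (δ ∘ s) ≈ 0#) → ∀ A → χ A ≈ 0#
  multilinear-zero {zero}  χ-lin χ≈0 A = trans (χ-lin .cong λ ()) (χ≈0 λ ())
  multilinear-zero {suc n} {m} {χ} χ-lin χ≈0 A = trans (χ-lin .cong λ { zero s → refl ; (suc r) s → refl })
    (combination-row-zero χ-lin (A zero) δ (A ∘ suc) basis (A zero) λ s → sym (sum-δʳ (A zero) s))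
    where
    basis : ∀ j → χ (δ j ∷ᵥ (A ∘ suc)) ≈ 0#
    basis j = multilinear-zero (multilinear-tail (δ j) χ-lin)
      (λ s → trans (χ-lin .cong λ { zero _ → refl ; (suc r) _ → refl }) (χ≈0 (j ∷ᵥ s))) (A ∘ suc)

  Alternating : ∀ {n m} → (Matrix n m → Carrier) → Set (c ⊔ ℓ₁)
  Alternating χ = ∀ {A} i j → i ≢ j → (∀ s → A i s ≈ A j s) → χ A ≈ 0#

  -- With fewer basis vectors than rows, two of the basis rows agree. This later forces two bases of
  -- a lattice to have the same size.
  too-many-rows : ∀ {n m} {χ : Matrix n m → Carrier} → Multilinear χ → Alternating χ →
                  m ℕ.< n → ∀ A → χ A ≈ 0#
  too-many-rows χ-lin χ-alt m<n = multilinear-zero χ-lin λ s →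
    let i , j , i<j , eq = Fin.pigeonhole m<n s
    in χ-alt i j (Fin.<⇒≢ i<j) (at-≡ (≡.cong δ eq))

  -- Sorting: the k-th step brings the row equal to δ k, if there is one, to position k.
  -- If there is none, two rows are equal.
  basis-zero : ∀ {n} {χ : Matrix n n → Carrier} → Multilinear χ → Alternating χ → χ δ ≈ 0# →
               ∀ j k → j ℕ.+ k ≡ n → (s : Fin n → Fin n) → (∀ r → toℕ r ℕ.< k → s r ≡ r) →
               χ (δ ∘ s) ≈ 0#
  basis-zero χ-lin χ-alt χδ zero k ≡.refl s fix =
    trans (χ-lin .cong λ r → at-≡ (≡.cong δ (fix r (Fin.toℕ<n r)))) χδ
  basis-zero {n} {χ} χ-lin χ-alt χδ (suc j) k eq s fix = search n k<n ≡.refl (Fin.any? (λ i → s i Fin.≟ k′))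
    where
    k<n : k ℕ.< n
    k<n = ≡.subst (k ℕ.<_) eq (ℕ.s≤s (ℕ.m≤n+m k j))
    k′ = fromℕ< k<n
    next : (s′ : Fin n → Fin n) → (∀ r → toℕ r ℕ.< suc k → s′ r ≡ r) → χ (δ ∘ s′) ≈ 0#
    next = basis-zero χ-lin χ-alt χδ j (suc k) (≡.trans (ℕ.+-suc j k) eq)
    next-or-k : ∀ r → toℕ r ℕ.< suc k → toℕ r ℕ.< k ⊎ r ≡ k′
    next-or-k r r<1+k with ℕ.m≤n⇒m<n∨m≡n (ℕ.s≤s⁻¹ r<1+k)
    ... | inj₁ r<k = inj₁ r<k
    ... | inj₂ r≡k = inj₂ (Fin.toℕ-injective (≡.trans r≡k (≡.sym (Fin.toℕ-fromℕ< k<n))))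
    -- Writing `n` as `suc m` makes `punchOut` available. If no row hits `k′`, then `s` takes values
    -- in `m` places only, and the pigeonhole principle yields two equal rows.
    search : ∀ m → k ℕ.< m → m ≡ n → Dec (∃ λ i → s i ≡ k′) → χ (δ ∘ s) ≈ 0#
    search (suc m) _ ≡.refl (no none) =
      let i , i′ , i<i′ , same = Fin.pigeonhole (ℕ.n<1+n m) (λ i → punchOut (λ k≡ → none (i , ≡.sym k≡)))
      in χ-alt i i′ (Fin.<⇒≢ i<i′) (at-≡ (≡.cong δ (Fin.punchOut-injective {i = k′} _ _ same)))
    search _ _ _ (yes (i , si≡k)) with i Fin.≟ k′
    ... | yes ≡.refl = next s λ r r<1+k → fixed r (next-or-k r r<1+k)
      where
      fixed : ∀ r → toℕ r ℕ.< k ⊎ r ≡ k′ → s r ≡ r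
      fixed r (inj₁ r<k)    = fix r r<k
      fixed r (inj₂ ≡.refl) = si≡k
    ... | no i≢k = begin
      χ (δ ∘ s)      ≈⟨ antisymmetric χ-lin i≢k (χ-alt _ _ i≢k) (at-≡ (≡.cong δ (≡.trans si≡k (≡.sym s′k))))
                          (at-≡ (≡.cong δ (≡.sym s′i)))
                          (λ r r≢i r≢k → at-≡ (≡.cong δ (≡.sym (s′r r r≢i r≢k)))) ⟩
      - χ (δ ∘ s′)   ≈⟨ -‿cong (next s′ λ r r<1+k → fixed r (next-or-k r r<1+k)) ⟩
      - 0#           ≈⟨ -0#≈0# ⟩
      0#             ∎
      where
      s′ : Fin n → Fin n
      s′ r = if does (r Fin.≟ k′) then k′ else if does (r Fin.≟ i) then s k′ else s r
      s′k : s′ k′ ≡ k′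
      s′k rewrite dec-true (k′ Fin.≟ k′) ≡.refl = ≡.refl
      s′i : s′ i ≡ s k′
      s′i rewrite dec-false (i Fin.≟ k′) i≢k | dec-true (i Fin.≟ i) ≡.refl = ≡.refl
      s′r : ∀ r → r ≢ i → r ≢ k′ → s′ r ≡ s r
      s′r r r≢i r≢k rewrite dec-false (r Fin.≟ k′) r≢k | dec-false (r Fin.≟ i) r≢i = ≡.refl
      fixed : ∀ r → toℕ r ℕ.< k ⊎ r ≡ k′ → s′ r ≡ r
      fixed r (inj₂ ≡.refl) = s′k
      fixed r (inj₁ r<k) = ≡.trans (s′r r r≢i r≢k) (fix r r<k)
        where
        r≢k : r ≢ k′
        r≢k ≡.refl = ℕ.<-irrefl (Fin.toℕ-fromℕ< k<n) r<k
        r≢i : r ≢ i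
        r≢i ≡.refl = r≢k (≡.trans (≡.sym (fix r r<k)) si≡k)

  -- Uniqueness of the determinant, in the form of a vanishing criterion: it is applied to the
  -- difference of two alternating functions that agree at the identity.
  alternating-zero : ∀ {n} {χ : Matrix n n → Carrier} → Multilinear χ → Alternating χ → χ δ ≈ 0# →
                     ∀ A → χ A ≈ 0#
  alternating-zero {n} χ-lin χ-alt χδ = multilinear-zero χ-lin λ s →
    basis-zero χ-lin χ-alt χδ n 0 (ℕ.+-identityʳ n) s λ r ()

module DeterminantProperties {c ℓ₁ ℓ₂} (F : OrderedField c ℓ₁ ℓ₂) where
  open FieldProperties F
  open Determinants F
  open Multilinear

  sgn : ℕ → Carrier
  sgn k = (- 1#) ^ k

  minor : ∀ {n} → Matrix (suc n) (suc n) → Fin (suc n) → Matrix n n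
  minor M j r s = M (suc r) (punchIn j s)

  laplace : ∀ {n} → Matrix (suc n) (suc n) → Fin (suc n) → Carrier
  laplace M j = sgn (toℕ j) * (M zero j * det (minor M j))

  det-cong : ∀ {n} {A B : Matrix n n} → A ≋ B → det A ≈ det B
  det-cong {zero}  A≋B = refl
  det-cong {suc n} A≋B = sum-cong-≋ λ j →
    *-congˡ {sgn (toℕ j)} (*-cong (A≋B zero j) (det-cong λ r s → A≋B (suc r) (punchIn j s)))

  det-linear : ∀ {n} i x y {A B C : Matrix n n} → (∀ s → A i s ≈ x * B i s + y * C i s) →
               (∀ r → r ≢ i → ∀ s → A r s ≈ B r s) → (∀ r → r ≢ i → ∀ s → A r s ≈ C r s) →
               det A ≈ x * det B + y * det C
  det-linear {suc n} i x y {A} {B} {C} Ai AB AC = trans (sum-cong-≋ (λ j → expand i Ai AB AC j))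
    (sum-linear x y (laplace B) (laplace C))
    where
    expand : ∀ i → (∀ s → A i s ≈ x * B i s + y * C i s) →
             (∀ r → r ≢ i → ∀ s → A r s ≈ B r s) → (∀ r → r ≢ i → ∀ s → A r s ≈ C r s) →
             ∀ j → sgn (toℕ j) * (A zero j * det (minor A j)) ≈
                   x * (sgn (toℕ j) * (B zero j * det (minor B j))) +
                   y * (sgn (toℕ j) * (C zero j * det (minor C j)))
    expand zero Ai AB AC j = begin
      sgn (toℕ j) * (A zero j * det (minor A j))
        ≈⟨ *-congˡ (*-congʳ (Ai j)) ⟩
      sgn (toℕ j) * ((x * B zero j + y * C zero j) * det (minor A j))
        ≈⟨ solve 6 (λ σ x y b c d → σ :* ((x :* b :+ y :* c) :* d) := x :* (σ :* (b :* d)) :+ y :* (σ :* (c :* d))) refl (sgn (toℕ j)) x y _ _ _ ⟩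
      x * (sgn (toℕ j) * (B zero j * det (minor A j))) + y * (sgn (toℕ j) * (C zero j * det (minor A j)))
        ≈⟨ +-cong (*-congˡ (*-congˡ (*-congˡ (det-cong λ r s → AB (suc r) (λ ()) (punchIn j s)))))
                  (*-congˡ (*-congˡ (*-congˡ (det-cong λ r s → AC (suc r) (λ ()) (punchIn j s))))) ⟩
      x * (sgn (toℕ j) * (B zero j * det (minor B j))) + y * (sgn (toℕ j) * (C zero j * det (minor C j))) ∎
    expand (suc i) Ai AB AC j = begin
      sgn (toℕ j) * (A zero j * det (minor A j))
        ≈⟨ *-congˡ (*-congˡ (det-linear i x y (λ s → Ai (punchIn j s))
             (λ r r≢i s → AB (suc r) (r≢i ∘ Fin.suc-injective) (punchIn j s))
             (λ r r≢i s → AC (suc r) (r≢i ∘ Fin.suc-injective) (punchIn j s)))) ⟩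
      sgn (toℕ j) * (A zero j * (x * det (minor B j) + y * det (minor C j)))
        ≈⟨ solve 6 (λ σ x y a b c → σ :* (a :* (x :* b :+ y :* c)) := x :* (σ :* (a :* b)) :+ y :* (σ :* (a :* c))) refl (sgn (toℕ j)) x y _ _ _ ⟩
      x * (sgn (toℕ j) * (A zero j * det (minor B j))) + y * (sgn (toℕ j) * (A zero j * det (minor C j)))
        ≈⟨ +-cong (*-congˡ (*-congˡ (*-congʳ (AB zero (λ ()) j)))) (*-congˡ (*-congˡ (*-congʳ (AC zero (λ ()) j)))) ⟩
      x * (sgn (toℕ j) * (B zero j * det (minor B j))) + y * (sgn (toℕ j) * (C zero j * det (minor C j))) ∎

  det-multilinear : ∀ {n} → Multilinear (det {n})
  det-multilinear = record { cong = det-cong ; linear = det-linear }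

  -- `G` is antisymmetric under exchanging the two deleted columns. The induction splits off the
  -- pairs that involve column 0 and cancels them directly, so no division by two occurs.
  sum-swapColumn : ∀ n (G : Fin (suc n) → Fin n → Carrier) →
                   (∀ j k → G j k + G (punchIn j k) (swapColumn j k) ≈ 0#) →
                   sum (λ j → sum (G j)) ≈ 0#
  sum-swapColumn zero    G G≈0 = +-identityˡ 0#
  sum-swapColumn (suc n) G G≈0 = begin
    sum (G zero) + sum (λ j → G (suc j) zero + sum (G (suc j) ∘ suc))
      ≈⟨ +-congˡ (∑-distrib-+ (λ j → G (suc j) zero) (λ j → sum (G (suc j) ∘ suc))) ⟩
    sum (G zero) + (sum (λ j → G (suc j) zero) + sum (λ j → sum (G (suc j) ∘ suc)))
      ≈⟨ +-congˡ (trans (+-congˡ (sum-swapColumn n (λ j k → G (suc j) (suc k)) λ j k → G≈0 (suc j) (suc k))) (+-identityʳ _)) ⟩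
    sum (G zero) + sum (λ j → G (suc j) zero)
      ≈⟨ ∑-distrib-+ (G zero) (λ j → G (suc j) zero) ⟨
    sum (λ j → G zero j + G (suc j) zero)
      ≈⟨ sum-zero border ⟩
    0# ∎
    where
    border : ∀ j → G zero j + G (suc j) zero ≈ 0#
    border zero    = G≈0 zero zero
    border (suc j) = G≈0 zero (suc j)

  -- If `k` lies before `j`, the new positions are k and j - 1; otherwise they are k + 1 and j. In
  -- both cases the sum of positions changes by one.
  sgn-swapColumn : ∀ {n} (j : Fin (suc n)) (k : Fin n) →
    sgn (toℕ (punchIn j k)) * sgn (toℕ (swapColumn j k)) ≈ - (sgn (toℕ j) * sgn (toℕ k))
  sgn-swapColumn zero    zero    = trans (*-identityʳ _) (solve 1 (λ o → :- o :* o := :- (o :* o)) refl 1#)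
  sgn-swapColumn zero    (suc k) = trans (*-identityʳ _) (solve 2 (λ o x → :- o :* (:- o :* x) := :- (o :* (:- o :* x))) refl 1# (sgn (toℕ k)))
  sgn-swapColumn (suc j) zero    = trans (*-congʳ (sym (*-identityˡ 1#))) (solve 2 (λ o x → (o :* o) :* x := :- ((:- o :* x) :* o)) refl 1# (sgn (toℕ j)))
  sgn-swapColumn (suc j) (suc k) = trans (solve 3 (λ o a b → (:- o :* a) :* (:- o :* b) := (o :* o) :* (a :* b)) refl 1# _ _)
    (trans (*-congˡ (sgn-swapColumn j k)) (solve 3 (λ o a b → (o :* o) :* (:- (a :* b)) := :- ((:- o :* a) :* (:- o :* b))) refl 1# (sgn (toℕ j)) (sgn (toℕ k))))

  -- Two Laplace expansions give a sum over ordered pairs of distinct columns. With equal top rows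
  -- the two orders of a pair differ only in sign.
  det-equal-01 : ∀ {n} {A : Matrix (suc (suc n)) (suc (suc n))} →
                 (∀ s → A zero s ≈ A (suc zero) s) → det A ≈ 0#
  det-equal-01 {n} {A} eq = trans (sum-cong-≋ expand) (sum-swapColumn (suc n) G cancel)
    where
    D : Fin (suc (suc n)) → Fin (suc n) → Carrier
    D j k = det λ r s → A (suc (suc r)) (punchIn j (punchIn k s))
    G : Fin (suc (suc n)) → Fin (suc n) → Carrier
    G j k = (sgn (toℕ j) * sgn (toℕ k)) * ((A zero j * A zero (punchIn j k)) * D j k)
    expand : ∀ j → sgn (toℕ j) * (A zero j * det (minor A j)) ≈ sum (G j)
    expand j = begin
      sgn (toℕ j) * (A zero j * sum (λ k → sgn (toℕ k) * (A (suc zero) (punchIn j k) * D j k)))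
        ≈⟨ *-assoc _ _ _ ⟨
      sgn (toℕ j) * A zero j * sum (λ k → sgn (toℕ k) * (A (suc zero) (punchIn j k) * D j k))
        ≈⟨ *-distribˡ-sum _ (λ k → sgn (toℕ k) * (A (suc zero) (punchIn j k) * D j k)) ⟩
      sum (λ k → sgn (toℕ j) * A zero j * (sgn (toℕ k) * (A (suc zero) (punchIn j k) * D j k)))
        ≈⟨ sum-cong-≋ (λ k → trans (*-congˡ (*-congˡ (*-congʳ (sym (eq (punchIn j k))))))
             (solve 5 (λ σ a τ b d → σ :* a :* (τ :* (b :* d)) := (σ :* τ) :* ((a :* b) :* d)) refl (sgn (toℕ j)) (A zero j) (sgn (toℕ k)) (A zero (punchIn j k)) (D j k))) ⟩
      sum (G j) ∎
    cancel : ∀ j k → G j k + G (punchIn j k) (swapColumn j k) ≈ 0#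
    cancel j k = begin
      G j k + G (punchIn j k) (swapColumn j k)
        ≈⟨ +-congˡ (*-cong (sgn-swapColumn j k) (*-cong
             (*-congˡ (reflexive (≡.cong (A zero) (punchIn-swapColumn j k))))
             (det-cong λ r s → reflexive (≡.cong (A (suc (suc r))) (punchIn-punchIn j k s))))) ⟩
      G j k + - (sgn (toℕ j) * sgn (toℕ k)) * ((A zero (punchIn j k) * A zero j) * D j k)
        ≈⟨ solve 4 (λ σ a b d → σ :* ((a :* b) :* d) :+ :- σ :* ((b :* a) :* d) := con 0ℤ) refl _ _ _ _ ⟩
      0# ∎

  det-minors-zero : ∀ {n} {A : Matrix (suc n) (suc n)} → (∀ j → det (minor A j) ≈ 0#) → det A ≈ 0#
  det-minors-zero {A = A} minors≈0 = sum-zero {f = laplace A} λ j →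
    trans (*-congˡ (trans (*-congˡ (minors≈0 j)) (zeroʳ _))) (zeroʳ _)

  -- If both rows lie below the first, they survive in every minor. If one is row 0 and the other is
  -- not row 1, exchanging rows 0 and 1 moves both below the first.
  det-alternating-< : ∀ {n} (A : Matrix n n) i j → i Fin.< j → (∀ s → A i s ≈ A j s) → det A ≈ 0#
  det-alternating-< {suc n} A (suc i) (suc j) (ℕ.s≤s i<j) eq = det-minors-zero {A = A} λ k →
    det-alternating-< (minor A k) i j i<j λ s → eq (punchIn k s)
  det-alternating-< {suc (suc n)} A zero (suc zero) _ eq = det-equal-01 {A = A} eq
  det-alternating-< {suc (suc n)} A zero (suc (suc j)) _ eq = begin
    det A       ≈⟨ antisymmetric det-multilinear {zero} {suc zero} (λ ()) (λ {M} → det-equal-01 {A = M}) {A} {B}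
                     (λ s → refl) (λ s → refl)
                     (λ { zero ne _ _ → ⊥-elim (ne ≡.refl) ; (suc zero) _ ne _ → ⊥-elim (ne ≡.refl) ; (suc (suc r)) _ _ _ → refl }) ⟩
    - det B     ≈⟨ -‿cong (det-minors-zero {A = B} λ k →
                     det-alternating-< (minor B k) zero (suc j) (ℕ.s≤s ℕ.z≤n) λ s → eq (punchIn k s)) ⟩
    - 0#        ≈⟨ -0#≈0# ⟩
    0#          ∎
    where
    B : Matrix (suc (suc n)) (suc (suc n))
    B = A (suc zero) ∷ᵥ A zero ∷ᵥ λ r → A (suc (suc r))

  det-alternating : ∀ {n} → Alternating (det {n})
  det-alternating {A = A} i j i≢j eq with Fin.<-cmp i j
  ... | tri< i<j _ _ = det-alternating-< A i j i<j eq
  ... | tri≈ _ i≡j _ = ⊥-elim (i≢j i≡j)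
  ... | tri> _ _ j<i = det-alternating-< A j i j<i (λ s → sym (eq s))

  ⊛-multilinear : ∀ {n m k} {χ : Matrix n k → Carrier} → Multilinear χ → (B : Matrix m k) →
                  Multilinear (λ A → χ (A ⊛ B))
  ⊛-multilinear χ-lin B .cong eq = χ-lin .cong λ r s → sum-cong-≋ λ j → *-congʳ (eq r j)
  ⊛-multilinear χ-lin B .linear i x y {A} {A₁} {A₂} Ai A₁r A₂r = χ-lin .linear i x y
    (λ s → trans (sum-cong-≋ λ j → trans (*-congʳ (Ai j))
                    (solve 5 (λ x y a b z → (x :* a :+ y :* b) :* z := x :* (a :* z) :+ y :* (b :* z)) refl x y _ _ _))
                 (sum-linear x y (λ j → A₁ i j * B j s) (λ j → A₂ i j * B j s)))
    (λ r r≢i s → sum-cong-≋ λ j → *-congʳ (A₁r r r≢i j))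
    (λ r r≢i s → sum-cong-≋ λ j → *-congʳ (A₂r r r≢i j))

  ⊛-alternating : ∀ {n m k} {χ : Matrix n k → Carrier} → Alternating χ → (B : Matrix m k) →
                  Alternating (λ A → χ (A ⊛ B))
  ⊛-alternating χ-alt B i j i≢j eq = χ-alt i j i≢j λ s → sum-cong-≋ λ k → *-congʳ (eq k)

  +*-multilinear : ∀ {n m} {χ ψ : Matrix n m → Carrier} → Multilinear χ → Multilinear ψ → ∀ z →
                   Multilinear (λ A → χ A + z * ψ A)
  +*-multilinear χ-lin ψ-lin z .cong eq = +-cong (χ-lin .cong eq) (*-congˡ (ψ-lin .cong eq))
  +*-multilinear χ-lin ψ-lin z .linear i x y Ai Ar₁ Ar₂ =
    trans (+-cong (χ-lin .linear i x y Ai Ar₁ Ar₂) (*-congˡ (ψ-lin .linear i x y Ai Ar₁ Ar₂)))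
          (solve 7 (λ x y z a b c d → (x :* a :+ y :* b) :+ z :* (x :* c :+ y :* d) := x :* (a :+ z :* c) :+ y :* (b :+ z :* d))
                 refl x y z _ _ _ _)

  det-δ : ∀ {n} → det (δ {n}) ≈ 1#
  det-δ {zero}  = refl
  det-δ {suc n} = begin
    det (δ {suc n})
      ≈⟨ sum-single {f = laplace (δ {suc n})} zero (λ j j≢0 → trans (*-congˡ (trans (*-congʳ (if-no (zero Fin.≟ j) (j≢0 ∘ ≡.sym))) (zeroˡ _))) (zeroʳ _)) ⟩
    1# * (1# * det (minor (δ {suc n}) zero))
      ≈⟨ trans (*-identityˡ _) (*-identityˡ _) ⟩
    det (minor (δ {suc n}) zero)
      ≈⟨ det-cong {n} {minor (δ {suc n}) zero} {δ {n}} (λ r s → refl) ⟩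
    det (δ {n})
      ≈⟨ det-δ {n} ⟩
    1# ∎

  δ-⊛ : ∀ {n m} (B : Matrix n m) → δ ⊛ B ≋ B
  δ-⊛ B r s = sum-δ (λ j → B j s) r

  -- As a function of `A`, the difference of the two sides is multilinear and alternating, and it is
  -- zero at the identity.
  det-⊛ : ∀ {n} (A B : Matrix n n) → det (A ⊛ B) ≈ det A * det B
  det-⊛ {n} A B = begin
    det (A ⊛ B)
      ≈⟨ solve 3 (λ x a b → x := (x :+ :- b :* a) :+ a :* b) refl _ (det A) (det B) ⟩
    (det (A ⊛ B) + - det B * det A) + det A * det B
      ≈⟨ +-congʳ (alternating-zero
           (+*-multilinear (⊛-multilinear det-multilinear B) det-multilinear (- det B))
           (λ {M} i j i≢j eq → trans (+-cong (⊛-alternating (det-alternating) B {M} i j i≢j eq)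
                                  (trans (*-congˡ (det-alternating i j i≢j eq)) (zeroʳ _))) (+-identityˡ 0#))
           at-δ A) ⟩
    0# + det A * det B
      ≈⟨ +-identityˡ _ ⟩
    det A * det B ∎
    where
    at-δ : det (δ ⊛ B) + - det B * det (δ {n}) ≈ 0#
    at-δ = begin
      det (δ ⊛ B) + - det B * det (δ {n})   ≈⟨ +-cong (det-cong (δ-⊛ B)) (*-congˡ (det-δ {n})) ⟩
      det B + - det B * 1#            ≈⟨ +-congˡ (*-identityʳ _) ⟩
      det B + - det B                 ≈⟨ -‿inverseʳ _ ⟩
      0#                              ∎

  -- As a function of the rows of `A`, `det (A ⊛ B)` is alternating. With more rows than columns it
  -- would vanish, whereas its value is `det δ`.
  ⊛≋δ⇒≤ : ∀ {n m} (A : Matrix n m) (B : Matrix m n) → A ⊛ B ≋ δ → n ℕ.≤ m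
  ⊛≋δ⇒≤ {n} {m} A B AB≋δ with n ℕ.≤? m
  ... | yes n≤m = n≤m
  ... | no  n≰m = ⊥-elim (1≉0 (begin
    1#            ≈⟨ det-δ {n} ⟨
    det (δ {n})   ≈⟨ det-cong AB≋δ ⟨
    det (A ⊛ B)   ≈⟨ too-many-rows (⊛-multilinear det-multilinear B) (λ {M} → ⊛-alternating det-alternating B {M}) (ℕ.≰⇒> n≰m) A ⟩
    0#            ∎))

  -- Expansion along the top rows meets only the columns of `A`, since the entries to their right
  -- vanish; the lower left block never enters, and `D` stays intact in every minor.
  det-block : ∀ {n m} (M : Matrix (n ℕ.+ m) (n ℕ.+ m)) (A : Matrix n n) (D : Matrix m m) →
              (∀ i j → M (i ↑ˡ m) (j ↑ˡ m) ≈ A i j) → (∀ i j → M (i ↑ˡ m) (n ↑ʳ j) ≈ 0#) →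
              (∀ i j → M (n ↑ʳ i) (n ↑ʳ j) ≈ D i j) → det M ≈ det A * det D
  det-block {zero}      M A D M≈A M≈0 M≈D = trans (det-cong M≈D) (sym (*-identityˡ _))
  det-block {suc n} {m} M A D M≈A M≈0 M≈D = begin
    det M
      ≈⟨ sum-↑ (suc n) (laplace M) ⟩
    sum (laplace M ∘ (_↑ˡ m)) + sum (laplace M ∘ (suc n ↑ʳ_))
      ≈⟨ +-cong (sum-cong-≋ left) (sum-zero λ j → trans (*-congˡ (trans (*-congʳ (M≈0 zero j)) (zeroˡ _))) (zeroʳ _)) ⟩
    sum (λ j → laplace A j * det D) + 0#
      ≈⟨ +-identityʳ _ ⟩
    sum (λ j → laplace A j * det D)
      ≈⟨ *-distribʳ-sum (det D) (laplace A) ⟨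
    det A * det D ∎
    where
    left : ∀ j → laplace M (j ↑ˡ m) ≈ laplace A j * det D
    left j = begin
      sgn (toℕ (j ↑ˡ m)) * (M zero (j ↑ˡ m) * det (minor M (j ↑ˡ m)))
        ≈⟨ *-cong (reflexive (≡.cong sgn (Fin.toℕ-↑ˡ j m))) (*-cong (M≈A zero j)
             (det-block (minor M (j ↑ˡ m)) (minor A j) D
               (λ r s → trans (reflexive (≡.cong (M (suc r ↑ˡ m)) (punchIn-↑ˡ m j s))) (M≈A (suc r) (punchIn j s)))
               (λ r s → trans (reflexive (≡.cong (M (suc r ↑ˡ m)) (punchIn-↑ʳ n j s))) (M≈0 (suc r) s))
               (λ r s → trans (reflexive (≡.cong (M (suc n ↑ʳ r)) (punchIn-↑ʳ n j s))) (M≈D r s)))) ⟩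
      sgn (toℕ j) * (A zero j * (det (minor A j) * det D))
        ≈⟨ solve 4 (λ σ a b d → σ :* (a :* (b :* d)) := σ :* (a :* b) :* d) refl (sgn (toℕ j)) _ _ _ ⟩
      laplace A j * det D ∎

  det-scale : ∀ {n m} x (A B : Matrix (n ℕ.+ m) (n ℕ.+ m)) →
              (∀ i s → A (i ↑ˡ m) s ≈ x * B (i ↑ˡ m) s) → (∀ i s → A (n ↑ʳ i) s ≈ B (n ↑ʳ i) s) →
              det A ≈ x ^ n * det B
  det-scale {zero}  x A B _     lower = trans (det-cong lower) (sym (*-identityˡ _))
  det-scale {suc n} x A B upper lower = begin
    sum (laplace A)
      ≈⟨ sum-cong-≋ (λ j → trans (*-congˡ (*-cong (upper zero j) (det-scale {n} x (minor A j) (minor B j)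
            (λ i s → upper (suc i) (punchIn j s)) (λ i s → lower i (punchIn j s)))))
           (solve 5 (λ σ x b y d → σ :* ((x :* b) :* (y :* d)) := (x :* y) :* (σ :* (b :* d))) refl (sgn (toℕ j)) x _ (x ^ n) _)) ⟩
    sum (λ j → x ^ suc n * laplace B j)
      ≈⟨ *-distribˡ-sum (x ^ suc n) (laplace B) ⟨
    x ^ suc n * det B ∎

  det-zero-column : ∀ {n} {M : Matrix (suc n) (suc n)} → (∀ r → M r zero ≈ 0#) → det M ≈ 0#
  det-zero-column {zero} {M} M≈0 = trans (+-identityʳ _) (trans (*-congˡ (trans (*-congʳ (M≈0 zero)) (zeroˡ _))) (zeroʳ _))
  det-zero-column {suc n} {M} M≈0 = sum-zero {f = laplace M} λ where
    zero    → trans (*-congˡ (trans (*-congʳ (M≈0 zero)) (zeroˡ _))) (zeroʳ _)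
    (suc j) → trans (*-congˡ (trans (*-congˡ (det-zero-column {M = minor M (suc j)} λ r → M≈0 (suc r))) (zeroʳ _))) (zeroʳ _)

  -- The expansion runs along the first row, so the other terms die for a different reason: their
  -- minors keep the first column, which is zero there.
  det-first-column : ∀ {n} {M : Matrix (suc n) (suc n)} → (∀ r → M (suc r) zero ≈ 0#) →
                     det M ≈ M zero zero * det (λ r s → M (suc r) (suc s))
  det-first-column {zero} {M} _ = trans (+-identityʳ _) (*-identityˡ _)
  det-first-column {suc n} {M} M≈0 = trans
    (sum-single {suc (suc n)} {f = laplace M} zero λ { zero ne → ⊥-elim (ne ≡.refl)
                       ; (suc j) _ → trans (*-congˡ (trans (*-congˡ (det-zero-column {M = minor M (suc j)} M≈0)) (zeroʳ _))) (zeroʳ _) })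
    (*-identityˡ _)

  det-integer : ∀ {n} {A : Matrix n n} → (∀ r s → IsInteger (A r s)) → IsInteger (det A)
  det-integer {zero}  A∈ = integer-1
  det-integer {suc n} A∈ = integer-sum λ j →
    integer-* (integer-^ (toℕ j) (integer-neg integer-1))
              (integer-* (A∈ zero j) (det-integer λ r s → A∈ (suc r) (punchIn j s)))

  det-unimodular : ∀ {n} {A B : Matrix n n} → (∀ r s → IsInteger (A r s)) → (∀ r s → IsInteger (B r s)) →
                   A ⊛ B ≋ δ → IsSign (det A)
  det-unimodular {n} {A} {B} A∈ B∈ AB≋δ = integer-unit (det-integer A∈) (det-integer B∈)
    (trans (sym (det-⊛ A B)) (trans (det-cong AB≋δ) (det-δ {n})))

  quadratic : ∀ {n} → Matrix n n → (Fin n → Carrier) → Carrier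
  quadratic M x = sum λ i → x i * sum λ j → M i j * x j

  PositiveDefinite : ∀ {n} → Matrix n n → Set (c ⊔ ℓ₁ ⊔ ℓ₂)
  PositiveDefinite M = ∀ x → (∃[ i ] ¬ (x i ≈ 0#)) → 0# < quadratic M x

  -- Row 0 clears the first column; the complement S is positive definite because every
  -- vector y extends to a vector x = (x₀ , y) with (M x)₀ = 0, for which M x = (0 , S y).
  det-positive : ∀ {n} (M : Matrix n n) → PositiveDefinite M → 0# < det M
  det-positive {zero}  M M-pd = 0<1
  det-positive {suc n} M M-pd = <-respʳ (sym det-M) (*-pos 0<a (det-positive S S-pd))
    where
    a = M zero zero
    0<a : 0# < a
    0<a = <-respʳ (trans (sum-δ (λ i → sum λ j → M i j * δ zero j) zero)
                         (trans (sum-cong-≋ λ j → *-comm (M zero j) (δ zero j)) (sum-δ (M zero) zero)))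
                  (M-pd (δ zero) (zero , 1≉0))
    a≉0 = <⇒≉ 0<a ∘ sym
    S : Matrix n n
    S r s = M (suc r) (suc s) + - (M (suc r) zero * a ⁻¹) * M zero (suc s)
    -- `U` performs the elimination: from each lower row it subtracts the multiple of row 0 that
    -- clears the first entry. It is lower triangular with unit diagonal.
    U : Matrix (suc n) (suc n)
    U = δ zero ∷ᵥ λ r → - (M (suc r) zero * a ⁻¹) ∷ᵥ δ r
    det-U : det U ≈ 1#
    det-U = trans (det-block {1} U δ δ (λ { zero zero → refl }) (λ { zero j → refl }) (λ i j → refl))
                  (trans (*-cong (det-δ {1}) (det-δ {n})) (*-identityˡ 1#))
    UM-zero : ∀ s → (U ⊛ M) zero s ≈ M zero s
    UM-zero s = sum-δ (λ j → M j s) zero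
    UM-suc : ∀ r s → (U ⊛ M) (suc r) s ≈ - (M (suc r) zero * a ⁻¹) * M zero s + M (suc r) s
    UM-suc r s = +-congˡ (sum-δ (λ j → M (suc j) s) r)
    a⁻¹*a : a ⁻¹ * a ≈ 1#
    a⁻¹*a = trans (*-comm _ _) (⁻¹-inverseʳ a≉0)
    det-M : det M ≈ a * det S
    det-M = begin
      det M                ≈⟨ *-identityˡ _ ⟨
      1# * det M           ≈⟨ *-congʳ det-U ⟨
      det U * det M        ≈⟨ det-⊛ U M ⟨
      det (U ⊛ M)          ≈⟨ det-first-column {M = U ⊛ M} (λ r → trans (UM-suc r zero) (cleared (M (suc r) zero))) ⟩
      (U ⊛ M) zero zero * det (λ r s → (U ⊛ M) (suc r) (suc s))
                           ≈⟨ *-cong (UM-zero zero) (det-cong λ r s → trans (UM-suc r (suc s)) (+-comm _ _)) ⟩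
      a * det S            ∎
      where
      cleared : ∀ x → - (x * a ⁻¹) * a + x ≈ 0#
      cleared x = begin
        - (x * a ⁻¹) * a + x        ≈⟨ solve 3 (λ x i a → :- (x :* i) :* a :+ x := x :+ :- (x :* (i :* a))) refl x _ a ⟩
        x + - (x * (a ⁻¹ * a))      ≈⟨ +-congˡ (-‿cong (trans (*-congˡ a⁻¹*a) (*-identityʳ x))) ⟩
        x + - x                     ≈⟨ -‿inverseʳ x ⟩
        0#                          ∎
    S-pd : PositiveDefinite S
    S-pd y (i , yi≉0) = <-respʳ same (M-pd x (suc i , yi≉0))
      where
      b = sum λ j → M zero (suc j) * y j
      x : Fin (suc n) → Carrier
      x = - (a ⁻¹ * b) ∷ᵥ y
      row-zero : a * - (a ⁻¹ * b) + b ≈ 0#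
      row-zero = begin
        a * - (a ⁻¹ * b) + b     ≈⟨ solve 3 (λ a i b → a :* (:- (i :* b)) :+ b := b :+ :- ((i :* a) :* b)) refl a _ b ⟩
        b + - ((a ⁻¹ * a) * b)   ≈⟨ +-congˡ (-‿cong (trans (*-congʳ a⁻¹*a) (*-identityˡ b))) ⟩
        b + - b                  ≈⟨ -‿inverseʳ b ⟩
        0#                       ∎
      row-suc : ∀ r → M (suc r) zero * - (a ⁻¹ * b) + sum (λ j → M (suc r) (suc j) * y j) ≈ sum (λ j → S r j * y j)
      row-suc r = sym (begin
        sum (λ j → S r j * y j)
          ≈⟨ sum-cong-≋ (λ j → solve 4 (λ d k m y → (d :+ k :* m) :* y := d :* y :+ k :* (m :* y)) refl (M (suc r) (suc j)) _ _ (y j)) ⟩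
        sum (λ j → M (suc r) (suc j) * y j + k * (M zero (suc j) * y j))
          ≈⟨ ∑-distrib-+ (λ j → M (suc r) (suc j) * y j) (λ j → k * (M zero (suc j) * y j)) ⟩
        sum (λ j → M (suc r) (suc j) * y j) + sum (λ j → k * (M zero (suc j) * y j))
          ≈⟨ +-congˡ (*-distribˡ-sum k (λ j → M zero (suc j) * y j)) ⟨
        sum (λ j → M (suc r) (suc j) * y j) + k * b
          ≈⟨ solve 4 (λ t m i b → t :+ (:- (m :* i)) :* b := m :* (:- (i :* b)) :+ t) refl _ _ _ b ⟩
        M (suc r) zero * - (a ⁻¹ * b) + sum (λ j → M (suc r) (suc j) * y j) ∎)
        where k = - (M (suc r) zero * a ⁻¹)
      same : quadratic M x ≈ quadratic S y
      same = trans (+-cong (trans (*-congˡ row-zero) (zeroʳ _)) (sum-cong-≋ λ r → *-congˡ (row-suc r)))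
                   (+-identityˡ _)

-- Lattice bases and Gram determinants

module ℤS where
  open SumProperties ℤ.+-0-commutativeMonoid public
  open SemiringSum ℤ.+-*-semiring public using (*-distribˡ-sum; *-distribʳ-sum)

δℤ : ∀ {n} → Fin n → Fin n → ℤ
δℤ i j = if does (i Fin.≟ j) then 1ℤ else 0ℤ

δℤ-refl : ∀ {n} (i : Fin n) → δℤ i i ≡ 1ℤ
δℤ-refl i = ℤS.if-yes (i Fin.≟ i) ≡.refl

δℤ-≢ : ∀ {n} {i j : Fin n} → i ≢ j → δℤ i j ≡ 0ℤ
δℤ-≢ {i = i} {j} = ℤS.if-no (i Fin.≟ j)

sum-δℤ : ∀ {n} (f : Fin n → ℤ) i → ℤΣ.sum (λ j → δℤ i j ℤ.* f j) ≡ f i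
sum-δℤ f i = ≡.trans
  (ℤS.sum-single i λ j j≢i → ≡.cong (ℤ._* f j) (δℤ-≢ (j≢i ∘ ≡.sym)))
  (≡.trans (≡.cong (ℤ._* f i) (δℤ-refl i)) (ℤ.*-identityˡ (f i)))

sum-neg : ∀ {n} (f : Fin n → ℤ) → ℤΣ.sum (λ i → ℤ.- f i) ≡ ℤ.- ℤΣ.sum f
sum-neg {zero}  f = ≡.refl
sum-neg {suc n} f = ≡.trans (≡.cong (λ z → ℤ.- f zero ℤ.+ z) (sum-neg (f ∘ suc)))
                            (≡.sym (ℤ.neg-distrib-+ (f zero) (ℤΣ.sum (f ∘ suc))))

sum-- : ∀ {n} (f g : Fin n → ℤ) → ℤΣ.sum (λ i → f i ℤ.- g i) ≡ ℤΣ.sum f ℤ.- ℤΣ.sum g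
sum-- f g = ≡.trans (ℤS.∑-distrib-+ f (λ i → ℤ.- g i)) (≡.cong (λ z → ℤΣ.sum f ℤ.+ z) (sum-neg g))

module _ {m n : ℕ} where

  combination-cong : ∀ {c d : Fin n → ℤ} {u v : Fin n → Fin m → ℤ} → (∀ i → c i ≡ d i) →
                     (∀ i e → u i e ≡ v i e) → ∀ e → combination c u e ≡ combination d v e
  combination-cong c≡d u≡v e = ℤS.sum-cong-≋ λ i → ≡.cong₂ ℤ._*_ (c≡d i) (u≡v i e)

  combination-+ : ∀ (c d : Fin n → ℤ) (u : Fin n → Fin m → ℤ) e →
                  combination (λ i → c i ℤ.+ d i) u e ≡ combination c u e ℤ.+ combination d u e
  combination-+ c d u e = ≡.trans (ℤS.sum-cong-≋ λ i → ℤ.*-distribʳ-+ (u i e) (c i) (d i))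
                                  (ℤS.∑-distrib-+ (λ i → c i ℤ.* u i e) (λ i → d i ℤ.* u i e))

  combination-neg : ∀ (c : Fin n → ℤ) (u : Fin n → Fin m → ℤ) e →
                    combination (λ i → ℤ.- c i) u e ≡ ℤ.- combination c u e
  combination-neg c u e = ≡.trans (ℤS.sum-cong-≋ λ i → ≡.sym (ℤ.neg-distribˡ-* (c i) (u i e)))
                                  (sum-neg (λ i → c i ℤ.* u i e))

  combination-δ : ∀ i (u : Fin n → Fin m → ℤ) e → combination (δℤ i) u e ≡ u i e
  combination-δ i u e = sum-δℤ (λ j → u j e) i

combination-combination : ∀ {m n k} (c : Fin k → ℤ) (P : Fin k → Fin n → ℤ) (u : Fin n → Fin m → ℤ) e →
  combination c (λ i → combination (P i) u) e ≡ combination (λ j → ℤΣ.sum λ i → c i ℤ.* P i j) u e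
combination-combination c P u e = begin
  ℤΣ.sum (λ i → c i ℤ.* ℤΣ.sum λ j → P i j ℤ.* u j e)
    ≡⟨ ℤS.sum-cong-≋ (λ i → ℤS.*-distribˡ-sum (c i) (λ j → P i j ℤ.* u j e)) ⟩
  ℤΣ.sum (λ i → ℤΣ.sum λ j → c i ℤ.* (P i j ℤ.* u j e))
    ≡⟨ ℤS.∑-comm (λ i j → c i ℤ.* (P i j ℤ.* u j e)) ⟩
  ℤΣ.sum (λ j → ℤΣ.sum λ i → c i ℤ.* (P i j ℤ.* u j e))
    ≡⟨ ℤS.sum-cong-≋ (λ j → ℤS.sum-cong-≋ λ i → ≡.sym (ℤ.*-assoc (c i) (P i j) (u j e))) ⟩
  ℤΣ.sum (λ j → ℤΣ.sum λ i → (c i ℤ.* P i j) ℤ.* u j e)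
    ≡⟨ ℤS.sum-cong-≋ (λ j → ≡.sym (ℤS.*-distribʳ-sum (u j e) (λ i → c i ℤ.* P i j))) ⟩
  ℤΣ.sum (λ j → ℤΣ.sum (λ i → c i ℤ.* P i j) ℤ.* u j e) ∎
  where open ≡-Reasoning

combination-++ : ∀ {m k l} (c : Fin (k ℕ.+ l) → ℤ) (u : Fin k → Fin m → ℤ) (v : Fin l → Fin m → ℤ) e →
  combination c (u ++ v) e ≡ combination (c ∘ (_↑ˡ l)) u e ℤ.+ combination (c ∘ (k ↑ʳ_)) v e
combination-++ {k = k} {l} c u v e = ≡.trans (ℤS.sum-↑ k (λ i → c i ℤ.* (u ++ v) i e)) (≡.cong₂ ℤ._+_
  (ℤS.sum-cong-≋ λ i → ≡.cong (λ w → c (i ↑ˡ l) ℤ.* w e) (Vector.lookup-++ˡ u v i))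
  (ℤS.sum-cong-≋ λ i → ≡.cong (λ w → c (k ↑ʳ i) ℤ.* w e) (Vector.lookup-++ʳ u v i)))

module _ {m ℓ} {L : Pred (Fin m → ℤ) ℓ} where

  coordinates : ∀ {n} {u : Fin n → Fin m → ℤ} → IsBasis L IsZero u →
                ∀ x → x ∈ L → ∃[ c ] (∀ e → x e ≡ combination c u e)
  coordinates {u = u} basis x x∈L with IsBasis.spanning basis x x∈L
  ... | c , eq = c , λ e → ℤ.i-j≡0⇒i≡j (x e) (combination c u e) (eq e)

  coordinates-unique : ∀ {n} {u : Fin n → Fin m → ℤ} → IsBasis L IsZero u → ∀ c d →
                       (∀ e → combination c u e ≡ combination d u e) → ∀ i → c i ≡ d i
  coordinates-unique {u = u} basis c d eq i = ℤ.i-j≡0⇒i≡j (c i) (d i)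
    (IsBasis.independent basis (λ i → c i ℤ.- d i) (λ e → begin
      combination (λ i → c i ℤ.- d i) u e                        ≡⟨ combination-+ c (λ i → ℤ.- d i) u e ⟩
      combination c u e ℤ.+ combination (λ i → ℤ.- d i) u e      ≡⟨ ≡.cong₂ ℤ._+_ (eq e) (combination-neg d u e) ⟩
      combination d u e ℤ.- combination d u e                    ≡⟨ ℤ.+-inverseʳ (combination d u e) ⟩
      0ℤ                                                         ∎) i)
    where open ≡-Reasoning

  transition : ∀ {n n′} {u : Fin n → Fin m → ℤ} {u′ : Fin n′ → Fin m → ℤ} →
               IsBasis L IsZero u → IsBasis L IsZero u′ →
               ∃[ P ] (∀ i e → u′ i e ≡ combination (P i) u e)
  transition {u′ = u′} basis basis′ =
    (λ i → proj₁ (coordinates basis (u′ i) (IsBasis.member basis′ i))) ,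
    (λ i → proj₂ (coordinates basis (u′ i) (IsBasis.member basis′ i)))

  -- Writing `u i` in terms of `u′` and then of `u` gives coordinates of `u i` with respect to `u`;
  -- coordinates are unique.
  transition-inverse : ∀ {n n′} {u : Fin n → Fin m → ℤ} {u′ : Fin n′ → Fin m → ℤ} →
    (basis : IsBasis L IsZero u) (basis′ : IsBasis L IsZero u′) → ∀ i k →
    let P = proj₁ (transition basis basis′)
        Q = proj₁ (transition basis′ basis)
    in ℤΣ.sum (λ j → Q i j ℤ.* P j k) ≡ δℤ i k
  transition-inverse {u = u} {u′} basis basis′ i = coordinates-unique basis _ (δℤ i) λ e → begin
    combination (λ k → ℤΣ.sum λ j → Q i j ℤ.* P j k) u e   ≡⟨ combination-combination (Q i) P u e ⟨
    combination (Q i) (λ j → combination (P j) u) e        ≡⟨ combination-cong {c = Q i} {Q i} {λ j → combination (P j) u} {u′} (λ _ → ≡.refl) (λ j e → ≡.sym (eqP j e)) e ⟩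
    combination (Q i) u′ e                                 ≡⟨ eqQ i e ⟨
    u i e                                                  ≡⟨ combination-δ i u e ⟨
    combination (δℤ i) u e                                 ∎
    where
    open ≡-Reasoning
    P = proj₁ (transition basis basis′)
    eqP = proj₂ (transition basis basis′)
    Q = proj₁ (transition basis′ basis)
    eqQ = proj₂ (transition basis′ basis)

  -- `quotient-basis` lists the basis of the sublattice first, but in the block matrix the lifts
  -- must stand before the kernel so that they face the torsion cycles.
  basis-swap : ∀ {k l} (u : Fin k → Fin m → ℤ) (v : Fin l → Fin m → ℤ) →
               IsBasis L IsZero (u ++ v) → IsBasis L IsZero (v ++ u)
  basis-swap {k} {l} u v basis = record
    { member      = member′
    ; spanning    = spanning′
    ; independent = independent′
    }
    where
    open IsBasis basis
    swap : ∀ {k l} {A : Set} → (Fin (k ℕ.+ l) → A) → Fin (l ℕ.+ k) → A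
    swap {k} {l} c = (c ∘ (k ↑ʳ_)) ++ (c ∘ (_↑ˡ l))
    combination-swap : ∀ {k l} (u : Fin k → Fin m → ℤ) (v : Fin l → Fin m → ℤ) c e →
                       combination (swap {k} {l} c) (v ++ u) e ≡ combination c (u ++ v) e
    combination-swap {k} {l} u v c e = begin
      combination (swap {k} {l} c) (v ++ u) e
        ≡⟨ combination-++ (swap {k} {l} c) v u e ⟩
      combination (swap {k} {l} c ∘ (_↑ˡ k)) v e ℤ.+ combination (swap {k} {l} c ∘ (l ↑ʳ_)) u e
        ≡⟨ ≡.cong₂ ℤ._+_
             (combination-cong {u = v} (Vector.lookup-++ˡ (c ∘ (k ↑ʳ_)) (c ∘ (_↑ˡ l))) (λ _ _ → ≡.refl) e)
             (combination-cong {u = u} (Vector.lookup-++ʳ (c ∘ (k ↑ʳ_)) (c ∘ (_↑ˡ l))) (λ _ _ → ≡.refl) e) ⟩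
      combination (c ∘ (k ↑ʳ_)) v e ℤ.+ combination (c ∘ (_↑ˡ l)) u e
        ≡⟨ ℤ.+-comm (combination (c ∘ (k ↑ʳ_)) v e) _ ⟩
      combination (c ∘ (_↑ˡ l)) u e ℤ.+ combination (c ∘ (k ↑ʳ_)) v e
        ≡⟨ combination-++ c u v e ⟨
      combination c (u ++ v) e ∎
      where open ≡-Reasoning
    member′ : ∀ i → (v ++ u) i ∈ L
    member′ i with splitAt l i
    ... | inj₁ j = ≡.subst L (Vector.lookup-++ʳ u v j) (member (k ↑ʳ j))
    ... | inj₂ j = ≡.subst L (Vector.lookup-++ˡ u v j) (member (j ↑ˡ l))
    spanning′ : ∀ x → x ∈ L → ∃[ c ] IsZero (λ e → x e ℤ.- combination c (v ++ u) e)
    spanning′ x x∈L with spanning x x∈L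
    ... | c , eq = swap {k} {l} c , λ e → ≡.trans (≡.cong (λ z → x e ℤ.- z) (combination-swap u v c e)) (eq e)
    independent′ : ∀ c → IsZero (combination c (v ++ u)) → IsZero c
    independent′ c eq i = ≡.trans (c≡ i)
      (c≡0 (splitAt l i))
      where
      zeros : IsZero (swap {l} {k} c)
      zeros = independent (swap {l} {k} c) λ e → ≡.trans (combination-swap v u c e) (eq e)
      c≡ : ∀ i → c i ≡ c (Fin.join l k (splitAt l i))
      c≡ i = ≡.cong c (≡.sym (Fin.join-splitAt l k i))
      c≡0 : ∀ j → c (Fin.join l k j) ≡ 0ℤ
      c≡0 (inj₁ j) = ≡.trans (≡.sym (Vector.lookup-++ʳ (c ∘ (l ↑ʳ_)) (c ∘ (_↑ˡ k)) j)) (zeros (k ↑ʳ j))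
      c≡0 (inj₂ j) = ≡.trans (≡.sym (Vector.lookup-++ˡ (c ∘ (l ↑ʳ_)) (c ∘ (_↑ˡ k)) j)) (zeros (j ↑ˡ l))

  -- Bases of the outer terms of 0 → N → L → L/N → 0 combine to a basis of L. The argument `closed`
  -- expresses that `N` contains the combinations of its own basis.
  quotient-basis : ∀ {ℓ′ k l} {N : Pred (Fin m → ℤ) ℓ′} {t : Fin k → Fin m → ℤ} {κ : Fin l → Fin m → ℤ} →
                   N ⊆ L → (∀ c x → (∀ e → x e ≡ combination c t e) → x ∈ N) →
                   IsBasis N IsZero t → IsBasis L N κ → IsBasis L IsZero (t ++ κ)
  quotient-basis {k = k} {l} {N} {t} {κ} N⊆L closed t-basis κ-basis = record
    { member      = member′
    ; spanning    = spanning′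
    ; independent = independent′
    }
    where
    module t = IsBasis t-basis
    module κ = IsBasis κ-basis
    member′ : ∀ i → (t ++ κ) i ∈ L
    member′ i with splitAt k i
    ... | inj₁ j = N⊆L (t.member j)
    ... | inj₂ j = κ.member j
    spanning′ : ∀ x → x ∈ L → ∃[ c ] IsZero (λ e → x e ℤ.- combination c (t ++ κ) e)
    spanning′ x x∈L with κ.spanning x x∈L
    ... | c , x-cκ∈N with t.spanning _ x-cκ∈N
    ...   | d , eq = d ++ c , λ e → begin
      x e ℤ.- combination (d ++ c) (t ++ κ) e
        ≡⟨ ≡.cong (λ z → x e ℤ.- z) (combination-++ (d ++ c) t κ e) ⟩
      x e ℤ.- (combination ((d ++ c) ∘ (_↑ˡ l)) t e ℤ.+ combination ((d ++ c) ∘ (k ↑ʳ_)) κ e)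
        ≡⟨ ≡.cong₂ (λ y z → x e ℤ.- (y ℤ.+ z))
             (combination-cong {u = t} (Vector.lookup-++ˡ d c) (λ _ _ → ≡.refl) e)
             (combination-cong {u = κ} (Vector.lookup-++ʳ d c) (λ _ _ → ≡.refl) e) ⟩
      x e ℤ.- (combination d t e ℤ.+ combination c κ e)
        ≡⟨ rearrange (x e) (combination d t e) (combination c κ e) ⟩
      x e ℤ.- combination c κ e ℤ.- combination d t e
        ≡⟨ eq e ⟩
      0ℤ ∎
      where
      open ≡-Reasoning
      rearrange : ∀ a b c → a ℤ.- (b ℤ.+ c) ≡ a ℤ.- c ℤ.- b
      rearrange a b c = solve-ℤ (a ∷ b ∷ c ∷ [])
    independent′ : ∀ c → IsZero (combination c (t ++ κ)) → IsZero c
    independent′ c eq i = ≡.trans (≡.cong c (≡.sym (Fin.join-splitAt k l i))) (c≡0 (splitAt k i))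
      where
      a = c ∘ (_↑ˡ l)
      b = c ∘ (k ↑ʳ_)
      sum≡0 : ∀ e → combination a t e ℤ.+ combination b κ e ≡ 0ℤ
      sum≡0 e = ≡.trans (≡.sym (combination-++ c t κ e)) (eq e)
      -- A vanishing combination exhibits the part in `κ` as a combination of `t`, hence as an
      -- element of `N`, and independence modulo `N` applies.
      b≡0 : IsZero b
      b≡0 = κ.independent b (closed (λ i → ℤ.- a i) _ λ e → begin
        combination b κ e
          ≡⟨ rearrange (combination a t e) (combination b κ e) ⟩
        (combination a t e ℤ.+ combination b κ e) ℤ.- combination a t e
          ≡⟨ ≡.cong (ℤ._- combination a t e) (sum≡0 e) ⟩
        0ℤ ℤ.- combination a t e
          ≡⟨ ℤ.+-identityˡ _ ⟩
        ℤ.- combination a t e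
          ≡⟨ combination-neg a t e ⟨
        combination (λ i → ℤ.- a i) t e ∎)
        where
        open ≡-Reasoning
        rearrange : ∀ x y → y ≡ (x ℤ.+ y) ℤ.- x
        rearrange x y = solve-ℤ (x ∷ y ∷ [])
      a≡0 : IsZero a
      a≡0 = t.independent a λ e → begin
        combination a t e                             ≡⟨ ℤ.+-identityʳ _ ⟨
        combination a t e ℤ.+ 0ℤ                      ≡⟨ ≡.cong (λ z → combination a t e ℤ.+ z) (ℤS.sum-zero λ i → ≡.trans (≡.cong (ℤ._* κ i e) (b≡0 i)) (ℤ.*-zeroˡ (κ i e))) ⟨
        combination a t e ℤ.+ combination b κ e       ≡⟨ sum≡0 e ⟩
        0ℤ                                            ∎
        where open ≡-Reasoning
      c≡0 : ∀ j → c (Fin.join k l j) ≡ 0ℤ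
      c≡0 (inj₁ j) = a≡0 j
      c≡0 (inj₂ j) = b≡0 j

module Gram {c ℓ₁ ℓ₂} (F : OrderedField c ℓ₁ ℓ₂) where
  open FieldProperties F
  open Determinants F
  open DeterminantProperties F

  ιM : ∀ {n m} → (Fin n → Fin m → ℤ) → Matrix n m
  ιM A i j = ι (A i j)

  ι-combination : ∀ {n m} (a : Fin n → ℤ) (u : Fin n → Fin m → ℤ) e →
                  ι (combination a u e) ≈ sum (λ i → ι (a i) * ι (u i e))
  ι-combination a u e = trans (ι-sum (λ i → a i ℤ.* u i e)) (sum-cong-≋ λ i → ι-* (a i) (u i e))

  ι-δℤ : ∀ {n} (i j : Fin n) → ι (δℤ i j) ≈ δ i j
  ι-δℤ i j with does (i Fin.≟ j)
  ... | true  = ι-1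
  ... | false = refl

  -- The sizes `n` and `n′` are kept apart, because their equality is itself deduced from the two
  -- inverse relations.
  record Unimodular {n n′ m} (u : Matrix n m) (u′ : Matrix n′ m) : Set (c ⊔ ℓ₁) where
    field
      matrix    : Matrix n′ n
      inverse   : Matrix n n′
      integer   : ∀ i j → IsInteger (matrix i j)
      integer⁻¹ : ∀ i j → IsInteger (inverse i j)
      inverseʳ  : matrix ⊛ inverse ≋ δ
      inverseˡ  : inverse ⊛ matrix ≋ δ
      change    : u′ ≋ matrix ⊛ u
      change⁻¹  : u ≋ inverse ⊛ u′

  bases-unimodular : ∀ {m n n′ ℓ} {L : Pred (Fin m → ℤ) ℓ} {u : Fin n → Fin m → ℤ} {u′ : Fin n′ → Fin m → ℤ} →
                     IsBasis L IsZero u → IsBasis L IsZero u′ → Unimodular (ιM u) (ιM u′)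
  bases-unimodular {u = u} {u′} basis basis′ = record
    { matrix    = ιM P
    ; inverse   = ιM Q
    ; integer   = λ i j → P i j , refl
    ; integer⁻¹ = λ i j → Q i j , refl
    ; inverseʳ  = λ i j → trans (sym (ι-combination (P i) Q j)) (trans (reflexive (≡.cong ι (transition-inverse basis′ basis i j))) (ι-δℤ i j))
    ; inverseˡ  = λ i j → trans (sym (ι-combination (Q i) P j)) (trans (reflexive (≡.cong ι (transition-inverse basis basis′ i j))) (ι-δℤ i j))
    ; change    = λ i e → trans (reflexive (≡.cong ι (proj₂ (transition basis basis′) i e))) (ι-combination (P i) u e)
    ; change⁻¹  = λ i e → trans (reflexive (≡.cong ι (proj₂ (transition basis′ basis) i e))) (ι-combination (Q i) u′ e)
    }
    where
    P = proj₁ (transition basis basis′)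
    Q = proj₁ (transition basis′ basis)

  basis-size-unique : ∀ {m n n′ ℓ} {L : Pred (Fin m → ℤ) ℓ} {u : Fin n → Fin m → ℤ} {u′ : Fin n′ → Fin m → ℤ} →
                      IsBasis L IsZero u → IsBasis L IsZero u′ → n ≡ n′
  basis-size-unique basis basis′ = ℕ.≤-antisym (⊛≋δ⇒≤ inverse matrix inverseˡ) (⊛≋δ⇒≤ matrix inverse inverseʳ)
    where open Unimodular (bases-unimodular basis basis′)

  module _ (Γ : MetricGraph F) where
    open MetricGraph Γ using (E; #E; length; length-pos)

    gram : ∀ {n n′} → (Fin n → E → ℤ) → (Fin n′ → E → ℤ) → Matrix n n′
    gram u v i j = pairing F Γ (u i) (v j)

    pairing≈ : ∀ a b → pairing F Γ a b ≈ sum (λ e → ι (a e) * (ι (b e) * length e))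
    pairing≈ a b = sum-cong-≋ λ e →
      trans (·≈ι* (a e ℤ.* b e) (length e)) (trans (*-congʳ (ι-* (a e) (b e))) (*-assoc _ _ _))

    pairing-comm : ∀ a b → pairing F Γ a b ≈ pairing F Γ b a
    pairing-comm a b = sum-cong-≋ λ e → reflexive (≡.cong (_· length e) (ℤ.*-comm (a e) (b e)))

    pairing-cong : ∀ {a a′ b b′} → (∀ e → a e ≡ a′ e) → (∀ e → b e ≡ b′ e) → pairing F Γ a b ≈ pairing F Γ a′ b′
    pairing-cong a≡a′ b≡b′ = sum-cong-≋ λ e → reflexive (≡.cong₂ (λ x y → (x ℤ.* y) · length e) (a≡a′ e) (b≡b′ e))

    pairing-scale : ∀ j k {a a′} b → (∀ e → j ℤ.* a e ≡ k ℤ.* a′ e) → ι j * pairing F Γ a b ≈ ι k * pairing F Γ a′ b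
    pairing-scale j k {a} {a′} b eq = begin
      ι j * pairing F Γ a b                                    ≈⟨ expand j a ⟩
      sum (λ e → ι (j ℤ.* a e) * (ι (b e) * length e))         ≈⟨ sum-cong-≋ (λ e → *-congʳ (reflexive (≡.cong ι (eq e)))) ⟩
      sum (λ e → ι (k ℤ.* a′ e) * (ι (b e) * length e))        ≈⟨ expand k a′ ⟨
      ι k * pairing F Γ a′ b                                   ∎
      where
      expand : ∀ j a → ι j * pairing F Γ a b ≈ sum (λ e → ι (j ℤ.* a e) * (ι (b e) * length e))
      expand j a = begin
        ι j * pairing F Γ a b                                  ≈⟨ *-congˡ (pairing≈ a b) ⟩
        ι j * sum (λ e → ι (a e) * (ι (b e) * length e))       ≈⟨ *-distribˡ-sum (ι j) (λ e → ι (a e) * (ι (b e) * length e)) ⟩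
        sum (λ e → ι j * (ι (a e) * (ι (b e) * length e)))     ≈⟨ sum-cong-≋ (λ e → trans (sym (*-assoc _ _ _)) (*-congʳ (sym (ι-* j (a e))))) ⟩
        sum (λ e → ι (j ℤ.* a e) * (ι (b e) * length e))       ∎

    -- The Gram matrix factors as `ιM u ⊛ W`, where `W` carries the lengths, so a change of the rows
    -- acts by multiplication on the left.
    gram-rows : ∀ {n n′ k} {u : Fin n → E → ℤ} {u′ : Fin n′ → E → ℤ} {A : Matrix n′ n} →
                ιM u′ ≋ A ⊛ ιM u → ∀ (v : Fin k → E → ℤ) → gram u′ v ≋ A ⊛ gram u v
    gram-rows {u = u} {u′} {A} eq v i j = begin
      gram u′ v i j                    ≈⟨ pairing≈ (u′ i) (v j) ⟩
      (ιM u′ ⊛ W) i j                  ≈⟨ sum-cong-≋ (λ e → *-congʳ (eq i e)) ⟩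
      (A ⊛ ιM u ⊛ W) i j               ≈⟨ ⊛-assoc A (ιM u) W i j ⟩
      (A ⊛ (ιM u ⊛ W)) i j             ≈⟨ sum-cong-≋ (λ k → *-congˡ (pairing≈ (u k) (v j))) ⟨
      (A ⊛ gram u v) i j               ∎
      where
      W : Matrix #E _
      W e j = ι (v j e) * length e

    gram-det-rows : ∀ {n ℓ} {L : Pred (E → ℤ) ℓ} {u u′ : Fin n → E → ℤ} →
                    IsBasis L IsZero u → IsBasis L IsZero u′ → ∀ v →
                    ∃[ s ] IsSign s × det (gram u′ v) ≈ s * det (gram u v)
    gram-det-rows {u = u} {u′} basis basis′ v =
      det matrix , det-unimodular integer integer⁻¹ inverseʳ ,
      trans (det-cong (gram-rows {u = u} {u′} {matrix} change v)) (det-⊛ matrix (gram u v))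
      where open Unimodular (bases-unimodular basis basis′)

    -- A change of columns multiplies by the transposed transition matrix. That this is unimodular
    -- follows by transposing `inverse ⊛ matrix ≋ δ`, so the determinants of a matrix and its
    -- transpose are never compared.
    gram-det-columns : ∀ {n ℓ} {L : Pred (E → ℤ) ℓ} {v v′ : Fin n → E → ℤ} →
                       IsBasis L IsZero v → IsBasis L IsZero v′ → ∀ u →
                       ∃[ s ] IsSign s × det (gram u v′) ≈ s * det (gram u v)
    gram-det-columns {v = v} {v′} basis basis′ u =
      det (λ i j → matrix j i) ,
      det-unimodular (λ i j → integer j i) (λ i j → integer⁻¹ j i)
        (λ i j → trans (sum-cong-≋ λ k → *-comm (matrix k i) (inverse j k)) (trans (inverseˡ j i) (δ-sym j i))) ,
      (begin
        det (gram u v′)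
          ≈⟨ det-cong (λ i j → trans (pairing-comm (u i) (v′ j)) (trans (gram-rows {u = v} {v′} {matrix} change u j i)
               (sum-cong-≋ λ k → trans (*-congˡ (pairing-comm (v k) (u i))) (*-comm (matrix j k) (gram u v i k))))) ⟩
        det (gram u v ⊛ λ i j → matrix j i)
          ≈⟨ det-⊛ (gram u v) (λ i j → matrix j i) ⟩
        det (gram u v) * det (λ i j → matrix j i)
          ≈⟨ *-comm _ _ ⟩
        det (λ i j → matrix j i) * det (gram u v) ∎)
      where
      open Unimodular (bases-unimodular basis basis′)
      δ-sym : ∀ {n} (i j : Fin n) → δ i j ≈ δ j i
      δ-sym i j with i Fin.≟ j | j Fin.≟ i
      ... | yes _    | yes _    = refl
      ... | yes i≡j  | no j≢i   = ⊥-elim (j≢i (≡.sym i≡j))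
      ... | no i≢j   | yes j≡i  = ⊥-elim (i≢j (≡.sym j≡i))
      ... | no _     | no _     = refl

    -- Independence over the field. `IsBasis` speaks of integer coefficients only, while positive
    -- definiteness has to be tested on vectors with entries in the field.
    Independent : ∀ {n} → (Fin n → E → ℤ) → Set (c ⊔ ℓ₁)
    Independent {n} u = (x : Fin n → Carrier) → (∀ e → sum (λ i → x i * ι (u i e)) ≈ 0#) → ∀ i → x i ≈ 0#

    -- A relation `x` among `u′` becomes the relation `x` times `matrix` among `u`, which is
    -- trivial; multiplying by `inverse` recovers `x`. So it is enough to check one convenient
    -- basis.
    independent-change : ∀ {n n′ ℓ} {L : Pred (E → ℤ) ℓ} {u : Fin n → E → ℤ} {u′ : Fin n′ → E → ℤ} →
                         IsBasis L IsZero u → IsBasis L IsZero u′ → Independent u → Independent u′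
    independent-change {n} {n′} {u = u} {u′} basis basis′ u-ind x eq i = begin
      x i
        ≈⟨ sum-δʳ x i ⟨
      sum (λ k → x k * δ k i)
        ≈⟨ sum-cong-≋ (λ k → *-congˡ (inverseʳ k i)) ⟨
      sum (λ k → x k * (matrix ⊛ inverse) k i)
        ≈⟨ ⊛-assoc {n = 1} (λ _ → x) matrix inverse zero i ⟨
      sum (λ j → xP j * inverse j i)
        ≈⟨ sum-zero (λ j → trans (*-congʳ (u-ind xP xP-zero j)) (zeroˡ _)) ⟩
      0# ∎
      where
      open Unimodular (bases-unimodular basis basis′)
      xP : Fin n → Carrier
      xP j = sum (λ k → x k * matrix k j)
      xP-zero : ∀ e → sum (λ j → xP j * ι (u j e)) ≈ 0#
      xP-zero e = begin
        sum (λ j → xP j * ι (u j e))                ≈⟨ ⊛-assoc {n = 1} (λ _ → x) matrix (ιM u) zero e ⟩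
        sum (λ k → x k * (matrix ⊛ ιM u) k e)       ≈⟨ sum-cong-≋ (λ k → *-congˡ (change k e)) ⟨
        sum (λ k → x k * ι (u′ k e))                ≈⟨ eq e ⟩
        0#                                          ∎

    -- The quadratic form at `x` is the sum of ℓ(e) w(e)² over the edges, where w is the combination
    -- of the `u i` with coefficients `x`.
    gram-positive : ∀ {n} (u : Fin n → E → ℤ) → Independent u → 0# < det (gram u u)
    gram-positive {n} u u-ind = det-positive (gram u u) positive
      where
      w : (Fin n → Carrier) → E → Carrier
      w x e = sum (λ i → x i * ι (u i e))
      -- Equality in the field is decidable, since the order is total, so an edge with nonzero
      -- coefficient can be found by a finite search.
      nonzero : ∀ x i → ¬ (x i ≈ 0#) → ∃[ e ] ¬ (w x e ≈ 0#)
      nonzero x i xi≉0 = Fin.¬∀⟶∃¬ _ (λ e → w x e ≈ 0#) (λ e → w x e ≟ 0#) λ w≈0 → xi≉0 (u-ind x w≈0 i)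
      nonneg : ∀ x e → 0# < w x e * w x e * length e ⊎ w x e * w x e * length e ≈ 0#
      nonneg x e with w x e ≟ 0#
      ... | yes we≈0 = inj₂ (trans (*-congʳ (trans (*-congʳ we≈0) (zeroˡ _))) (zeroˡ _))
      ... | no  we≉0 = inj₁ (*-pos (square-pos we≉0) (length-pos e))
      expand : ∀ x → quadratic (gram u u) x ≈ sum (λ e → w x e * w x e * length e)
      expand x = begin
        sum (λ i → x i * sum (λ j → gram u u i j * x j))
          ≈⟨ sum-cong-≋ (λ i → *-congˡ (row i)) ⟩
        sum (λ i → x i * sum (λ e → ι (u i e) * (w x e * length e)))
          ≈⟨ ⊛-assoc {n = 1} (λ _ → x) (ιM u) (λ e (_ : Fin 1) → w x e * length e) zero zero ⟨
        sum (λ e → w x e * (w x e * length e))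
          ≈⟨ sum-cong-≋ (λ e → *-assoc (w x e) (w x e) (length e)) ⟨
        sum (λ e → w x e * w x e * length e) ∎
        where
        row : ∀ i → sum (λ j → gram u u i j * x j) ≈ sum (λ e → ι (u i e) * (w x e * length e))
        row i = begin
          sum (λ j → gram u u i j * x j)
            ≈⟨ sum-cong-≋ (λ j → *-congʳ (pairing≈ (u i) (u j))) ⟩
          sum (λ j → sum (λ e → ι (u i e) * (ι (u j e) * length e)) * x j)
            ≈⟨ ⊛-assoc {n = 1} (λ _ e → ι (u i e)) (λ e j → ι (u j e) * length e) (λ j (_ : Fin 1) → x j) zero zero ⟩
          sum (λ e → ι (u i e) * sum (λ j → ι (u j e) * length e * x j))
            ≈⟨ sum-cong-≋ (λ e → *-congˡ (trans
                 (sum-cong-≋ λ j → solve 3 (λ a b c → a :* b :* c := c :* a :* b) refl (ι (u j e)) (length e) (x j))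
                 (sym (*-distribʳ-sum (length e) (λ j → x j * ι (u j e)))))) ⟩
          sum (λ e → ι (u i e) * (w x e * length e)) ∎

      positive : PositiveDefinite (gram u u)
      positive x (i , xi≉0) with nonzero x i xi≉0
      ... | e , we≉0 = <-respʳ (sym (expand x))
        (sum-pos (λ e → w x e * w x e * length e) (nonneg x) e (*-pos (square-pos we≉0) (length-pos e)))

count-all : ∀ {m p} {P : Pred (Fin m) p} (P? : Decidable P) → (∀ x → P x) → count P? ≡ m
count-all {m} P? all = Enumeration-unique (enumerate P?)
  record { at = id ; at-∈ = all ; injective = id ; index = λ x _ → x , ≡.refl }

count-none : ∀ {m p} {P : Pred (Fin m) p} (P? : Decidable P) → (∀ x → ¬ P x) → count P? ≡ 0
count-none P? none = ℕS.sum-zero λ x → ℕS.if-no (P? x) (none x)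

Enumeration-++ : ∀ {m k l p q r} {P : Pred (Fin m) p} {Q : Pred (Fin m) q} {R : Pred (Fin m) r} →
                 (a : Enumeration P k) (b : Enumeration Q l) → (∀ x → R x → P x ⊎ Q x) →
                 (∀ x → P x → R x) → (∀ x → Q x → R x) → (∀ x → P x → Q x → ⊥) →
                 Enumeration R (k ℕ.+ l)
Enumeration-++ {k = k} {l} {Q = Q} {R} a b split left right disjoint = record
  { at        = A.at ++ B.at
  ; at-∈      = at-∈
  ; injective = λ {i} {j} → injective i j
  ; index     = index
  }
  where
  module A = Enumeration a
  module B = Enumeration b
  at-∈ : ∀ i → R ((A.at ++ B.at) i)
  at-∈ i with splitAt k i
  ... | inj₁ j = left _ (A.at-∈ j)
  ... | inj₂ j = right _ (B.at-∈ j)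
  injective : ∀ i j → (A.at ++ B.at) i ≡ (A.at ++ B.at) j → i ≡ j
  injective i j eq with splitAt k i in eqi | splitAt k j in eqj
  ... | inj₁ i′ | inj₁ j′ = ≡.trans (≡.sym (Fin.splitAt⁻¹-↑ˡ eqi))
        (≡.trans (≡.cong (_↑ˡ l) (A.injective eq)) (Fin.splitAt⁻¹-↑ˡ eqj))
  ... | inj₁ i′ | inj₂ j′ = ⊥-elim (disjoint _ (A.at-∈ i′) (≡.subst Q (≡.sym eq) (B.at-∈ j′)))
  ... | inj₂ i′ | inj₁ j′ = ⊥-elim (disjoint _ (A.at-∈ j′) (≡.subst Q eq (B.at-∈ i′)))
  ... | inj₂ i′ | inj₂ j′ = ≡.trans (≡.sym (Fin.splitAt⁻¹-↑ʳ eqi))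
        (≡.trans (≡.cong (k ↑ʳ_) (B.injective eq)) (Fin.splitAt⁻¹-↑ʳ eqj))
  index : ∀ x → R x → ∃[ i ] (A.at ++ B.at) i ≡ x
  index x Rx with split x Rx
  ... | inj₁ Px with A.index x Px
  ...   | i , ≡.refl = i ↑ˡ l , ≡.cong [ A.at , B.at ] (Fin.splitAt-↑ˡ k i l)
  index x Rx | inj₂ Qx with B.index x Qx
  ...   | i , ≡.refl = k ↑ʳ i , ≡.cong [ A.at , B.at ] (Fin.splitAt-↑ʳ k l i)

-- Chains, walks and spanning forests

-- Boundary and pushforward are both given by sums over fibres; as combinations of basis vectors
-- they fall under the same linear algebra.
sumOver≡combination : ∀ {m n} (p : Fin m → Fin n) (a : Fin m → ℤ) v →
                      ℤΣ.sumOver (λ e → p e Fin.≟ v) a ≡ combination a (δℤ ∘ p) v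
sumOver≡combination p a v = ℤS.sum-cong-≋ λ e → indicator (does (p e Fin.≟ v)) (a e)
  where
  indicator : ∀ b x → (if b then x else 0ℤ) ≡ x ℤ.* (if b then 1ℤ else 0ℤ)
  indicator true  x = ≡.sym (ℤ.*-identityʳ x)
  indicator false x = ≡.sym (ℤ.*-zeroʳ x)

module Chains {G : Graph} (o : Orientation G) where
  open Graph G
  open Orientation o
  open Homology o

  incidence : E → V → ℤ
  incidence e v = δℤ (head e) v ℤ.- δℤ (tail e) v

  ∂≡combination : ∀ a v → ∂ a v ≡ combination a incidence v
  ∂≡combination a v = begin
    ∂ a v
      ≡⟨ ≡.cong₂ ℤ._-_ (sumOver≡combination head a v) (sumOver≡combination tail a v) ⟩
    combination a (δℤ ∘ head) v ℤ.- combination a (δℤ ∘ tail) v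
      ≡⟨ sum-- (λ e → a e ℤ.* δℤ (head e) v) (λ e → a e ℤ.* δℤ (tail e) v) ⟨
    ℤΣ.sum (λ e → a e ℤ.* δℤ (head e) v ℤ.- a e ℤ.* δℤ (tail e) v)
      ≡⟨ ℤS.sum-cong-≋ (λ e → distrib (a e) (δℤ (head e) v) (δℤ (tail e) v)) ⟨
    combination a incidence v ∎
    where
    open ≡-Reasoning
    distrib : ∀ x y z → x ℤ.* (y ℤ.- z) ≡ x ℤ.* y ℤ.- x ℤ.* z
    distrib x y z = solve-ℤ (x ∷ y ∷ z ∷ [])

  H₁-combination : ∀ {n} (c : Fin n → ℤ) (z : Fin n → E → ℤ) → (∀ i → z i ∈ H₁) →
                   ∀ x → (∀ e → x e ≡ combination c z e) → x ∈ H₁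
  H₁-combination c z z∈H₁ x eq v = begin
    ∂ x v
      ≡⟨ ∂≡combination x v ⟩
    combination x incidence v
      ≡⟨ combination-cong {c = x} {combination c z} {incidence} {incidence} eq (λ _ _ → ≡.refl) v ⟩
    combination (combination c z) incidence v
      ≡⟨ combination-combination c z incidence v ⟨
    combination c (λ i → combination (z i) incidence) v
      ≡⟨ ℤS.sum-zero (λ i → ≡.trans (≡.cong (c i ℤ.*_) (≡.trans (≡.sym (∂≡combination (z i) v)) (z∈H₁ i v))) (ℤ.*-zeroʳ (c i))) ⟩
    0ℤ ∎
    where open ≡-Reasoning

  -- Summation by parts. On a cycle the right-hand side is therefore zero for every potential `φ`;
  -- acyclicity and the lifting of cycles rest on a suitable choice of `φ`.
  coboundary : ∀ (φ : V → ℤ) a →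
               ℤΣ.sum (λ v → φ v ℤ.* ∂ a v) ≡ ℤΣ.sum (λ e → a e ℤ.* (φ (head e) ℤ.- φ (tail e)))
  coboundary φ a = begin
    ℤΣ.sum (λ v → φ v ℤ.* ∂ a v)
      ≡⟨ ℤS.sum-cong-≋ (λ v → ≡.trans (≡.cong (φ v ℤ.*_) (∂≡combination a v))
           (ℤS.*-distribˡ-sum (φ v) (λ e → a e ℤ.* incidence e v))) ⟩
    ℤΣ.sum (λ v → ℤΣ.sum λ e → φ v ℤ.* (a e ℤ.* incidence e v))
      ≡⟨ ℤS.∑-comm (λ v e → φ v ℤ.* (a e ℤ.* incidence e v)) ⟩
    ℤΣ.sum (λ e → ℤΣ.sum λ v → φ v ℤ.* (a e ℤ.* incidence e v))
      ≡⟨ ℤS.sum-cong-≋ (λ e → edge-term e) ⟩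
    ℤΣ.sum (λ e → a e ℤ.* (φ (head e) ℤ.- φ (tail e))) ∎
    where
    open ≡-Reasoning
    rearrange : ∀ x y z w → x ℤ.* (y ℤ.* (z ℤ.- w)) ≡ y ℤ.* (z ℤ.* x ℤ.- w ℤ.* x)
    rearrange x y z w = solve-ℤ (x ∷ y ∷ z ∷ w ∷ [])
    edge-term : ∀ e → ℤΣ.sum (λ v → φ v ℤ.* (a e ℤ.* incidence e v)) ≡ a e ℤ.* (φ (head e) ℤ.- φ (tail e))
    edge-term e = begin
      ℤΣ.sum (λ v → φ v ℤ.* (a e ℤ.* incidence e v))
        ≡⟨ ℤS.sum-cong-≋ (λ v → rearrange (φ v) (a e) (δℤ (head e) v) (δℤ (tail e) v)) ⟩
      ℤΣ.sum (λ v → a e ℤ.* (δℤ (head e) v ℤ.* φ v ℤ.- δℤ (tail e) v ℤ.* φ v))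
        ≡⟨ ℤS.*-distribˡ-sum (a e) (λ v → δℤ (head e) v ℤ.* φ v ℤ.- δℤ (tail e) v ℤ.* φ v) ⟨
      a e ℤ.* ℤΣ.sum (λ v → δℤ (head e) v ℤ.* φ v ℤ.- δℤ (tail e) v ℤ.* φ v)
        ≡⟨ ≡.cong (a e ℤ.*_) (≡.trans (sum-- (λ v → δℤ (head e) v ℤ.* φ v) (λ v → δℤ (tail e) v ℤ.* φ v))
             (≡.cong₂ ℤ._-_ (sum-δℤ φ (head e)) (sum-δℤ φ (tail e)))) ⟩
      a e ℤ.* (φ (head e) ℤ.- φ (tail e)) ∎

  Bounds : (E → ℤ) → V → V → Set
  Bounds y u v = ∀ w → combination y incidence w ≡ δℤ v w ℤ.- δℤ u w

  bounds-+ : ∀ {y z u v w} → Bounds y u v → Bounds z v w → Bounds (λ e → y e ℤ.+ z e) u w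
  bounds-+ {y} {z} {u} {v} {w} by bz x = ≡.trans (combination-+ y z incidence x)
    (≡.trans (≡.cong₂ ℤ._+_ (by x) (bz x)) (telescope (δℤ u x) (δℤ v x) (δℤ w x)))
    where
    telescope : ∀ a b c → (b ℤ.- a) ℤ.+ (c ℤ.- b) ≡ c ℤ.- a
    telescope a b c = solve-ℤ (a ∷ b ∷ c ∷ [])

  start-edge : ∀ h → start (edge h) ≡ h ⊎ start (edge h) ≡ inv h
  start-edge h = Equivalence.to (proj₂ edgeQuotient h (start (edge h))) (≡.sym (edge-start (edge h)))

  edge-inv : ∀ h → edge (inv h) ≡ edge h
  edge-inv h = ≡.sym (Equivalence.from (proj₂ edgeQuotient h (inv h)) (inj₂ ≡.refl))

  -- The sign is read off from the half-edge and not from its end vertices, so loops are traversed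
  -- with a definite direction too.
  crossing : H → E → ℤ
  crossing h e = (if does (start (edge h) Fin.≟ h) then 1ℤ else -1ℤ) ℤ.* δℤ (edge h) e

  crossing-bounds : ∀ h → Bounds (crossing h) (root h) (root (inv h))
  crossing-bounds h w = begin
    combination (crossing h) incidence w
      ≡⟨ ℤS.sum-cong-≋ (λ e → ℤ.*-assoc σ (δℤ (edge h) e) (incidence e w)) ⟩
    ℤΣ.sum (λ e → σ ℤ.* (δℤ (edge h) e ℤ.* incidence e w))
      ≡⟨ ℤS.*-distribˡ-sum σ (λ e → δℤ (edge h) e ℤ.* incidence e w) ⟨
    σ ℤ.* combination (δℤ (edge h)) incidence w
      ≡⟨ ≡.cong (σ ℤ.*_) (combination-δ (edge h) incidence w) ⟩
    σ ℤ.* incidence (edge h) w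
      ≡⟨ signed (start-edge h) ⟩
    δℤ (root (inv h)) w ℤ.- δℤ (root h) w ∎
    where
    open ≡-Reasoning
    σ = if does (start (edge h) Fin.≟ h) then 1ℤ else -1ℤ
    negate : ∀ x y → -1ℤ ℤ.* (x ℤ.- y) ≡ y ℤ.- x
    negate x y = solve-ℤ (x ∷ y ∷ [])
    signed : start (edge h) ≡ h ⊎ start (edge h) ≡ inv h → σ ℤ.* incidence (edge h) w ≡ δℤ (root (inv h)) w ℤ.- δℤ (root h) w
    signed (inj₁ eq) rewrite dec-true (start (edge h) Fin.≟ h) eq | eq = ℤ.*-identityˡ _
    signed (inj₂ eq) rewrite dec-false (start (edge h) Fin.≟ h) (λ eq′ → no-fixed h (≡.trans (≡.sym eq) eq′)) | eq | involutive h =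
      negate (δℤ (root h) w) (δℤ (root (inv h)) w)

  crossing-support : ∀ h {e} → edge h ≢ e → crossing h e ≡ 0ℤ
  crossing-support h {e} ne = ≡.trans (≡.cong (σ ℤ.*_) (δℤ-≢ ne)) (ℤ.*-zeroʳ σ)
    where σ = if does (start (edge h) Fin.≟ h) then 1ℤ else -1ℤ

  record Adjacent {p} (P : Pred E p) (u v : V) : Set p where
    constructor step
    field
      half   : H
      along  : P (edge half)
      source : root half ≡ u
      target : root (inv half) ≡ v

  adjacent-map : ∀ {p q} {P : Pred E p} {Q : Pred E q} → P ⊆ Q → ∀ {u v} → Adjacent P u v → Adjacent Q u v
  adjacent-map P⊆Q (step h Ph eq eq′) = step h (P⊆Q Ph) eq eq′

  forward : ∀ {p} {P : Pred E p} e → P e → Adjacent P (tail e) (head e)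
  forward {P = P} e Pe = step (start e) (≡.subst P (≡.sym (edge-start e)) Pe) ≡.refl ≡.refl

  backward : ∀ {p} {P : Pred E p} e → P e → Adjacent P (head e) (tail e)
  backward {P = P} e Pe = step (inv (start e)) (≡.subst P (≡.sym (≡.trans (edge-inv (start e)) (edge-start e))) Pe)
    ≡.refl (≡.cong root (involutive (start e)))

  walk : ∀ {p} {P : Pred E p} {u v} → Star (Adjacent P) u v → E → ℤ
  walk Star.ε              e = 0ℤ
  walk (step h _ _ _ ◅ hs) e = crossing h e ℤ.+ walk hs e

  walk-bounds : ∀ {p} {P : Pred E p} {u v} (hs : Star (Adjacent P) u v) → Bounds (walk hs) u v
  walk-bounds {u = u} Star.ε w = ≡.trans
    (ℤS.sum-zero λ e → ℤ.*-zeroˡ (incidence e w)) (≡.sym (ℤ.+-inverseʳ (δℤ u w)))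
  walk-bounds {v = v} (step h _ ≡.refl ≡.refl ◅ hs) =
    bounds-+ {crossing h} {walk hs} {root h} {root (inv h)} {v} (crossing-bounds h) (walk-bounds hs)

  walk-support : ∀ {p} {P : Pred E p} {u v} (hs : Star (Adjacent P) u v) {e} → ¬ P e → walk hs e ≡ 0ℤ
  walk-support Star.ε ¬Pe = ≡.refl
  walk-support {P = P} (step h Ph _ _ ◅ hs) {e} ¬Pe = ≡.cong₂ ℤ._+_
    (crossing-support h λ eq → ¬Pe (≡.subst P eq Ph)) (walk-support hs ¬Pe)

  -- The walk is subtracted because it runs from tail to head as well, parallel to `e`.
  fundamental : ∀ {p} {P : Pred E p} e → Star (Adjacent P) (tail e) (head e) → E → ℤ
  fundamental e hs e′ = δℤ e e′ ℤ.- walk hs e′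

  fundamental-cycle : ∀ {p} {P : Pred E p} e (hs : Star (Adjacent P) (tail e) (head e)) →
                      fundamental e hs ∈ H₁
  fundamental-cycle e hs v = begin
    ∂ (fundamental e hs) v
      ≡⟨ ∂≡combination (fundamental e hs) v ⟩
    combination (fundamental e hs) incidence v
      ≡⟨ combination-+ (δℤ e) (λ e′ → ℤ.- walk hs e′) incidence v ⟩
    combination (δℤ e) incidence v ℤ.+ combination (λ e′ → ℤ.- walk hs e′) incidence v
      ≡⟨ ≡.cong₂ ℤ._+_ (combination-δ e incidence v) (combination-neg (walk hs) incidence v) ⟩
    incidence e v ℤ.- combination (walk hs) incidence v
      ≡⟨ ≡.cong (λ z → incidence e v ℤ.- z) (walk-bounds hs v) ⟩
    incidence e v ℤ.- incidence e v
      ≡⟨ ℤ.+-inverseʳ (incidence e v) ⟩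
    0ℤ ∎
    where open ≡-Reasoning

  -- The walk stays inside `P`, so with `P` the forest the fundamental cycles have the identity as
  -- coefficient matrix on the remaining edges.
  fundamental-off : ∀ {p} {P : Pred E p} e (hs : Star (Adjacent P) (tail e) (head e)) {e′} → ¬ P e′ →
                    fundamental e hs e′ ≡ δℤ e e′
  fundamental-off e hs {e′} ¬Pe′ = ≡.trans (≡.cong (λ z → δℤ e e′ ℤ.- z) (walk-support hs ¬Pe′)) (ℤ.+-identityʳ (δℤ e e′))

  -- `label` picks a representative of each tree, so that trees are counted as fixed points.
  -- Acyclicity is stated homologically: this is the form in which two cycles that agree off the
  -- forest are seen to be equal.
  record Forest : Set where
    field
      tree      : E → Bool
      label     : V → V
      idem      : ∀ v → label (label v) ≡ label v
      connected : ∀ {u v} → label u ≡ label v → Star (Adjacent (λ e → tree e ≡ true)) u v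
      respects  : ∀ {e} → tree e ≡ true → label (tail e) ≡ label (head e)
      acyclic   : ∀ a → a ∈ H₁ → (∀ e → tree e ≢ true → a e ≡ 0ℤ) → IsZero a
      counted   : count (λ v → label v Fin.≟ v) ℕ.+ count (λ e → tree e Bool.≟ true) ≡ #V

    Tree : Pred E _
    Tree e = tree e ≡ true

  open Forest

  discrete : Forest
  discrete = record
    { tree      = λ _ → false
    ; label     = id
    ; idem      = λ _ → ≡.refl
    ; connected = λ { ≡.refl → Star.ε }
    ; respects  = λ ()
    ; acyclic   = λ a _ off e → off e λ ()
    ; counted   = ≡.trans (≡.cong₂ ℕ._+_ (count-all {#V} (λ v → v Fin.≟ v) λ _ → ≡.refl) (count-none {#E} (λ e → false Bool.≟ true) λ _ ()))
                          (ℕ.+-identityʳ #V)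
    }

  -- One step of Kruskal's algorithm: `e` joins two different trees, and the tree of its tail takes
  -- over the representative of the tree of its head.
  module Insert (S : Forest) (e : E) (a≢b : label S (tail e) ≢ label S (head e)) where
    private
      a = label S (tail e)
      b = label S (head e)

    tree′ : E → Bool
    tree′ e′ = does (e Fin.≟ e′) ∨ tree S e′

    label′ : V → V
    label′ v = if does (label S v Fin.≟ a) then b else label S v

    tree′-e : tree′ e ≡ true
    tree′-e rewrite dec-true (e Fin.≟ e) ≡.refl = ≡.refl

    tree⊆tree′ : ∀ {e′} → tree S e′ ≡ true → tree′ e′ ≡ true
    tree⊆tree′ {e′} eq rewrite eq = Bool.∨-zeroʳ (does (e Fin.≟ e′))

    tree′-cases : ∀ {e′} → tree′ e′ ≡ true → e ≡ e′ ⊎ tree S e′ ≡ true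
    tree′-cases {e′} eq with e Fin.≟ e′
    ... | yes e≡e′ = inj₁ e≡e′
    ... | no _     = inj₂ eq

    label′-a : ∀ {v} → label S v ≡ a → label′ v ≡ b
    label′-a {v} eq rewrite dec-true (label S v Fin.≟ a) eq = ≡.refl

    label′-≢ : ∀ {v} → label S v ≢ a → label′ v ≡ label S v
    label′-≢ {v} ne rewrite dec-false (label S v Fin.≟ a) ne = ≡.refl

    label-b≢a : label S b ≢ a
    label-b≢a eq = a≢b (≡.trans (≡.sym eq) (idem S (head e)))

    idem′ : ∀ v → label′ (label′ v) ≡ label′ v
    idem′ v with label S v Fin.≟ a
    ... | yes _ = ≡.trans (label′-≢ label-b≢a) (idem S (head e))
    ... | no ne = ≡.trans (label′-≢ (λ eq → ne (≡.trans (≡.sym (idem S v)) eq))) (idem S v)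

    coarser : ∀ {u v} → label S u ≡ label S v → label′ u ≡ label′ v
    coarser eq = ≡.cong (λ x → if does (x Fin.≟ a) then b else x) eq

    private
      old : ∀ {u v} → label S u ≡ label S v → Star (Adjacent (λ e → tree′ e ≡ true)) u v
      old = Star.map (adjacent-map {P = Tree S} tree⊆tree′) ∘ connected S

    connected′ : ∀ {u v} → label′ u ≡ label′ v → Star (Adjacent (λ e → tree′ e ≡ true)) u v
    connected′ {u} {v} eq with label S u Fin.≟ a | label S v Fin.≟ a
    ... | yes p | yes q = old (≡.trans p (≡.sym q))
    ... | no _  | no _  = old eq
    ... | yes p | no _  = old p ◅◅ forward e tree′-e ◅ old eq
    ... | no _  | yes q = old eq ◅◅ backward e tree′-e ◅ old (≡.sym q)

    label′-e : label′ (tail e) ≡ label′ (head e)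
    label′-e = ≡.trans (label′-a ≡.refl) (≡.sym (label′-≢ (a≢b ∘ ≡.sym)))

    respects′ : ∀ {e′} → tree′ e′ ≡ true → label′ (tail e′) ≡ label′ (head e′)
    respects′ eq with tree′-cases eq
    ... | inj₁ ≡.refl = label′-e
    ... | inj₂ eq′    = coarser (respects S eq′)

    -- The indicator of the label of the tail of e vanishes on the boundary of every old
    -- tree edge, but not on the boundary of e.
    acyclic′ : ∀ x → x ∈ H₁ → (∀ e′ → tree′ e′ ≢ true → x e′ ≡ 0ℤ) → IsZero x
    acyclic′ x x∈H₁ off = acyclic S x x∈H₁ off-tree
      where
      φ : V → ℤ
      φ v = δℤ (label S v) a
      others : ∀ e′ → e′ ≢ e → x e′ ℤ.* (φ (head e′) ℤ.- φ (tail e′)) ≡ 0ℤ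
      others e′ e′≢e with tree S e′ Bool.≟ true
      ... | yes t rewrite respects S t = ≡.trans (≡.cong (x e′ ℤ.*_) (ℤ.+-inverseʳ (φ (head e′)))) (ℤ.*-zeroʳ (x e′))
      ... | no ¬t = ≡.trans (≡.cong (ℤ._* _) (off e′ λ t → [ e′≢e ∘ ≡.sym , ¬t ] (tree′-cases t))) (ℤ.*-zeroˡ (φ (head e′) ℤ.- φ (tail e′)))
      x-e : x e ≡ 0ℤ
      x-e = ℤ.neg-injective (begin
        ℤ.- x e                                                      ≡⟨ ℤ.-1*i≡-i (x e) ⟨
        -1ℤ ℤ.* x e                                                  ≡⟨ ℤ.*-comm -1ℤ (x e) ⟩
        x e ℤ.* -1ℤ                                                  ≡⟨ ≡.cong (x e ℤ.*_) (≡.cong₂ ℤ._-_ (δℤ-≢ (a≢b ∘ ≡.sym)) (δℤ-refl a)) ⟨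
        x e ℤ.* (φ (head e) ℤ.- φ (tail e))                          ≡⟨ ℤS.sum-single {f = λ e′ → x e′ ℤ.* (φ (head e′) ℤ.- φ (tail e′))} e others ⟨
        ℤΣ.sum (λ e′ → x e′ ℤ.* (φ (head e′) ℤ.- φ (tail e′)))       ≡⟨ coboundary φ x ⟨
        ℤΣ.sum (λ v → φ v ℤ.* ∂ x v)                                 ≡⟨ ℤS.sum-zero (λ v → ≡.trans (≡.cong (φ v ℤ.*_) (x∈H₁ v)) (ℤ.*-zeroʳ (φ v))) ⟩
        0ℤ                                                           ∎)
        where open ≡-Reasoning
      off-tree : ∀ e′ → tree S e′ ≢ true → x e′ ≡ 0ℤ
      off-tree e′ ¬t with e Fin.≟ e′
      ... | yes ≡.refl = x-e
      ... | no e≢e′    = off e′ λ t → [ e≢e′ , ¬t ] (tree′-cases t)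

    -- One edge is gained and exactly one representative, `a`, is lost.
    counted′ : count (λ v → label′ v Fin.≟ v) ℕ.+ count (λ e → tree′ e Bool.≟ true) ≡ #V
    counted′ = begin
      count (λ v → label′ v Fin.≟ v) ℕ.+ count (λ e → tree′ e Bool.≟ true)
        ≡⟨ ≡.cong (count (λ v → label′ v Fin.≟ v) ℕ.+_)
             (count-⊎ (e Fin.≟_) (λ e → tree S e Bool.≟ true) (λ e → tree′ e Bool.≟ true)
               (λ _ → tree′-cases) (λ { _ ≡.refl → tree′-e }) (λ _ → tree⊆tree′)
               (λ { _ ≡.refl t → a≢b (respects S t) })) ⟩
      count (λ v → label′ v Fin.≟ v) ℕ.+ (count (e Fin.≟_) ℕ.+ count (λ e → tree S e Bool.≟ true))
        ≡⟨ ≡.cong (λ k → count (λ v → label′ v Fin.≟ v) ℕ.+ (k ℕ.+ count (λ e → tree S e Bool.≟ true)))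
             (≡.trans (count-single (e Fin.≟_) ≡.refl (λ _ → ≡.sym)) (≡.sym (count-single (a Fin.≟_) ≡.refl (λ _ → ≡.sym)))) ⟩
      count (λ v → label′ v Fin.≟ v) ℕ.+ (count (a Fin.≟_) ℕ.+ count (λ e → tree S e Bool.≟ true))
        ≡⟨ ℕ.+-assoc (count (λ v → label′ v Fin.≟ v)) (count (a Fin.≟_)) _ ⟨
      count (λ v → label′ v Fin.≟ v) ℕ.+ count (a Fin.≟_) ℕ.+ count (λ e → tree S e Bool.≟ true)
        ≡⟨ ≡.cong (ℕ._+ count (λ e → tree S e Bool.≟ true))
             (count-⊎ (λ v → label′ v Fin.≟ v) (a Fin.≟_) (λ v → label S v Fin.≟ v) roots roots′ (λ { _ ≡.refl → idem S (tail e) }) disjoint) ⟨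
      count (λ v → label S v Fin.≟ v) ℕ.+ count (λ e → tree S e Bool.≟ true)
        ≡⟨ counted S ⟩
      #V ∎
      where
      open ≡-Reasoning
      roots : ∀ v → label S v ≡ v → label′ v ≡ v ⊎ a ≡ v
      roots v eq with a Fin.≟ v
      ... | yes a≡v = inj₂ a≡v
      ... | no a≢v  = inj₁ (≡.trans (label′-≢ (λ eq′ → a≢v (≡.trans (≡.sym eq′) eq))) eq)
      roots′ : ∀ v → label′ v ≡ v → label S v ≡ v
      roots′ v eq with label S v Fin.≟ a
      ... | yes p = ⊥-elim (label-b≢a (≡.trans (≡.cong (label S) eq) p))
      ... | no _  = eq
      disjoint : ∀ v → label′ v ≡ v → a ≡ v → ⊥
      disjoint _ eq ≡.refl = a≢b (≡.trans (≡.sym eq) (label′-a (idem S (tail e))))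

    insert : Forest
    insert = record
      { tree = tree′ ; label = label′ ; idem = idem′ ; connected = connected′ ; respects = respects′
      ; acyclic = acyclic′ ; counted = counted′ }

  -- `adds` confines the new tree edges to the list, which controls the support of cycles. `spans`
  -- says that each listed edge, chosen or not, has both ends in one tree, so that it can be closed
  -- up along the forest.
  record Extension (S : Forest) (es : List E) : Set where
    field
      forest  : Forest
      keeps   : ∀ {e} → Tree S e → Tree forest e
      adds    : ∀ {e} → Tree forest e → Tree S e ⊎ e ∈ˡ es
      coarser : ∀ {u v} → label S u ≡ label S v → label forest u ≡ label forest v
      spans   : ∀ {e} → e ∈ˡ es → label forest (tail e) ≡ label forest (head e)

  -- Greedy choice: an edge is inserted unless its ends already lie in one tree, and later
  -- insertions only merge trees.
  extend : ∀ S es → Extension S es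
  extend S [] = record { forest = S ; keeps = id ; adds = inj₁ ; coarser = id ; spans = λ () }
  extend S (e ∷ es) with label S (tail e) Fin.≟ label S (head e)
  ... | yes same = record
    { forest  = forest
    ; keeps   = keeps
    ; adds    = λ t → [ inj₁ , inj₂ ∘ there ] (adds t)
    ; coarser = coarser
    ; spans   = λ { (here ≡.refl) → coarser same ; (there e∈es) → spans e∈es }
    }
    where open Extension (extend S es)
  ... | no differ = record
    { forest  = forest
    ; keeps   = keeps ∘ I.tree⊆tree′
    ; adds    = λ t → [ (λ t′ → [ inj₂ ∘ here ∘ ≡.sym , inj₁ ] (I.tree′-cases t′)) , inj₂ ∘ there ] (adds t)
    ; coarser = coarser ∘ I.coarser
    ; spans   = λ { (here ≡.refl) → coarser I.label′-e ; (there e∈es) → spans e∈es }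
    }
    where
    module I = Insert S e differ
    open Extension (extend I.insert es)

  module _ (S : Forest) {k} (en : Enumeration (λ e → tree S e ≢ true) k) (z : Fin k → E → ℤ)
           (z∈H₁ : ∀ i → z i ∈ H₁) (z-off : ∀ i {e} → tree S e ≢ true → z i e ≡ δℤ (Enumeration.at en i) e) where
    open Enumeration en

    combination-off : ∀ c j → combination c z (at j) ≡ c j
    combination-off c j = ≡.trans
      (ℤS.sum-single {f = λ i → c i ℤ.* z i (at j)} j λ i i≢j →
        ≡.trans (≡.cong (c i ℤ.*_) (≡.trans (z-off i (at-∈ j)) (δℤ-≢ (i≢j ∘ injective)))) (ℤ.*-zeroʳ (c i)))
      (≡.trans (≡.cong (c j ℤ.*_) (≡.trans (z-off j (at-∈ j)) (δℤ-refl (at j)))) (ℤ.*-identityʳ (c j)))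

    -- The difference of the two sides is a cycle that vanishes off the forest. The coefficients are
    -- simply the values of `x` on the edges off the forest.
    expansion : ∀ x → x ∈ H₁ → ∀ e → x e ≡ combination (x ∘ at) z e
    expansion x x∈H₁ e = ℤ.i-j≡0⇒i≡j (x e) _ (acyclic S d d∈H₁ off e)
      where
      d : E → ℤ
      d e = x e ℤ.- combination (x ∘ at) z e
      d∈H₁ : d ∈ H₁
      d∈H₁ v = begin
        ∂ d v
          ≡⟨ ∂≡combination d v ⟩
        combination d incidence v
          ≡⟨ combination-+ x (λ e → ℤ.- combination (x ∘ at) z e) incidence v ⟩
        combination x incidence v ℤ.+ combination (λ e → ℤ.- combination (x ∘ at) z e) incidence v
          ≡⟨ ≡.cong₂ ℤ._+_ (≡.trans (≡.sym (∂≡combination x v)) (x∈H₁ v))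
               (≡.trans (combination-neg (combination (x ∘ at) z) incidence v)
                 (≡.cong ℤ.-_ (≡.trans (≡.sym (∂≡combination (combination (x ∘ at) z) v))
                   (H₁-combination (x ∘ at) z z∈H₁ (combination (x ∘ at) z) (λ _ → ≡.refl) v)))) ⟩
        0ℤ ∎
        where open ≡-Reasoning
      off : ∀ e → tree S e ≢ true → d e ≡ 0ℤ
      off e ¬t with index e ¬t
      ... | j , ≡.refl = ≡.trans (≡.cong (λ y → x (at j) ℤ.- y) (combination-off (x ∘ at) j)) (ℤ.+-inverseʳ (x (at j)))

    fundamental-basis : IsBasis H₁ IsZero z
    fundamental-basis = record
      { member      = z∈H₁
      ; spanning    = λ x x∈H₁ → x ∘ at , λ e → ≡.trans (≡.cong (λ y → y ℤ.- combination (x ∘ at) z e) (expansion x x∈H₁ e))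
                        (ℤ.+-inverseʳ (combination (x ∘ at) z e))
      ; independent = λ c eq j → ≡.trans (≡.sym (combination-off c j)) (eq (at j))
      }

pos-sum : ∀ {n} (f : Fin n → ℕ) → + ℕΣ.sum f ≡ ℤΣ.sum (λ i → + f i)
pos-sum {zero}  f = ≡.refl
pos-sum {suc n} f = ≡.trans (ℤ.pos-+ (f zero) (ℕΣ.sum (f ∘ suc))) (≡.cong (λ z → + f zero ℤ.+ z) (pos-sum (f ∘ suc)))

-- The only positive decompositions are 2 and 1 + 1. This converts the number of preimages, by which
-- dilation is defined, into degrees.
positive-sum-2 : ∀ {k} (f : Fin k → ℕ) → (∀ i → 0 ℕ.< f i) → ℕΣ.sum f ≡ 2 →
                 (k ≡ 1 → ∀ i → f i ≡ 2) × (k ≢ 1 → ∀ i → f i ≡ 1)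
positive-sum-2 {1} f pos eq = (λ { _ zero → ≡.trans (≡.sym (ℕ.+-identityʳ (f zero))) eq }) , λ ne → ⊥-elim (ne ≡.refl)
positive-sum-2 {2} f pos eq = (λ ()) , λ _ → both (f zero) (f (suc zero)) (pos zero) (pos (suc zero)) eq ≡.refl ≡.refl
  where
  both : ∀ a b → 0 ℕ.< a → 0 ℕ.< b → a ℕ.+ (b ℕ.+ 0) ≡ 2 → f zero ≡ a → f (suc zero) ≡ b → ∀ i → f i ≡ 1
  both 1 1 _ _ _ p q zero       = p
  both 1 1 _ _ _ p q (suc zero) = q
  both 1 (suc (suc b)) _ _ ()
  both (suc (suc a)) (suc b) _ _ eq rewrite ℕ.+-suc a (b ℕ.+ 0) with () ← eq
positive-sum-2 {suc (suc (suc k))} f pos eq = ⊥-elim (ℕ.<-irrefl (≡.sym eq)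
  (ℕ.+-mono-≤ (pos zero) (ℕ.+-mono-≤ (pos (suc zero)) (ℕ.+-mono-≤ (pos (suc (suc zero))) ℕ.z≤n))))

sumOver-positive : ∀ {n p k} {P : Pred (Fin n) p} (P? : Decidable P) (f : Fin n → ℕ) →
                   0 ℕ.< k → ℕΣ.sumOver P? f ≡ k → ∃ P
sumOver-positive P? f 0<k eq with Fin.any? P?
... | yes found = found
... | no none   = ⊥-elim (ℕ.<-irrefl (≡.sym (≡.trans (≡.sym eq) (ℕS.sum-zero λ i → ℕS.if-no (P? i) λ p → none (i , p)))) 0<k)

sumOver-positive-2 : ∀ {n p} {P : Pred (Fin n) p} (P? : Decidable P) (f : Fin n → ℕ) →
                     (∀ i → 0 ℕ.< f i) → ℕΣ.sumOver P? f ≡ 2 →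
                     (count P? ≡ 1 → ∀ x → P x → f x ≡ 2) × (count P? ≢ 1 → ∀ x → P x → f x ≡ 1)
sumOver-positive-2 {P = P} P? f pos eq =
  (λ k≡1 x Px → let i , at≡x = index x Px in ≡.trans (≡.cong f (≡.sym at≡x)) (proj₁ values k≡1 i)) ,
  (λ k≢1 x Px → let i , at≡x = index x Px in ≡.trans (≡.cong f (≡.sym at≡x)) (proj₂ values k≢1 i))
  where
  open Enumeration (enumerate P?)
  g : Fin _ → ℕ
  g i = if does (P? i) then f i else 0
  off : ∀ x → P x ⊎ g x ≡ 0
  off x with P? x
  ... | yes p = inj₁ p
  ... | no _  = inj₂ ≡.refl
  values = positive-sum-2 (f ∘ at) (pos ∘ at) (≡.trans
    (ℕS.sum-cong-≋ λ i → ≡.sym (ℕS.if-yes (P? (at i)) (at-∈ i)))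
    (≡.trans (ℕS.sum-reindex (enumerate P?) g off) eq))

-- Double covers

module Cover {c ℓ₁ ℓ₂} (F : OrderedField c ℓ₁ ℓ₂) {Γ̃ Γ : MetricGraph F} (π : DoubleCover F Γ̃ Γ)
             (õ : Orientation (MetricGraph.graph Γ̃)) (o : Orientation (MetricGraph.graph Γ))
             (compatible : DoubleCover.Compatible π õ o) where
  open DoubleCover π
  module S where
    open MetricGraph Γ̃ public
    open Orientation õ public
    open Homology õ public
    open Chains õ public
  module T where
    open MetricGraph Γ public
    open Orientation o public
    open Homology o public
    open Chains o public

  onV-tail : ∀ ẽ → onV (S.tail ẽ) ≡ T.tail (onE ẽ)
  onV-tail ẽ = ≡.trans (onV-root (S.start ẽ)) (≡.cong T.root (compatible ẽ))

  compatible-inv : ∀ ẽ → onH (S.inv (S.start ẽ)) ≡ T.inv (T.start (onE ẽ))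
  compatible-inv ẽ = ≡.trans (onH-inv (S.start ẽ)) (≡.cong T.inv (compatible ẽ))

  onV-head : ∀ ẽ → onV (S.head ẽ) ≡ T.head (onE ẽ)
  onV-head ẽ = ≡.trans (onV-root (S.inv (S.start ẽ))) (≡.cong T.root (compatible-inv ẽ))

  -- The two halves of an edge have images exchanged by the involution downstairs, which has no
  -- fixed points, so the images differ.
  fibre-edge-injective : ∀ {h̃ h̃′} → S.edge h̃ ≡ S.edge h̃′ → onH h̃ ≡ onH h̃′ → h̃ ≡ h̃′
  fibre-edge-injective {h̃} {h̃′} same-edge same with Equivalence.to (proj₂ S.edgeQuotient h̃ h̃′) same-edge
  ... | inj₁ eq = ≡.sym eq
  ... | inj₂ eq = ⊥-elim (T.no-fixed (onH h̃) (≡.trans (≡.sym (≡.trans (≡.cong onH eq) (onH-inv h̃))) (≡.sym same)))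

  -- ẽnd ranges over the two ends of an edge: start and inv ∘ start.
  module Ends (ẽnd : S.E → S.H) (end : T.E → T.H) (edge-ẽnd : ∀ ẽ → S.edge (ẽnd ẽ) ≡ ẽ)
              (edge-end : ∀ e → T.edge (end e) ≡ e) (ends : ∀ ẽ → onH (ẽnd ẽ) ≡ end (onE ẽ)) where

    ẽnd-edge : ∀ {h̃ e} → onH h̃ ≡ end e → ẽnd (S.edge h̃) ≡ h̃
    ẽnd-edge {h̃} {e} eq = fibre-edge-injective (edge-ẽnd (S.edge h̃)) (begin
      onH (ẽnd (S.edge h̃))        ≡⟨ ends (S.edge h̃) ⟩
      end (onE (S.edge h̃))        ≡⟨ ≡.cong end (onE-edge h̃) ⟩
      end (T.edge (onH h̃))        ≡⟨ ≡.cong (end ∘ T.edge) eq ⟩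
      end (T.edge (end e))        ≡⟨ ≡.cong end (edge-end e) ⟩
      end e                       ≡⟨ eq ⟨
      onH h̃                       ∎)
      where open ≡-Reasoning

    module _ {p} {P : Pred S.H p} (P? : Decidable P) {q} {Q : Pred S.E q} (Q? : Decidable Q)
             {e} (over : ∀ {h̃} → P h̃ → onH h̃ ≡ end e) (P⇒Q : ∀ {ẽ} → P (ẽnd ẽ) → Q ẽ) (Q⇒P : ∀ {ẽ} → Q ẽ → P (ẽnd ẽ)) where

      -- The degree axioms are phrased with half-edges. Over one chosen end of `e`, half-edges and
      -- edges correspond, and the axioms carry over to edges.
      half-edges : Enumeration P (count Q?)
      half-edges = record
        { at        = ẽnd ∘ at
        ; at-∈      = Q⇒P ∘ at-∈
        ; injective = λ {i} {j} eq → injective (≡.trans (≡.sym (edge-ẽnd (at i))) (≡.trans (≡.cong S.edge eq) (edge-ẽnd (at j))))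
        ; index     = λ h̃ Ph̃ → let i , eq = index (S.edge h̃) (P⇒Q (≡.subst P (≡.sym (ẽnd-edge (over Ph̃))) Ph̃))
                                in i , ≡.trans (≡.cong ẽnd eq) (ẽnd-edge (over Ph̃))
        }
        where open Enumeration (enumerate Q?)

      sum-half-edges : ℕΣ.sumOver P? (degE ∘ S.edge) ≡ ℕΣ.sumOver Q? degE
      sum-half-edges = begin
        ℕΣ.sum f                                       ≡⟨ ℕS.sum-reindex half-edges f (off P? (degE ∘ S.edge)) ⟨
        ℕΣ.sum (f ∘ ẽnd ∘ at)                          ≡⟨ ℕS.sum-cong-≋ (λ i → ≡.trans (ℕS.if-yes (P? (ẽnd (at i))) (Q⇒P (at-∈ i)))
                                                             (≡.trans (≡.cong degE (edge-ẽnd (at i))) (≡.sym (ℕS.if-yes (Q? (at i)) (at-∈ i))))) ⟩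
        ℕΣ.sum (g ∘ at)                                ≡⟨ ℕS.sum-reindex (enumerate Q?) g (off Q? degE) ⟩
        ℕΣ.sum g                                       ∎
        where
        open ≡-Reasoning
        open Enumeration (enumerate Q?)
        f : S.H → ℕ
        f h̃ = if does (P? h̃) then degE (S.edge h̃) else 0
        g : S.E → ℕ
        g ẽ = if does (Q? ẽ) then degE ẽ else 0
        off : ∀ {n r} {R : Pred (Fin n) r} (R? : Decidable R) (d : Fin n → ℕ) x →
              R x ⊎ (if does (R? x) then d x else 0) ≡ 0
        off R? d x with R? x
        ... | yes r = inj₁ r
        ... | no _  = inj₂ ≡.refl

    degree-E : ∀ e → ℕΣ.sumOver (λ ẽ → onE ẽ Fin.≟ e) degE ≡ 2
    degree-E e = ≡.trans (≡.sym (sum-half-edges (λ h̃ → onH h̃ Fin.≟ end e) (λ ẽ → onE ẽ Fin.≟ e) id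
        (λ {ẽ} eq → ≡.trans (≡.sym (edge-end (onE ẽ))) (≡.trans (≡.cong T.edge (≡.trans (≡.sym (ends ẽ)) eq)) (edge-end e)))
        (λ {ẽ} eq → ≡.trans (ends ẽ) (≡.cong end eq))))
      (degree-H (end e))

    degree-end : ∀ ṽ e → T.root (end e) ≡ onV ṽ →
                 ℕΣ.sumOver (λ ẽ → (S.root (ẽnd ẽ) Fin.≟ ṽ) ×-dec (onE ẽ Fin.≟ e)) degE ≡ degV ṽ
    degree-end ṽ e eq = ≡.trans (≡.sym (sum-half-edges
        (λ h̃ → S.root h̃ Fin.≟ ṽ ×-dec onH h̃ Fin.≟ end e) (λ ẽ → (S.root (ẽnd ẽ) Fin.≟ ṽ) ×-dec (onE ẽ Fin.≟ e)) proj₂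
        (λ {ẽ} (r , eq) → r , ≡.trans (≡.sym (edge-end (onE ẽ))) (≡.trans (≡.cong T.edge (≡.trans (≡.sym (ends ẽ)) eq)) (edge-end e)))
        (λ {ẽ} (r , eq) → r , ≡.trans (ends ẽ) (≡.cong end eq))))
      (≡.sym (harmonic ṽ (end e) eq))

    module _ (root-ends : ∀ ẽ → onV (S.root (ẽnd ẽ)) ≡ T.root (end (onE ẽ))) where

      -- Group the edges upstairs by their images. If `e` ends at `onV ṽ`, harmonicity sums the
      -- degrees of its lifts at `ṽ` to `degV ṽ`; if not, none of its lifts ends at `ṽ`.
      pullback-end : ∀ (b : T.E → ℤ) ṽ →
        ℤΣ.sum (λ ẽ → (+ degE ẽ ℤ.* b (onE ẽ)) ℤ.* δℤ (S.root (ẽnd ẽ)) ṽ) ≡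
        + degV ṽ ℤ.* combination b (δℤ ∘ T.root ∘ end) (onV ṽ)
      pullback-end b ṽ = begin
        ℤΣ.sum g
          ≡⟨ ℤS.sum-fibres onE g ⟨
        ℤΣ.sum (λ e → ℤΣ.sum λ ẽ → if does (onE ẽ Fin.≟ e) then g ẽ else 0ℤ)
          ≡⟨ ℤS.sum-cong-≋ over ⟩
        ℤΣ.sum (λ e → + degV ṽ ℤ.* (b e ℤ.* δℤ (T.root (end e)) (onV ṽ)))
          ≡⟨ ℤS.*-distribˡ-sum (+ degV ṽ) (λ e → b e ℤ.* δℤ (T.root (end e)) (onV ṽ)) ⟨
        + degV ṽ ℤ.* combination b (δℤ ∘ T.root ∘ end) (onV ṽ) ∎
        where
        open ≡-Reasoning
        g : S.E → ℤ
        g ẽ = (+ degE ẽ ℤ.* b (onE ẽ)) ℤ.* δℤ (S.root (ẽnd ẽ)) ṽ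
        over : ∀ e → ℤΣ.sum (λ ẽ → if does (onE ẽ Fin.≟ e) then g ẽ else 0ℤ) ≡
                     + degV ṽ ℤ.* (b e ℤ.* δℤ (T.root (end e)) (onV ṽ))
        over e with T.root (end e) Fin.≟ onV ṽ
        ... | no ne = ≡.trans (ℤS.sum-zero λ ẽ → zero-term ẽ (onE ẽ Fin.≟ e))
              (≡.sym (≡.trans (≡.cong (+ degV ṽ ℤ.*_) (ℤ.*-zeroʳ (b e))) (ℤ.*-zeroʳ (+ degV ṽ))))
          where
          zero-term : ∀ ẽ (d : Dec (onE ẽ ≡ e)) → (if does d then g ẽ else 0ℤ) ≡ 0ℤ
          zero-term ẽ (no _)       = ≡.refl
          zero-term ẽ (yes ≡.refl) = ≡.trans
            (≡.cong ((+ degE ẽ ℤ.* b (onE ẽ)) ℤ.*_) (δℤ-≢ λ eq → ne (≡.trans (≡.sym (root-ends ẽ)) (≡.cong onV eq))))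
            (ℤ.*-zeroʳ (+ degE ẽ ℤ.* b (onE ẽ)))
        ... | yes eq = begin
          ℤΣ.sum (λ ẽ → if does (onE ẽ Fin.≟ e) then g ẽ else 0ℤ)
            ≡⟨ ℤS.sum-cong-≋ (λ ẽ → term ẽ (onE ẽ Fin.≟ e) (S.root (ẽnd ẽ) Fin.≟ ṽ)) ⟩
          ℤΣ.sum (λ ẽ → + dE ẽ ℤ.* (b e ℤ.* 1ℤ))
            ≡⟨ ℤS.*-distribʳ-sum (b e ℤ.* 1ℤ) (λ ẽ → + dE ẽ) ⟨
          ℤΣ.sum (λ ẽ → + dE ẽ) ℤ.* (b e ℤ.* 1ℤ)
            ≡⟨ ≡.cong (ℤ._* (b e ℤ.* 1ℤ)) (≡.trans (≡.sym (pos-sum dE)) (≡.cong +_ (degree-end ṽ e eq))) ⟩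
          + degV ṽ ℤ.* (b e ℤ.* 1ℤ) ∎
          where
          dE : S.E → ℕ
          dE ẽ = if does ((S.root (ẽnd ẽ) Fin.≟ ṽ) ×-dec (onE ẽ Fin.≟ e)) then degE ẽ else 0
          term : ∀ ẽ (d : Dec (onE ẽ ≡ e)) (d′ : Dec (S.root (ẽnd ẽ) ≡ ṽ)) →
                 (if does d then (+ degE ẽ ℤ.* b (onE ẽ)) ℤ.* (if does d′ then 1ℤ else 0ℤ) else 0ℤ) ≡
                 + (if does (d′ ×-dec d) then degE ẽ else 0) ℤ.* (b e ℤ.* 1ℤ)
          term ẽ (yes ≡.refl) (yes _) = ℤ.*-assoc (+ degE ẽ) (b e) 1ℤ
          term ẽ (yes ≡.refl) (no _)  = ≡.trans (ℤ.*-zeroʳ (+ degE ẽ ℤ.* b e)) (≡.sym (ℤ.*-zeroˡ (b e ℤ.* 1ℤ)))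
          term ẽ (no _) (yes _) = ≡.sym (ℤ.*-zeroˡ (b e ℤ.* 1ℤ))
          term ẽ (no _) (no _)  = ≡.sym (ℤ.*-zeroˡ (b e ℤ.* 1ℤ))

  module Start = Ends S.start T.start S.edge-start T.edge-start compatible
  module End = Ends (S.inv ∘ S.start) (T.inv ∘ T.start)
    (λ ẽ → ≡.trans (S.edge-inv (S.start ẽ)) (S.edge-start ẽ))
    (λ e → ≡.trans (T.edge-inv (T.start e)) (T.edge-start e)) compatible-inv

  degE-dilated : ∀ {ẽ} → DilatedE (onE ẽ) → degE ẽ ≡ 2
  degE-dilated {ẽ} dil = proj₁ (sumOver-positive-2 (λ ẽ′ → onE ẽ′ Fin.≟ onE ẽ) degE degE-pos (Start.degree-E (onE ẽ))) dil ẽ ≡.refl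

  degE-undilated : ∀ {ẽ} → ¬ DilatedE (onE ẽ) → degE ẽ ≡ 1
  degE-undilated {ẽ} undil = proj₂ (sumOver-positive-2 (λ ẽ′ → onE ẽ′ Fin.≟ onE ẽ) degE degE-pos (Start.degree-E (onE ẽ))) undil ẽ ≡.refl

  -- Degree 2 over dilated edges and 1 over the others absorbs the case distinction, after which
  -- harmonicity and the rule for lengths apply uniformly.
  π*-degree : ∀ b ẽ → π* b ẽ ≡ + degE ẽ ℤ.* b (onE ẽ)
  π*-degree b ẽ = choose (dilatedE? (onE ẽ))
    where
    choose : (d : Dec (DilatedE (onE ẽ))) → (if does d then + 2 ℤ.* b (onE ẽ) else b (onE ẽ)) ≡ + degE ẽ ℤ.* b (onE ẽ)
    choose (yes dil)  = ≡.cong (λ d → + d ℤ.* b (onE ẽ)) (≡.sym (degE-dilated dil))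
    choose (no undil) = ≡.trans (≡.sym (ℤ.*-identityˡ (b (onE ẽ)))) (≡.cong (λ d → + d ℤ.* b (onE ẽ)) (≡.sym (degE-undilated undil)))

  ∂-π* : ∀ b ṽ → S.∂ (π* b) ṽ ≡ + degV ṽ ℤ.* T.∂ b (onV ṽ)
  ∂-π* b ṽ = begin
    S.∂ (π* b) ṽ
      ≡⟨ ≡.cong₂ ℤ._-_ (half S.head) (half S.tail) ⟩
    ℤΣ.sum (λ ẽ → (+ degE ẽ ℤ.* b (onE ẽ)) ℤ.* δℤ (S.head ẽ) ṽ) ℤ.- ℤΣ.sum (λ ẽ → (+ degE ẽ ℤ.* b (onE ẽ)) ℤ.* δℤ (S.tail ẽ) ṽ)
      ≡⟨ ≡.cong₂ ℤ._-_ (End.pullback-end onV-head b ṽ) (Start.pullback-end onV-tail b ṽ) ⟩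
    + degV ṽ ℤ.* combination b (δℤ ∘ T.head) (onV ṽ) ℤ.- + degV ṽ ℤ.* combination b (δℤ ∘ T.tail) (onV ṽ)
      ≡⟨ distrib (+ degV ṽ) (combination b (δℤ ∘ T.head) (onV ṽ)) (combination b (δℤ ∘ T.tail) (onV ṽ)) ⟩
    + degV ṽ ℤ.* (combination b (δℤ ∘ T.head) (onV ṽ) ℤ.- combination b (δℤ ∘ T.tail) (onV ṽ))
      ≡⟨ ≡.cong (+ degV ṽ ℤ.*_) (≡.cong₂ ℤ._-_ (sumOver≡combination T.head b (onV ṽ)) (sumOver≡combination T.tail b (onV ṽ))) ⟨
    + degV ṽ ℤ.* T.∂ b (onV ṽ) ∎
    where
    open ≡-Reasoning
    half : ∀ (end : S.E → S.V) → ℤΣ.sumOver (λ ẽ → end ẽ Fin.≟ ṽ) (π* b) ≡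
                                 ℤΣ.sum (λ ẽ → (+ degE ẽ ℤ.* b (onE ẽ)) ℤ.* δℤ (end ẽ) ṽ)
    half end = ≡.trans (sumOver≡combination end (π* b) ṽ) (ℤS.sum-cong-≋ λ ẽ → ≡.cong (ℤ._* δℤ (end ẽ) ṽ) (π*-degree b ẽ))
    distrib : ∀ x y z → x ℤ.* y ℤ.- x ℤ.* z ≡ x ℤ.* (y ℤ.- z)
    distrib x y z = solve-ℤ (x ∷ y ∷ z ∷ [])

  π*-H₁ : ∀ b → b ∈ T.H₁ → π* b ∈ S.H₁
  π*-H₁ b b∈H₁ ṽ = ≡.trans (∂-π* b ṽ) (≡.trans (≡.cong (+ degV ṽ ℤ.*_) (b∈H₁ (onV ṽ))) (ℤ.*-zeroʳ (+ degV ṽ)))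

  π⁎≡combination : ∀ a e → π⁎ a e ≡ combination a (δℤ ∘ onE) e
  π⁎≡combination = sumOver≡combination onE

  -- The boundary of the pushforward at `v` is the boundary of `a` summed over the fibre of `v`:
  -- take the indicator of that fibre as the potential in `coboundary`.
  π⁎-H₁ : ∀ a → a ∈ S.H₁ → π⁎ a ∈ T.H₁
  π⁎-H₁ a a∈H₁ v = begin
    T.∂ (π⁎ a) v
      ≡⟨ T.∂≡combination (π⁎ a) v ⟩
    combination (π⁎ a) T.incidence v
      ≡⟨ combination-cong {c = π⁎ a} {combination a (δℤ ∘ onE)} {T.incidence} {T.incidence} (π⁎≡combination a) (λ _ _ → ≡.refl) v ⟩
    combination (combination a (δℤ ∘ onE)) T.incidence v
      ≡⟨ combination-combination a (δℤ ∘ onE) T.incidence v ⟨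
    combination a (λ ẽ → combination (δℤ (onE ẽ)) T.incidence) v
      ≡⟨ ℤS.sum-cong-≋ (λ ẽ → ≡.cong (a ẽ ℤ.*_) (≡.trans (combination-δ (onE ẽ) T.incidence v)
           (≡.cong₂ (λ x y → δℤ x v ℤ.- δℤ y v) (≡.sym (onV-head ẽ)) (≡.sym (onV-tail ẽ))))) ⟩
    ℤΣ.sum (λ ẽ → a ẽ ℤ.* (δℤ (onV (S.head ẽ)) v ℤ.- δℤ (onV (S.tail ẽ)) v))
      ≡⟨ S.coboundary (λ ṽ → δℤ (onV ṽ) v) a ⟨
    ℤΣ.sum (λ ṽ → δℤ (onV ṽ) v ℤ.* S.∂ a ṽ)
      ≡⟨ ℤS.sum-zero (λ ṽ → ≡.trans (≡.cong (δℤ (onV ṽ) v ℤ.*_) (a∈H₁ ṽ)) (ℤ.*-zeroʳ (δℤ (onV ṽ) v))) ⟩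
    0ℤ ∎
    where open ≡-Reasoning

  π⁎-π* : ∀ b e → π⁎ (π* b) e ≡ + 2 ℤ.* b e
  π⁎-π* b e = begin
    π⁎ (π* b) e
      ≡⟨ ℤS.sum-cong-≋ (λ ẽ → term ẽ (onE ẽ Fin.≟ e)) ⟩
    ℤΣ.sum (λ ẽ → + dE ẽ ℤ.* b e)
      ≡⟨ ℤS.*-distribʳ-sum (b e) (λ ẽ → + dE ẽ) ⟨
    ℤΣ.sum (λ ẽ → + dE ẽ) ℤ.* b e
      ≡⟨ ≡.cong (ℤ._* b e) (≡.trans (≡.sym (pos-sum dE)) (≡.cong +_ (Start.degree-E e))) ⟩
    + 2 ℤ.* b e ∎
    where
    open ≡-Reasoning
    dE : S.E → ℕ
    dE ẽ = if does (onE ẽ Fin.≟ e) then degE ẽ else 0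
    term : ∀ ẽ (d : Dec (onE ẽ ≡ e)) → (if does d then π* b ẽ else 0ℤ) ≡ + (if does d then degE ẽ else 0) ℤ.* b e
    term ẽ (yes ≡.refl) = π*-degree b ẽ
    term ẽ (no _)       = ≡.sym (ℤ.*-zeroˡ (b e))

  -- By harmonicity the degrees of the lifts at `ṽ` sum to the positive number `degV ṽ`, so there is
  -- at least one lift.
  lift-half-edge : ∀ ṽ h → T.root h ≡ onV ṽ → ∃[ h̃ ] S.root h̃ ≡ ṽ × onH h̃ ≡ h
  lift-half-edge ṽ h eq = sumOver-positive (λ h̃ → S.root h̃ Fin.≟ ṽ ×-dec onH h̃ Fin.≟ h) (degE ∘ S.edge)
    (degV-pos ṽ) (≡.sym (harmonic ṽ h eq))

  lift-vertex : ∀ v → ∃[ ṽ ] onV ṽ ≡ v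
  lift-vertex v = sumOver-positive (λ ṽ → onV ṽ Fin.≟ v) degV (ℕ.s≤s ℕ.z≤n) (degree-V v)

  lift-edge : ∀ e → ∃[ ẽ ] onE ẽ ≡ e
  lift-edge e = sumOver-positive (λ ẽ → onE ẽ Fin.≟ e) degE (ℕ.s≤s ℕ.z≤n) (Start.degree-E e)

  -- Each point over the root carries a lift of `h`. These lifts lie on the only edge over
  -- `T.edge h` and have the same image, so they coincide, and so do their roots.
  dilated-end : ∀ h → DilatedE (T.edge h) → DilatedV (T.root h)
  dilated-end h dil with lift-vertex (T.root h)
  ... | ṽ , over = count-single (λ ṽ → onV ṽ Fin.≟ T.root h) over (λ ṽ′ over′ → same over′ over)
    where
    same : ∀ {ṽ ṽ′} → onV ṽ ≡ T.root h → onV ṽ′ ≡ T.root h → ṽ ≡ ṽ′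
    same {ṽ} {ṽ′} over over′ with lift-half-edge ṽ h (≡.sym over) | lift-half-edge ṽ′ h (≡.sym over′)
    ... | h̃ , ≡.refl , p | h̃′ , ≡.refl , p′ = ≡.cong S.root (fibre-edge-injective
      (count-unique (λ ẽ → onE ẽ Fin.≟ T.edge h) dil
        (≡.trans (onE-edge h̃) (≡.cong T.edge p)) (≡.trans (onE-edge h̃′) (≡.cong T.edge p′)))
      (≡.trans p (≡.sym p′)))

  -- Compatibility of the orientations makes a half-edge the chosen one exactly when its image is,
  -- so the signs agree.
  π⁎-crossing : ∀ h̃ e → combination (S.crossing h̃) (δℤ ∘ onE) e ≡ T.crossing (onH h̃) e
  π⁎-crossing h̃ e = begin
    combination (S.crossing h̃) (δℤ ∘ onE) e
      ≡⟨ ℤS.sum-cong-≋ (λ ẽ → ℤ.*-assoc σ (δℤ (S.edge h̃) ẽ) (δℤ (onE ẽ) e)) ⟩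
    ℤΣ.sum (λ ẽ → σ ℤ.* (δℤ (S.edge h̃) ẽ ℤ.* δℤ (onE ẽ) e))
      ≡⟨ ℤS.*-distribˡ-sum σ (λ ẽ → δℤ (S.edge h̃) ẽ ℤ.* δℤ (onE ẽ) e) ⟨
    σ ℤ.* combination (δℤ (S.edge h̃)) (δℤ ∘ onE) e
      ≡⟨ ≡.cong₂ ℤ._*_ (signs (S.start-edge h̃))
           (≡.trans (combination-δ (S.edge h̃) (δℤ ∘ onE) e) (≡.cong (λ x → δℤ x e) (onE-edge h̃))) ⟩
    T.crossing (onH h̃) e ∎
    where
    open ≡-Reasoning
    h = onH h̃
    σ = if does (S.start (S.edge h̃) Fin.≟ h̃) then 1ℤ else -1ℤ
    start-onH : T.start (T.edge h) ≡ onH (S.start (S.edge h̃))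
    start-onH = ≡.trans (≡.cong T.start (≡.sym (onE-edge h̃))) (≡.sym (compatible (S.edge h̃)))
    signs : S.start (S.edge h̃) ≡ h̃ ⊎ S.start (S.edge h̃) ≡ S.inv h̃ →
            σ ≡ (if does (T.start (T.edge h) Fin.≟ h) then 1ℤ else -1ℤ)
    signs (inj₁ eq)
      rewrite dec-true (S.start (S.edge h̃) Fin.≟ h̃) eq
            | dec-true (T.start (T.edge h) Fin.≟ h) (≡.trans start-onH (≡.cong onH eq)) = ≡.refl
    signs (inj₂ eq)
      rewrite dec-false (S.start (S.edge h̃) Fin.≟ h̃) (λ eq′ → S.no-fixed h̃ (≡.trans (≡.sym eq) eq′))
            | dec-false (T.start (T.edge h) Fin.≟ h) (λ eq′ → T.no-fixed h
                (≡.trans (≡.sym (≡.trans start-onH (≡.trans (≡.cong onH eq) (onH-inv h̃)))) eq′)) = ≡.refl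

*-cancelˡ-nonzero : ∀ k x y → k ≢ 0ℤ → k ℤ.* x ≡ k ℤ.* y → x ≡ y
*-cancelˡ-nonzero k x y k≢0 = ℤ.*-cancelˡ-≡ k x y {{ℤ.≢-nonZero k≢0}}

-- Lifting cycles, and the cycles that are torsion in coker π*

module PrymLattices {c ℓ₁ ℓ₂} (F : OrderedField c ℓ₁ ℓ₂) {Γ̃ Γ : MetricGraph F} (π : DoubleCover F Γ̃ Γ)
                    (õ : Orientation (MetricGraph.graph Γ̃)) (o : Orientation (MetricGraph.graph Γ))
                    (compatible : DoubleCover.Compatible π õ o) where
  open DoubleCover π
  open Cover F π õ o compatible
  open Prym F π õ o

  module Lifting {v₀ : T.V} (v₀-dilated : DilatedV v₀) (connected : T.Connected) where

    ṽ₀ : S.V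
    ṽ₀ = proj₁ (lift-vertex v₀)

    push : (S.E → ℤ) → T.E → ℤ
    push a = combination a (δℤ ∘ onE)

    -- The start of the lift is prescribed and its end is determined only up to the fibre of `v₀`.
    -- That fibre is a single point by dilation, so all lifts meet in `ṽ₀`.
    lift-walk : ∀ {p} {P : Pred T.E p} {u} (hs : Star (T.Adjacent P) u v₀) ũ → onV ũ ≡ u →
                ∃[ p ] S.Bounds p ũ ṽ₀ × (∀ e → push p e ≡ T.walk hs e)
    lift-walk Star.ε ũ over
      with ≡.refl ← count-unique (λ ṽ → onV ṽ Fin.≟ v₀) v₀-dilated over (proj₂ (lift-vertex v₀)) =
      (λ _ → 0ℤ) ,
      (λ w → ≡.trans (ℤS.sum-zero λ e → ℤ.*-zeroˡ (S.incidence e w)) (≡.sym (ℤ.+-inverseʳ (δℤ ũ w)))) ,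
      (λ e → ℤS.sum-zero λ ẽ → ℤ.*-zeroˡ (δℤ (onE ẽ) e))
    lift-walk (T.step h _ ≡.refl ≡.refl ◅ hs) ũ over with lift-half-edge ũ h (≡.sym over)
    ... | h̃ , ≡.refl , onH≡h with lift-walk hs (S.root (S.inv h̃))
            (≡.trans (onV-root (S.inv h̃)) (≡.cong T.root (≡.trans (onH-inv h̃) (≡.cong T.inv onH≡h))))
    ...   | p , p-bounds , push-p =
      (λ ẽ → S.crossing h̃ ẽ ℤ.+ p ẽ) ,
      S.bounds-+ {S.crossing h̃} {p} {S.root h̃} {S.root (S.inv h̃)} {ṽ₀} (S.crossing-bounds h̃) p-bounds ,
      (λ e → ≡.trans (combination-+ (S.crossing h̃) p (δℤ ∘ onE) e)
        (≡.cong₂ ℤ._+_ (≡.trans (π⁎-crossing h̃ e) (≡.cong (λ h → T.crossing h e) onH≡h)) (push-p e)))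

    to-v₀ : ∀ v → Star (T.Adjacent (λ _ → ⊤)) v v₀
    to-v₀ v = Star.map (λ (h , source , target) → T.step h tt source target) (connected v v₀)

    path : S.V → S.E → ℤ
    path ṽ = proj₁ (lift-walk (to-v₀ (onV ṽ)) ṽ ≡.refl)

    path-bounds : ∀ ṽ → S.Bounds (path ṽ) ṽ ṽ₀
    path-bounds ṽ = proj₁ (proj₂ (lift-walk (to-v₀ (onV ṽ)) ṽ ≡.refl))

    push-path : ∀ ṽ e → push (path ṽ) e ≡ T.walk (to-v₀ (onV ṽ)) e
    push-path ṽ = proj₂ (proj₂ (lift-walk (to-v₀ (onV ṽ)) ṽ ≡.refl))

    -- A lift of e, closed up through ṽ₀.
    loop : T.E → S.E → ℤ
    loop e ẽ = δℤ ẽ₀ ẽ ℤ.+ (path (S.head ẽ₀) ẽ ℤ.- path (S.tail ẽ₀) ẽ)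
      where ẽ₀ = proj₁ (lift-edge e)

    combination-loop : ∀ {n} e (u : S.E → Fin n → ℤ) w → let ẽ₀ = proj₁ (lift-edge e) in
      combination (loop e) u w ≡ u ẽ₀ w ℤ.+ (combination (path (S.head ẽ₀)) u w ℤ.- combination (path (S.tail ẽ₀)) u w)
    combination-loop e u w = ≡.trans
      (combination-+ (δℤ ẽ₀) (λ ẽ → path (S.head ẽ₀) ẽ ℤ.- path (S.tail ẽ₀) ẽ) u w)
      (≡.cong₂ ℤ._+_ (combination-δ ẽ₀ u w)
        (≡.trans (combination-+ (path (S.head ẽ₀)) (λ ẽ → ℤ.- path (S.tail ẽ₀) ẽ) u w)
                 (≡.cong (λ z → combination (path (S.head ẽ₀)) u w ℤ.+ z) (combination-neg (path (S.tail ẽ₀)) u w))))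
      where ẽ₀ = proj₁ (lift-edge e)

    loop-H₁ : ∀ e → loop e ∈ S.H₁
    loop-H₁ e w = begin
      S.∂ (loop e) w
        ≡⟨ S.∂≡combination (loop e) w ⟩
      combination (loop e) S.incidence w
        ≡⟨ combination-loop e S.incidence w ⟩
      S.incidence ẽ₀ w ℤ.+ (combination (path (S.head ẽ₀)) S.incidence w ℤ.- combination (path (S.tail ẽ₀)) S.incidence w)
        ≡⟨ ≡.cong₂ (λ x y → S.incidence ẽ₀ w ℤ.+ (x ℤ.- y)) (path-bounds (S.head ẽ₀) w) (path-bounds (S.tail ẽ₀) w) ⟩
      S.incidence ẽ₀ w ℤ.+ ((δℤ ṽ₀ w ℤ.- δℤ (S.head ẽ₀) w) ℤ.- (δℤ ṽ₀ w ℤ.- δℤ (S.tail ẽ₀) w))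
        ≡⟨ cancel (δℤ (S.head ẽ₀) w) (δℤ (S.tail ẽ₀) w) (δℤ ṽ₀ w) ⟩
      0ℤ ∎
      where
      open ≡-Reasoning
      ẽ₀ = proj₁ (lift-edge e)
      cancel : ∀ x y z → (x ℤ.- y) ℤ.+ ((z ℤ.- x) ℤ.- (z ℤ.- y)) ≡ 0ℤ
      cancel x y z = solve-ℤ (x ∷ y ∷ z ∷ [])

    push-loop : ∀ e e′ → push (loop e) e′ ≡
                δℤ e e′ ℤ.+ (T.walk (to-v₀ (T.head e)) e′ ℤ.- T.walk (to-v₀ (T.tail e)) e′)
    push-loop e e′ = ≡.trans (combination-loop e (δℤ ∘ onE) e′)
      (≡.cong₂ ℤ._+_ (≡.cong (λ x → δℤ x e′) over) (≡.cong₂ ℤ._-_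
        (≡.trans (push-path (S.head ẽ₀) e′) (≡.cong (λ v → T.walk (to-v₀ v) e′) (≡.trans (onV-head ẽ₀) (≡.cong T.head over))))
        (≡.trans (push-path (S.tail ẽ₀) e′) (≡.cong (λ v → T.walk (to-v₀ v) e′) (≡.trans (onV-tail ẽ₀) (≡.cong T.tail over))))))
      where
      ẽ₀ = proj₁ (lift-edge e)
      over = proj₂ (lift-edge e)

    lift : (T.E → ℤ) → S.E → ℤ
    lift a = combination a loop

    lift-H₁ : ∀ a → lift a ∈ S.H₁
    lift-H₁ a = S.H₁-combination a loop loop-H₁ (lift a) (λ _ → ≡.refl)

    -- The image of a path depends only on the vertex below, so the pushed closing paths contribute
    -- φ(head) - φ(tail), where φ(v) is the coefficient at `e` of the chosen walk from v to `v₀`. On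
    -- a cycle these contributions cancel by `coboundary`.
    π⁎-lift : ∀ a → a ∈ T.H₁ → ∀ e → π⁎ (lift a) e ≡ a e
    π⁎-lift a a∈H₁ e = begin
      π⁎ (lift a) e
        ≡⟨ π⁎≡combination (lift a) e ⟩
      push (lift a) e
        ≡⟨ combination-combination a loop (δℤ ∘ onE) e ⟨
      combination a (λ e′ → push (loop e′)) e
        ≡⟨ ℤS.sum-cong-≋ (λ e′ → ≡.trans (≡.cong (a e′ ℤ.*_) (push-loop e′ e)) (ℤ.*-distribˡ-+ (a e′) (δℤ e′ e) (φ (T.head e′) ℤ.- φ (T.tail e′)))) ⟩
      ℤΣ.sum (λ e′ → a e′ ℤ.* δℤ e′ e ℤ.+ a e′ ℤ.* (φ (T.head e′) ℤ.- φ (T.tail e′)))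
        ≡⟨ ℤS.∑-distrib-+ (λ e′ → a e′ ℤ.* δℤ e′ e) (λ e′ → a e′ ℤ.* (φ (T.head e′) ℤ.- φ (T.tail e′))) ⟩
      ℤΣ.sum (λ e′ → a e′ ℤ.* δℤ e′ e) ℤ.+ ℤΣ.sum (λ e′ → a e′ ℤ.* (φ (T.head e′) ℤ.- φ (T.tail e′)))
        ≡⟨ ≡.cong₂ ℤ._+_ (ℤS.sum-single {f = λ e′ → a e′ ℤ.* δℤ e′ e} e λ e′ e′≢e → ≡.trans (≡.cong (a e′ ℤ.*_) (δℤ-≢ e′≢e)) (ℤ.*-zeroʳ (a e′)))
             (≡.sym (T.coboundary φ a)) ⟩
      a e ℤ.* δℤ e e ℤ.+ ℤΣ.sum (λ v → φ v ℤ.* T.∂ a v)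
        ≡⟨ ≡.cong₂ ℤ._+_ (≡.trans (≡.cong (a e ℤ.*_) (δℤ-refl e)) (ℤ.*-identityʳ (a e)))
             (ℤS.sum-zero λ v → ≡.trans (≡.cong (φ v ℤ.*_) (a∈H₁ v)) (ℤ.*-zeroʳ (φ v))) ⟩
      a e ℤ.+ 0ℤ
        ≡⟨ ℤ.+-identityʳ (a e) ⟩
      a e ∎
      where
      open ≡-Reasoning
      φ : T.V → ℤ
      φ v = T.walk (to-v₀ v) e

    π⁎-combination : ∀ {n} (c : Fin n → ℤ) (u : Fin n → S.E → ℤ) e →
                     π⁎ (combination c u) e ≡ combination c (π⁎ ∘ u) e
    π⁎-combination c u e = begin
      π⁎ (combination c u) e                   ≡⟨ π⁎≡combination (combination c u) e ⟩
      push (combination c u) e                 ≡⟨ combination-combination c u (δℤ ∘ onE) e ⟨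
      combination c (λ i → push (u i)) e       ≡⟨ ℤS.sum-cong-≋ (λ i → ≡.cong (c i ℤ.*_) (π⁎≡combination (u i) e)) ⟨
      combination c (π⁎ ∘ u) e                 ∎
      where open ≡-Reasoning

    -- Lifting shows that `π⁎` maps H₁(Γ̃) onto H₁(Γ) with kernel K′, and the lifts of `γ` form a
    -- basis of the quotient.
    lift-basis : ∀ {g h} {γ : Fin g → T.E → ℤ} {l : Fin h → S.E → ℤ} → IsBasis T.H₁ IsZero γ → IsBasisOfK′ l →
                 IsBasis S.H₁ IsZero (l ++ (lift ∘ γ))
    lift-basis {γ = γ} {l} γ-basis l-basis = quotient-basis proj₁ closed l-basis record
      { member      = λ i → lift-H₁ (γ i)
      ; spanning    = spanning
      ; independent = λ c (_ , π⁎≡0) → coordinates-unique γ-basis c (λ _ → 0ℤ) λ e → begin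
          combination c γ e                      ≡⟨ π⁎-combination-lift c e ⟨
          π⁎ (combination c (lift ∘ γ)) e        ≡⟨ π⁎≡0 e ⟩
          0ℤ                                     ≡⟨ ℤS.sum-zero (λ i → ℤ.*-zeroˡ (γ i e)) ⟨
          combination (λ _ → 0ℤ) γ e             ∎
      }
      where
      open ≡-Reasoning
      module γ = IsBasis γ-basis
      module l = IsBasis l-basis
      closed : ∀ c x → (∀ e → x e ≡ combination c l e) → x ∈ Kerπ⁎
      closed c x eq = S.H₁-combination c l (λ i → proj₁ (l.member i)) x eq , λ e → begin
        π⁎ x e                        ≡⟨ ℤS.sumOver-cong (λ ẽ → onE ẽ Fin.≟ e) (λ ẽ _ → eq ẽ) ⟩
        π⁎ (combination c l) e        ≡⟨ π⁎-combination c l e ⟩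
        combination c (π⁎ ∘ l) e      ≡⟨ ℤS.sum-zero (λ i → ≡.trans (≡.cong (c i ℤ.*_) (proj₂ (l.member i) e)) (ℤ.*-zeroʳ (c i))) ⟩
        0ℤ                            ∎
      π⁎-combination-lift : ∀ c e → π⁎ (combination c (lift ∘ γ)) e ≡ combination c γ e
      π⁎-combination-lift c e = ≡.trans (π⁎-combination c (lift ∘ γ) e)
        (ℤS.sum-cong-≋ λ i → ≡.cong (c i ℤ.*_) (π⁎-lift (γ i) (γ.member i) e))
      spanning : ∀ x → x ∈ S.H₁ → ∃[ c ] (λ e → x e ℤ.- combination c (lift ∘ γ) e) ∈ Kerπ⁎
      spanning x x∈H₁ = a , d∈H₁ , λ e → begin
        π⁎ d e
          ≡⟨ π⁎≡combination d e ⟩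
        push d e
          ≡⟨ combination-+ x (λ ẽ → ℤ.- combination a (lift ∘ γ) ẽ) (δℤ ∘ onE) e ⟩
        push x e ℤ.+ push (λ ẽ → ℤ.- combination a (lift ∘ γ) ẽ) e
          ≡⟨ ≡.cong₂ ℤ._+_ (≡.sym (π⁎≡combination x e)) (combination-neg (combination a (lift ∘ γ)) (δℤ ∘ onE) e) ⟩
        π⁎ x e ℤ.- push (combination a (lift ∘ γ)) e
          ≡⟨ ≡.cong₂ ℤ._-_ (eq e) (≡.trans (≡.sym (π⁎≡combination (combination a (lift ∘ γ)) e)) (π⁎-combination-lift a e)) ⟩
        combination a γ e ℤ.- combination a γ e
          ≡⟨ ℤ.+-inverseʳ (combination a γ e) ⟩
        0ℤ ∎
        where
        a = proj₁ (coordinates γ-basis (π⁎ x) (π⁎-H₁ x x∈H₁))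
        eq = proj₂ (coordinates γ-basis (π⁎ x) (π⁎-H₁ x x∈H₁))
        d : S.E → ℤ
        d ẽ = x ẽ ℤ.- combination a (lift ∘ γ) ẽ
        d∈H₁ : d ∈ S.H₁
        d∈H₁ v = begin
          S.∂ d v
            ≡⟨ S.∂≡combination d v ⟩
          combination d S.incidence v
            ≡⟨ combination-+ x (λ ẽ → ℤ.- combination a (lift ∘ γ) ẽ) S.incidence v ⟩
          combination x S.incidence v ℤ.+ combination (λ ẽ → ℤ.- combination a (lift ∘ γ) ẽ) S.incidence v
            ≡⟨ ≡.cong₂ ℤ._+_ (≡.trans (≡.sym (S.∂≡combination x v)) (x∈H₁ v))
                 (≡.trans (combination-neg (combination a (lift ∘ γ)) S.incidence v)
                   (≡.cong ℤ.-_ (≡.trans (≡.sym (S.∂≡combination (combination a (lift ∘ γ)) v))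
                     (S.H₁-combination a (lift ∘ γ) (λ i → lift-H₁ (γ i)) (combination a (lift ∘ γ)) (λ _ → ≡.refl) v)))) ⟩
          0ℤ ∎

  -- Push k x = π* y forward: since `π⁎` after `π*` is doubling, k π⁎ x = 2 y. Substituting this and
  -- cancelling k gives 2 x = π*(π⁎ x), so the unknown multiplier is gone.
  torsion-double : ∀ x → x ∈ TorsionInCoker → ∀ ẽ → + 2 ℤ.* x ẽ ≡ + degE ẽ ℤ.* π⁎ x (onE ẽ)
  torsion-double x (x∈H₁ , k , y , k≢0 , y∈H₁ , kx≡π*y) ẽ = *-cancelˡ-nonzero k (+ 2 ℤ.* x ẽ) (+ degE ẽ ℤ.* π⁎ x (onE ẽ)) k≢0 (begin
    k ℤ.* (+ 2 ℤ.* x ẽ)                            ≡⟨ swap k (+ 2) (x ẽ) ⟩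
    + 2 ℤ.* (k ℤ.* x ẽ)                            ≡⟨ ≡.cong (+ 2 ℤ.*_) (≡.trans (kx≡π*y ẽ) (π*-degree y ẽ)) ⟩
    + 2 ℤ.* (+ degE ẽ ℤ.* y (onE ẽ))               ≡⟨ swap (+ 2) (+ degE ẽ) (y (onE ẽ)) ⟩
    + degE ẽ ℤ.* (+ 2 ℤ.* y (onE ẽ))               ≡⟨ ≡.cong (+ degE ẽ ℤ.*_) (push (onE ẽ)) ⟨
    + degE ẽ ℤ.* (k ℤ.* π⁎ x (onE ẽ))              ≡⟨ swap (+ degE ẽ) k (π⁎ x (onE ẽ)) ⟩
    k ℤ.* (+ degE ẽ ℤ.* π⁎ x (onE ẽ))              ∎)
    where
    open ≡-Reasoning
    swap : ∀ a b c → a ℤ.* (b ℤ.* c) ≡ b ℤ.* (a ℤ.* c)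
    swap a b c = solve-ℤ (a ∷ b ∷ c ∷ [])
    push : ∀ e → k ℤ.* π⁎ x e ≡ + 2 ℤ.* y e
    push e = begin
      k ℤ.* π⁎ x e                                            ≡⟨ ≡.cong (k ℤ.*_) (π⁎≡combination x e) ⟩
      k ℤ.* combination x (δℤ ∘ onE) e                        ≡⟨ ℤS.*-distribˡ-sum k (λ ẽ → x ẽ ℤ.* δℤ (onE ẽ) e) ⟩
      ℤΣ.sum (λ ẽ → k ℤ.* (x ẽ ℤ.* δℤ (onE ẽ) e))             ≡⟨ ℤS.sum-cong-≋ (λ ẽ → ≡.trans (≡.sym (ℤ.*-assoc k (x ẽ) (δℤ (onE ẽ) e))) (≡.cong (ℤ._* δℤ (onE ẽ) e) (kx≡π*y ẽ))) ⟩
      combination (π* y) (δℤ ∘ onE) e                         ≡⟨ π⁎≡combination (π* y) e ⟨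
      π⁎ (π* y) e                                             ≡⟨ π⁎-π* y e ⟩
      + 2 ℤ.* y e                                             ∎

  -- ν i is 1 or 2, according as z i is supported on dilated edges (so that π* (z i) is
  -- divisible by 2) or not.
  module TorsionBasis {k} (z : Fin k → T.E → ℤ) (z-basis : IsBasis T.H₁ IsZero z)
                      (ν : Fin k → ℤ) (ν≢0 : ∀ i → ν i ≢ 0ℤ)
                      (t : Fin k → S.E → ℤ) (t∈H₁ : ∀ i → t i ∈ S.H₁)
                      (2t≡νπ*z : ∀ i ẽ → + 2 ℤ.* t i ẽ ≡ ν i ℤ.* π* (z i) ẽ)
                      (divisible : ∀ x → x ∈ TorsionInCoker → ∀ a → (∀ e → π⁎ x e ≡ combination a z e) →
                                   ∀ i → ∃[ d ] a i ≡ d ℤ.* ν i) where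
    open ≡-Reasoning

    double-combination : ∀ c ẽ → + 2 ℤ.* combination c t ẽ ≡ + degE ẽ ℤ.* combination (λ i → c i ℤ.* ν i) z (onE ẽ)
    double-combination c ẽ = begin
      + 2 ℤ.* combination c t ẽ
        ≡⟨ ℤS.*-distribˡ-sum (+ 2) (λ i → c i ℤ.* t i ẽ) ⟩
      ℤΣ.sum (λ i → + 2 ℤ.* (c i ℤ.* t i ẽ))
        ≡⟨ ℤS.sum-cong-≋ (λ i → term i) ⟩
      ℤΣ.sum (λ i → + degE ẽ ℤ.* ((c i ℤ.* ν i) ℤ.* z i (onE ẽ)))
        ≡⟨ ℤS.*-distribˡ-sum (+ degE ẽ) (λ i → (c i ℤ.* ν i) ℤ.* z i (onE ẽ)) ⟨
      + degE ẽ ℤ.* combination (λ i → c i ℤ.* ν i) z (onE ẽ) ∎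
      where
      swap : ∀ a b c → a ℤ.* (b ℤ.* c) ≡ b ℤ.* (a ℤ.* c)
      swap a b c = solve-ℤ (a ∷ b ∷ c ∷ [])
      rearrange : ∀ c n d z → c ℤ.* (n ℤ.* (d ℤ.* z)) ≡ d ℤ.* ((c ℤ.* n) ℤ.* z)
      rearrange c n d z = solve-ℤ (c ∷ n ∷ d ∷ z ∷ [])
      term : ∀ i → + 2 ℤ.* (c i ℤ.* t i ẽ) ≡ + degE ẽ ℤ.* ((c i ℤ.* ν i) ℤ.* z i (onE ẽ))
      term i = begin
        + 2 ℤ.* (c i ℤ.* t i ẽ)                               ≡⟨ swap (+ 2) (c i) (t i ẽ) ⟩
        c i ℤ.* (+ 2 ℤ.* t i ẽ)                               ≡⟨ ≡.cong (c i ℤ.*_) (≡.trans (2t≡νπ*z i ẽ) (≡.cong (ν i ℤ.*_) (π*-degree (z i) ẽ))) ⟩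
        c i ℤ.* (ν i ℤ.* (+ degE ẽ ℤ.* z i (onE ẽ)))          ≡⟨ rearrange (c i) (ν i) (+ degE ẽ) (z i (onE ẽ)) ⟩
        + degE ẽ ℤ.* ((c i ℤ.* ν i) ℤ.* z i (onE ẽ))          ∎

    -- The multiplier 2 always suffices, because every 2 `t i` is a multiple of a pullback.
    combination-torsion : ∀ c x → (∀ ẽ → x ẽ ≡ combination c t ẽ) → x ∈ TorsionInCoker
    combination-torsion c x eq = S.H₁-combination c t t∈H₁ x eq ,
      + 2 , y , (λ ()) , T.H₁-combination (λ i → c i ℤ.* ν i) z (IsBasis.member z-basis) y (λ _ → ≡.refl) ,
      λ ẽ → ≡.trans (≡.cong (+ 2 ℤ.*_) (eq ẽ)) (≡.trans (double-combination c ẽ) (≡.sym (π*-degree y ẽ)))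
      where
      y : T.E → ℤ
      y = combination (λ i → c i ℤ.* ν i) z

    torsion-basis : IsBasis TorsionInCoker IsZero t
    torsion-basis = record
      { member      = λ i → combination-torsion (δℤ i) (t i) (λ ẽ → ≡.sym (combination-δ i t ẽ))
      ; spanning    = spanning
      ; independent = independent
      }
      where
      spanning : ∀ x → x ∈ TorsionInCoker → ∃[ c ] IsZero (λ ẽ → x ẽ ℤ.- combination c t ẽ)
      spanning x x∈ = b , λ ẽ → ℤ.i≡j⇒i-j≡0 {x ẽ} {combination b t ẽ} (*-cancelˡ-nonzero (+ 2) (x ẽ) (combination b t ẽ) (λ ()) (begin
        + 2 ℤ.* x ẽ                                                   ≡⟨ torsion-double x x∈ ẽ ⟩
        + degE ẽ ℤ.* π⁎ x (onE ẽ)                                     ≡⟨ ≡.cong (+ degE ẽ ℤ.*_) (≡.trans (eq (onE ẽ)) (ℤS.sum-cong-≋ λ i → ≡.cong (ℤ._* z i (onE ẽ)) (proj₂ (divisible x x∈ a eq i)))) ⟩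
        + degE ẽ ℤ.* combination (λ i → b i ℤ.* ν i) z (onE ẽ)        ≡⟨ double-combination b ẽ ⟨
        + 2 ℤ.* combination b t ẽ                                     ∎))
        where
        a = proj₁ (coordinates z-basis (π⁎ x) (π⁎-H₁ x (proj₁ x∈)))
        eq = proj₂ (coordinates z-basis (π⁎ x) (π⁎-H₁ x (proj₁ x∈)))
        -- The coordinates of `π⁎ x` divided by `ν`. They are the coordinates of `x` itself because
        -- both sides agree after doubling.
        b : Fin k → ℤ
        b i = proj₁ (divisible x x∈ a eq i)
      independent : ∀ c → IsZero (combination c t) → IsZero c
      independent c eq i = [ id , ⊥-elim ∘ ν≢0 i ] (ℤ.i*j≡0⇒i≡0∨j≡0 (c i) {ν i} (IsBasis.independent z-basis (λ i → c i ℤ.* ν i) zero-combination i))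
        where
        zero-combination : IsZero (combination (λ i → c i ℤ.* ν i) z)
        zero-combination e = ≡.subst (λ e → combination (λ i → c i ℤ.* ν i) z e ≡ 0ℤ) (proj₂ (lift-edge e)) (below (proj₁ (lift-edge e)))
          where
          below : ∀ ẽ → combination (λ i → c i ℤ.* ν i) z (onE ẽ) ≡ 0ℤ
          below ẽ = *-cancelˡ-nonzero (+ degE ẽ) (combination (λ i → c i ℤ.* ν i) z (onE ẽ)) 0ℤ
            (λ deg≡0 → ℕ.<-irrefl (≡.sym (ℤ.+-injective deg≡0)) (degE-pos ẽ)) (begin
              + degE ẽ ℤ.* combination (λ i → c i ℤ.* ν i) z (onE ẽ)        ≡⟨ double-combination c ẽ ⟨
              + 2 ℤ.* combination c t ẽ                                     ≡⟨ ≡.cong (+ 2 ℤ.*_) (eq ẽ) ⟩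
              0ℤ                                                            ≡⟨ ℤ.*-zeroʳ (+ degE ẽ) ⟨
              + degE ẽ ℤ.* 0ℤ                                               ∎)

  open FieldProperties F
  open Determinants F
  open Gram F

  -- The degree that `π*` introduces is the factor between the lengths of an edge and of its lift,
  -- so it turns the upper length into the lower one.
  adjoint : ∀ b a → pairing F Γ̃ (π* b) a ≈ pairing F Γ b (π⁎ a)
  adjoint b a = begin
    pairing F Γ̃ (π* b) a
      ≈⟨ pairing≈ Γ̃ (π* b) a ⟩
    sum (λ ẽ → ι (π* b ẽ) * (ι (a ẽ) * S.length ẽ))
      ≈⟨ sum-cong-≋ term ⟩
    sum (λ ẽ → ι (a ẽ) * G (onE ẽ))
      ≈⟨ sum-cong-≋ (λ ẽ → *-congˡ (sum-δ G (onE ẽ))) ⟨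
    sum (λ ẽ → ι (a ẽ) * sum (λ e → δ (onE ẽ) e * G e))
      ≈⟨ ⊛-assoc {n = 1} (λ _ ẽ → ι (a ẽ)) (λ ẽ e → δ (onE ẽ) e) (λ e (_ : Fin 1) → G e) zero zero ⟨
    sum (λ e → sum (λ ẽ → ι (a ẽ) * δ (onE ẽ) e) * G e)
      ≈⟨ sum-cong-≋ (λ e → *-congʳ (trans (sum-cong-≋ λ ẽ → *-congˡ (sym (ι-δℤ (onE ẽ) e))) (sym (ι-combination a (δℤ ∘ onE) e)))) ⟩
    sum (λ e → ι (combination a (δℤ ∘ onE) e) * G e)
      ≈⟨ sum-cong-≋ (λ e → trans (*-congʳ (reflexive (≡.cong ι (≡.sym (π⁎≡combination a e)))))
           (rotate (ι (π⁎ a e)) (ι (b e)) (T.length e))) ⟩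
    sum (λ e → ι (b e) * (ι (π⁎ a e) * T.length e))
      ≈⟨ pairing≈ Γ b (π⁎ a) ⟨
    pairing F Γ b (π⁎ a) ∎
    where
    G : T.E → Carrier
    G e = ι (b e) * T.length e
    rotate : ∀ x y z → x * (y * z) ≈ y * (x * z)
    rotate = solve 3 (λ x y z → x :* (y :* z) := y :* (x :* z)) refl
    term : ∀ ẽ → ι (π* b ẽ) * (ι (a ẽ) * S.length ẽ) ≈ ι (a ẽ) * G (onE ẽ)
    term ẽ = begin
      ι (π* b ẽ) * (ι (a ẽ) * S.length ẽ)
        ≈⟨ *-congʳ (trans (reflexive (≡.cong ι (π*-degree b ẽ))) (ι-* (+ degE ẽ) (b (onE ẽ)))) ⟩
      ι (+ degE ẽ) * ι (b (onE ẽ)) * (ι (a ẽ) * S.length ẽ)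
        ≈⟨ solve 4 (λ d b a l → d :* b :* (a :* l) := a :* (b :* (d :* l))) refl (ι (+ degE ẽ)) (ι (b (onE ẽ))) (ι (a ẽ)) (S.length ẽ) ⟩
      ι (a ẽ) * (ι (b (onE ẽ)) * (ι (+ degE ẽ) * S.length ẽ))
        ≈⟨ *-congˡ (*-congˡ (trans (sym (·≈ι* (+ degE ẽ) (S.length ẽ))) (sym (dilation ẽ)))) ⟩
      ι (a ẽ) * G (onE ẽ) ∎

-- Volumes

module JacobianVolume {c ℓ₁ ℓ₂} (F : OrderedField c ℓ₁ ℓ₂) (Γ : MetricGraph F)
                      (o : Orientation (MetricGraph.graph Γ)) where
  open MetricGraph Γ
  open Homology o
  open Chains o
  open FieldProperties F
  open Determinants F
  open Gram F

  private
    module X = Extension (extend discrete (allFin #E))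

  nontree : Enumeration (λ e → Forest.tree X.forest e ≢ true) _
  nontree = enumerate (λ e → ¬? (Forest.tree X.forest e Bool.≟ true))

  open Enumeration nontree

  cycle : Fin _ → E → ℤ
  cycle i = fundamental (at i) (Forest.connected X.forest (X.spans (∈-allFin (at i))))

  cycle-off : ∀ i {e} → Forest.tree X.forest e ≢ true → cycle i e ≡ δℤ (at i) e
  cycle-off i = fundamental-off (at i) (Forest.connected X.forest (X.spans (∈-allFin (at i))))

  cycle-basis : IsBasis H₁ IsZero cycle
  cycle-basis = fundamental-basis X.forest nontree cycle
    (λ i → fundamental-cycle (at i) (Forest.connected X.forest (X.spans (∈-allFin (at i))))) cycle-off

  -- Evaluating a relation at the edges off the forest isolates its coefficients one at a time.
  cycle-independent : Independent Γ cycle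
  cycle-independent x eq j = begin
    x j                                         ≈⟨ sum-δʳ x j ⟨
    sum (λ i → x i * δ i j)                     ≈⟨ sum-cong-≋ (λ i → *-congˡ (trans (reflexive (≡.cong ι (cycle-at i))) (ι-δℤ i j))) ⟨
    sum (λ i → x i * ι (cycle i (at j)))        ≈⟨ eq (at j) ⟩
    0#                                          ∎
    where
    cycle-at : ∀ i → cycle i (at j) ≡ δℤ i j
    cycle-at i = ≡.trans (cycle-off i (at-∈ j)) (δ-at (i Fin.≟ j))
      where
      δ-at : Dec (i ≡ j) → δℤ (at i) (at j) ≡ δℤ i j
      δ-at (yes ≡.refl) = ≡.trans (δℤ-refl (at i)) (≡.sym (δℤ-refl i))
      δ-at (no i≢j)     = ≡.trans (δℤ-≢ (i≢j ∘ injective)) (≡.sym (δℤ-≢ i≢j))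

  jacVol²-positive : ∀ {g} (γ : Fin g → E → ℤ) → IsBasisOfH₁ F Γ o γ → 0# < jacVol² F Γ γ
  jacVol²-positive γ γ-basis = gram-positive Γ γ (independent-change Γ cycle-basis γ-basis cycle-independent)

-- A cycle basis adapted to the dilation subgraph, and the exponent.

module Dilation {c ℓ₁ ℓ₂} (F : OrderedField c ℓ₁ ℓ₂) {Γ̃ Γ : MetricGraph F} (π : DoubleCover F Γ̃ Γ)
                (õ : Orientation (MetricGraph.graph Γ̃)) (o : Orientation (MetricGraph.graph Γ))
                (compatible : DoubleCover.Compatible π õ o) where
  open DoubleCover π
  open Cover F π õ o compatible
  open Prym F π õ o
  open PrymLattices F π õ o compatible

  undilatedE? : Decidable (λ e → ¬ DilatedE e)
  undilatedE? e = ¬? (dilatedE? e)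

  -- The first stage already connects the ends of every dilated edge by dilated tree edges. The
  -- second stage lists undilated edges only, so the dilated part of the forest does not change any
  -- more.
  module X₁ = T.Extension (T.extend T.discrete (filter dilatedE? (allFin T.#E)))
  module X₂ = T.Extension (T.extend X₁.forest (filter undilatedE? (allFin T.#E)))
  module F₁ = T.Forest X₁.forest
  module F₂ = T.Forest X₂.forest

  tree₁-dilated : ∀ {e} → F₁.Tree e → DilatedE e
  tree₁-dilated t with X₁.adds t
  ... | inj₂ e∈ = proj₂ (∈-filter⁻ dilatedE? {xs = allFin T.#E} e∈)

  spans₁ : ∀ {e} → DilatedE e → F₁.label (T.tail e) ≡ F₁.label (T.head e)
  spans₁ {e} dil = X₁.spans (∈-filter⁺ dilatedE? (∈-allFin e) dil)

  tree₂-dilated : ∀ {e} → F₂.Tree e → DilatedE e → F₁.Tree e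
  tree₂-dilated t dil with X₂.adds t
  ... | inj₁ t₁ = t₁
  ... | inj₂ e∈ = ⊥-elim (proj₂ (∈-filter⁻ undilatedE? {xs = allFin T.#E} e∈) dil)

  spans₂ : ∀ {e} → ¬ DilatedE e → F₂.label (T.tail e) ≡ F₂.label (T.head e)
  spans₂ {e} undil = X₂.spans (∈-filter⁺ undilatedE? (∈-allFin e) undil)

  nontree-dilated? : Decidable (λ e → DilatedE e × F₂.tree e ≢ true)
  nontree-dilated? e = dilatedE? e ×-dec ¬? (F₂.tree e Bool.≟ true)

  nontree-undilated? : Decidable (λ e → ¬ DilatedE e × F₂.tree e ≢ true)
  nontree-undilated? e = undilatedE? e ×-dec ¬? (F₂.tree e Bool.≟ true)

  r s : ℕ
  r = count nontree-dilated?
  s = count nontree-undilated?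

  module A₁ = Enumeration (enumerate nontree-dilated?)
  module A₂ = Enumeration (enumerate nontree-undilated?)

  nontree : Enumeration (λ e → F₂.tree e ≢ true) (r ℕ.+ s)
  nontree = Enumeration-++ (enumerate nontree-dilated?) (enumerate nontree-undilated?)
    (λ e ¬t → split e ¬t (dilatedE? e)) (λ _ → proj₂) (λ _ → proj₂) (λ _ (dil , _) (undil , _) → undil dil)
    where
    split : ∀ e → F₂.tree e ≢ true → Dec (DilatedE e) →
            (DilatedE e × F₂.tree e ≢ true) ⊎ (¬ DilatedE e × F₂.tree e ≢ true)
    split e ¬t (yes dil)  = inj₁ (dil , ¬t)
    split e ¬t (no undil) = inj₂ (undil , ¬t)

  -- Closing up inside the first forest keeps the cycle on dilated edges. For an undilated edge the
  -- full forest is required.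
  walk₁ : ∀ i → Star (T.Adjacent F₁.Tree) (T.tail (A₁.at i)) (T.head (A₁.at i))
  walk₁ i = F₁.connected (spans₁ (proj₁ (A₁.at-∈ i)))

  walk₂ : ∀ i → Star (T.Adjacent F₂.Tree) (T.tail (A₂.at i)) (T.head (A₂.at i))
  walk₂ i = F₂.connected (spans₂ (proj₁ (A₂.at-∈ i)))

  z₁ : Fin r → T.E → ℤ
  z₁ i = T.fundamental (A₁.at i) (walk₁ i)

  z₂ : Fin s → T.E → ℤ
  z₂ i = T.fundamental (A₂.at i) (walk₂ i)

  z : Fin (r ℕ.+ s) → T.E → ℤ
  z = z₁ ++ z₂

  z₁-undilated : ∀ i {e} → ¬ DilatedE e → z₁ i e ≡ 0ℤ
  z₁-undilated i {e} undil = ≡.trans (T.fundamental-off (A₁.at i) (walk₁ i) (undil ∘ tree₁-dilated))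
    (δℤ-≢ {i = A₁.at i} {e} λ eq → undil (≡.subst DilatedE eq (proj₁ (A₁.at-∈ i))))

  z∈H₁ : ∀ i → z i ∈ T.H₁
  z∈H₁ i = cases (splitAt r i)
    where
    cases : ∀ j → [ z₁ , z₂ ]′ j ∈ T.H₁
    cases (inj₁ j) = T.fundamental-cycle (A₁.at j) (walk₁ j)
    cases (inj₂ j) = T.fundamental-cycle (A₂.at j) (walk₂ j)

  z-off : ∀ i {e} → F₂.tree e ≢ true → z i e ≡ δℤ (Enumeration.at nontree i) e
  z-off i {e} ¬t = cases (splitAt r i)
    where
    cases : ∀ j → [ z₁ , z₂ ]′ j e ≡ δℤ ([ A₁.at , A₂.at ]′ j) e
    cases (inj₁ j) = T.fundamental-off (A₁.at j) (walk₁ j) (¬t ∘ X₂.keeps)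
    cases (inj₂ j) = T.fundamental-off (A₂.at j) (walk₂ j) ¬t

  z-basis : IsBasis T.H₁ IsZero z
  z-basis = T.fundamental-basis X₂.forest nontree z z∈H₁ z-off

  -- This is half of `π* (z₁ i)`: over dilated edges `π*` doubles coefficients, and over all others
  -- `z₁ i` is zero.
  t₁ : Fin r → S.E → ℤ
  t₁ i = z₁ i ∘ onE

  t₂ : Fin s → S.E → ℤ
  t₂ i = π* (z₂ i)

  t : Fin (r ℕ.+ s) → S.E → ℤ
  t = t₁ ++ t₂

  ν : Fin (r ℕ.+ s) → ℤ
  ν = (λ (_ : Fin r) → 1ℤ) ++ (λ (_ : Fin s) → + 2)

  2t₁≡π*z₁ : ∀ i ẽ → + 2 ℤ.* t₁ i ẽ ≡ π* (z₁ i) ẽ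
  2t₁≡π*z₁ i ẽ = ≡.trans (cases (dilatedE? (onE ẽ))) (≡.sym (π*-degree (z₁ i) ẽ))
    where
    cases : Dec (DilatedE (onE ẽ)) → + 2 ℤ.* z₁ i (onE ẽ) ≡ + degE ẽ ℤ.* z₁ i (onE ẽ)
    cases (yes dil)  = ≡.cong (λ d → + d ℤ.* z₁ i (onE ẽ)) (≡.sym (degE-dilated dil))
    cases (no undil) = ≡.trans (≡.cong (+ 2 ℤ.*_) (z₁-undilated i undil))
      (≡.sym (≡.trans (≡.cong (+ degE ẽ ℤ.*_) (z₁-undilated i undil)) (ℤ.*-zeroʳ (+ degE ẽ))))

  2t≡νπ*z : ∀ i ẽ → + 2 ℤ.* t i ẽ ≡ ν i ℤ.* π* (z i) ẽ
  2t≡νπ*z i ẽ = cases (splitAt r i)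
    where
    cases : ∀ j → + 2 ℤ.* [ t₁ , t₂ ]′ j ẽ ≡ [ (λ (_ : Fin r) → 1ℤ) , (λ (_ : Fin s) → + 2) ]′ j ℤ.* π* ([ z₁ , z₂ ]′ j) ẽ
    cases (inj₁ j) = ≡.trans (2t₁≡π*z₁ j ẽ) (≡.sym (ℤ.*-identityˡ (π* (z₁ j) ẽ)))
    cases (inj₂ j) = ≡.refl

  ν≢0 : ∀ i → ν i ≢ 0ℤ
  ν≢0 i = cases (splitAt r i)
    where
    cases : ∀ j → [ (λ (_ : Fin r) → 1ℤ) , (λ (_ : Fin s) → + 2) ]′ j ≢ 0ℤ
    cases (inj₁ j) ()
    cases (inj₂ j) ()

  -- Twice the chain is the pullback of a cycle, and boundaries have integer values, so 2 can be
  -- cancelled.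
  t₁∈H₁ : ∀ i → t₁ i ∈ S.H₁
  t₁∈H₁ i v = *-cancelˡ-nonzero (+ 2) (S.∂ (t₁ i) v) 0ℤ (λ ()) (begin
    + 2 ℤ.* S.∂ (t₁ i) v
      ≡⟨ ≡.cong (+ 2 ℤ.*_) (S.∂≡combination (t₁ i) v) ⟩
    + 2 ℤ.* combination (t₁ i) S.incidence v
      ≡⟨ ℤS.*-distribˡ-sum (+ 2) (λ ẽ → t₁ i ẽ ℤ.* S.incidence ẽ v) ⟩
    ℤΣ.sum (λ ẽ → + 2 ℤ.* (t₁ i ẽ ℤ.* S.incidence ẽ v))
      ≡⟨ ℤS.sum-cong-≋ (λ ẽ → ≡.trans (≡.sym (ℤ.*-assoc (+ 2) (t₁ i ẽ) (S.incidence ẽ v))) (≡.cong (ℤ._* S.incidence ẽ v) (2t₁≡π*z₁ i ẽ))) ⟩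
    combination (π* (z₁ i)) S.incidence v
      ≡⟨ S.∂≡combination (π* (z₁ i)) v ⟨
    S.∂ (π* (z₁ i)) v
      ≡⟨ π*-H₁ (z₁ i) (T.fundamental-cycle (A₁.at i) (walk₁ i)) v ⟩
    0ℤ ∎)
    where open ≡-Reasoning

  t∈H₁ : ∀ i → t i ∈ S.H₁
  t∈H₁ i = cases (splitAt r i)
    where
    cases : ∀ j → [ t₁ , t₂ ]′ j ∈ S.H₁
    cases (inj₁ j) = t₁∈H₁ j
    cases (inj₂ j) = π*-H₁ (z₂ j) (T.fundamental-cycle (A₂.at j) (walk₂ j))

  -- The coefficient `a i` is the value of `π⁎ x` at the edge that defines the i-th cycle. If that
  -- edge is undilated, a lift of it has degree 1, and `torsion-double` makes the value twice the
  -- coefficient of `x` at the lift.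
  divisible : ∀ x → x ∈ TorsionInCoker → ∀ a → (∀ e → π⁎ x e ≡ combination a z e) →
              ∀ i → ∃[ d ] a i ≡ d ℤ.* ν i
  divisible x x∈ a eq i = cases (splitAt r i) (≡.trans (eq (Enumeration.at nontree i)) (T.combination-off X₂.forest nontree z z∈H₁ z-off a i))
    where
    cases : ∀ j → π⁎ x ([ A₁.at , A₂.at ]′ j) ≡ a i → ∃[ d ] a i ≡ d ℤ.* [ (λ (_ : Fin r) → 1ℤ) , (λ (_ : Fin s) → + 2) ]′ j
    cases (inj₁ j) _  = a i , ≡.sym (ℤ.*-identityʳ (a i))
    cases (inj₂ j) at = x ẽ , (begin
      a i                             ≡⟨ at ⟨
      π⁎ x (A₂.at j)                  ≡⟨ ≡.cong (π⁎ x) over ⟨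
      π⁎ x (onE ẽ)                    ≡⟨ ℤ.*-identityˡ (π⁎ x (onE ẽ)) ⟨
      1ℤ ℤ.* π⁎ x (onE ẽ)             ≡⟨ ≡.cong (λ k → + k ℤ.* π⁎ x (onE ẽ)) (degE-undilated (≡.subst (¬_ ∘ DilatedE) (≡.sym over) (proj₁ (A₂.at-∈ j)))) ⟨
      + degE ẽ ℤ.* π⁎ x (onE ẽ)       ≡⟨ torsion-double x x∈ ẽ ⟨
      + 2 ℤ.* x ẽ                     ≡⟨ ℤ.*-comm (+ 2) (x ẽ) ⟩
      x ẽ ℤ.* + 2                     ∎)
      where
      open ≡-Reasoning
      ẽ = proj₁ (lift-edge (A₂.at j))
      over = proj₂ (lift-edge (A₂.at j))

  module Torsion = TorsionBasis z z-basis ν ν≢0 t t∈H₁ 2t≡νπ*z divisible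

  source-dilated : ∀ {u v} → Star (T.Adjacent F₁.Tree) u v → u ≡ v ⊎ DilatedV u
  source-dilated Star.ε = inj₁ ≡.refl
  source-dilated (T.step h t ≡.refl _ ◅ _) = inj₂ (dilated-end h (tree₁-dilated t))

  step-target : ∀ h → F₁.Tree (T.edge h) → DilatedV (T.root (T.inv h))
  step-target h t = dilated-end (T.inv h) (≡.subst DilatedE (≡.sym (T.edge-inv h)) (tree₁-dilated t))

  target-dilated : ∀ {u v} → Star (T.Adjacent F₁.Tree) u v → u ≡ v ⊎ DilatedV v
  target-dilated Star.ε = inj₁ ≡.refl
  target-dilated (T.step h t _ ≡.refl ◅ hs) with target-dilated hs
  ... | inj₁ ≡.refl = inj₂ (step-target h t)
  ... | inj₂ dil    = inj₂ dil

  to-component : ∀ {u v} → Star (T.Adjacent F₁.Tree) u v → (du : DilatedV u) (dv : DilatedV v) →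
                 Star _—_ (u , du) (v , dv)
  -- Dilation of a vertex is an equation between naturals, so its two proofs agree and the two
  -- dilated vertices are the same.
  to-component Star.ε du dv with ≡.refl ← ℕ.≡-irrelevant du dv = Star.ε
  to-component (T.step h t source ≡.refl ◅ hs) du dv =
    (h , tree₁-dilated t , source , ≡.refl) ◅ to-component hs (step-target h t) dv

  label-half-edge : ∀ h → DilatedE (T.edge h) → F₁.label (T.root h) ≡ F₁.label (T.root (T.inv h))
  label-half-edge h dil = cases (T.start-edge h)
    where
    cases : T.start (T.edge h) ≡ h ⊎ T.start (T.edge h) ≡ T.inv h → F₁.label (T.root h) ≡ F₁.label (T.root (T.inv h))
    cases (inj₁ eq) = ≡.subst (λ x → F₁.label (T.root x) ≡ F₁.label (T.root (T.inv x))) eq (spans₁ dil)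
    cases (inj₂ eq) = ≡.trans (≡.cong (F₁.label ∘ T.root) (≡.sym (T.involutive h)))
      (≡.sym (≡.subst (λ x → F₁.label (T.root x) ≡ F₁.label (T.root (T.inv x))) eq (spans₁ dil)))

  label-component : ∀ {x y} → Star _—_ x y → F₁.label (proj₁ x) ≡ F₁.label (proj₁ y)
  label-component Star.ε = ≡.refl
  label-component ((h , dil , source , target) ◅ hs) = ≡.trans
    (≡.trans (≡.cong F₁.label (≡.sym source)) (≡.trans (label-half-edge h dil) (≡.cong F₁.label target)))
    (label-component hs)

  label-dilated : ∀ {v} → DilatedV v → DilatedV (F₁.label v)
  label-dilated {v} dil with source-dilated (F₁.connected (F₁.idem v))
  ... | inj₁ eq   = ≡.subst DilatedV (≡.sym eq) dil
  ... | inj₂ dil′ = dil′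

  label-undilated : ∀ {v} → ¬ DilatedV v → F₁.label v ≡ v
  label-undilated {v} undil with target-dilated (F₁.connected (F₁.idem v))
  ... | inj₁ eq  = eq
  ... | inj₂ dil = ⊥-elim (undil dil)

  module Count {d} (components : HasDilatedComponents d) where
    f = proj₁ components
    f-quotient = proj₂ components

    root? : Decidable (λ v → F₁.label v ≡ v)
    root? v = F₁.label v Fin.≟ v

    dilated-root? : Decidable (λ v → DilatedV v × F₁.label v ≡ v)
    dilated-root? v = dilatedV? v ×-dec root? v

    -- On dilated vertices the trees of the first forest are the components of the dilation
    -- subgraph: the forest uses dilated edges only and connects the ends of each of them. One
    -- representative is taken per component.
    dilated-roots : Enumeration (λ v → DilatedV v × F₁.label v ≡ v) d
    dilated-roots = record
      { at        = λ i → F₁.label (proj₁ (rep i))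
      ; at-∈      = λ i → label-dilated (proj₂ (rep i)) , F₁.idem (proj₁ (rep i))
      ; injective = λ {i} {j} eq → ≡.trans (≡.sym (f-rep i)) (≡.trans
          (Equivalence.from (proj₂ f-quotient (rep i) (rep j)) (to-component (F₁.connected eq) (proj₂ (rep i)) (proj₂ (rep j))))
          (f-rep j))
      ; index     = λ v (dil , root) → f (v , dil) ,
          ≡.trans (label-component (Equivalence.to (proj₂ f-quotient (rep (f (v , dil))) (v , dil)) (f-rep (f (v , dil))))) root
      }
      where
      rep : Fin d → ∃ DilatedV
      rep i = proj₁ (proj₁ f-quotient i)
      f-rep : ∀ i → f (rep i) ≡ i
      f-rep i = proj₂ (proj₁ f-quotient i)

    undilatedV? : Decidable (λ v → ¬ DilatedV v)
    undilatedV? v = ¬? (dilatedV? v)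

    -- An undilated vertex touches no edge of the first forest, so it is a tree of its own.
    count-roots : count root? ≡ d ℕ.+ count undilatedV?
    count-roots = ≡.trans (count-⊎ dilated-root? undilatedV? root?
        (λ v root → cases v root (dilatedV? v)) (λ _ → proj₂) (λ _ → label-undilated) (λ _ (dil , _) undil → undil dil))
      (≡.cong (ℕ._+ count undilatedV?) (Enumeration-unique (enumerate dilated-root?) dilated-roots))
      where
      cases : ∀ v → F₁.label v ≡ v → Dec (DilatedV v) → (DilatedV v × F₁.label v ≡ v) ⊎ (¬ DilatedV v)
      cases v root (yes dil)  = inj₁ (dil , root)
      cases v root (no undil) = inj₂ undil

    count-vertices : T.#V ≡ #dilatedV ℕ.+ count undilatedV?
    count-vertices = ≡.trans (≡.sym (count-all {T.#V} (λ _ → yes tt) (λ _ → tt)))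
      (count-⊎ dilatedV? undilatedV? (λ _ → yes tt) (λ v _ → cases v (dilatedV? v)) (λ _ _ → tt) (λ _ _ → tt) (λ _ dil undil → undil dil))
      where
      cases : ∀ v → Dec (DilatedV v) → DilatedV v ⊎ ¬ DilatedV v
      cases v (yes dil)  = inj₁ dil
      cases v (no undil) = inj₂ undil

    count-dilated-edges : #dilatedE ≡ count (λ e → F₁.tree e Bool.≟ true) ℕ.+ r
    count-dilated-edges = count-⊎ (λ e → F₁.tree e Bool.≟ true) nontree-dilated? dilatedE?
      (λ e dil → cases e dil (F₂.tree e Bool.≟ true)) (λ _ → tree₁-dilated) (λ _ → proj₁) (λ _ t (_ , ¬t) → ¬t (X₂.keeps t))
      where
      cases : ∀ e → DilatedE e → Dec (F₂.Tree e) → F₁.Tree e ⊎ (DilatedE e × F₂.tree e ≢ true)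
      cases e dil (yes t) = inj₁ (tree₂-dilated t dil)
      cases e dil (no ¬t) = inj₂ (dil , ¬t)

    -- The forest count is taken over all vertices of Γ. Each undilated vertex enters it as an
    -- isolated tree and cancels, leaving n_d = d + (number of tree edges).
    exponent : (+ #dilatedE ℤ.- + #dilatedV) ℤ.+ + d ≡ + r
    exponent = begin
      (+ #dilatedE ℤ.- + #dilatedV) ℤ.+ + d
        ≡⟨ ≡.cong₂ (λ m n → (+ m ℤ.- + n) ℤ.+ + d) count-dilated-edges (≡.sym d+tree) ⟩
      (+ (tree ℕ.+ r) ℤ.- + (d ℕ.+ tree)) ℤ.+ + d
        ≡⟨ ≡.cong₂ (λ m n → (m ℤ.- n) ℤ.+ + d) (ℤ.pos-+ tree r) (ℤ.pos-+ d tree) ⟩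
      ((+ tree ℤ.+ + r) ℤ.- (+ d ℤ.+ + tree)) ℤ.+ + d
        ≡⟨ cancel (+ tree) (+ r) (+ d) ⟩
      + r ∎
      where
      open ≡-Reasoning
      tree = count (λ e → F₁.tree e Bool.≟ true)
      undil = count undilatedV?
      cancel : ∀ t r d → ((t ℤ.+ r) ℤ.- (d ℤ.+ t)) ℤ.+ d ≡ r
      cancel t r d = solve-ℤ (t ∷ r ∷ d ∷ [])
      d+tree : d ℕ.+ tree ≡ #dilatedV
      d+tree = ℕ.+-cancelʳ-≡ undil (d ℕ.+ tree) #dilatedV (begin
        d ℕ.+ tree ℕ.+ undil            ≡⟨ ℕ.+-assoc d tree undil ⟩
        d ℕ.+ (tree ℕ.+ undil)          ≡⟨ ≡.cong (d ℕ.+_) (ℕ.+-comm tree undil) ⟩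
        d ℕ.+ (undil ℕ.+ tree)          ≡⟨ ℕ.+-assoc d undil tree ⟨
        d ℕ.+ undil ℕ.+ tree            ≡⟨ ≡.cong (ℕ._+ tree) count-roots ⟨
        count root? ℕ.+ tree            ≡⟨ F₁.counted ⟩
        T.#V                            ≡⟨ count-vertices ⟩
        #dilatedV ℕ.+ undil             ∎)

  dilated-vertex : Dilated → ∃ DilatedV
  dilated-vertex (inj₁ v)         = v
  dilated-vertex (inj₂ (e , dil)) = T.tail e , dilated-end (T.start e) (≡.subst DilatedE (≡.sym (T.edge-start e)) dil)

  -- Comparison of the three determinants.

  open FieldProperties F
  open Determinants F
  open DeterminantProperties F
  open Gram F

  pairing-t : ∀ i b → ι (+ 2) * pairing F Γ̃ (t i) b ≈ ι (ν i) * pairing F Γ (z i) (π⁎ b)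
  pairing-t i b = trans (pairing-scale Γ̃ (+ 2) (ν i) b (2t≡νπ*z i)) (*-congˡ (adjoint (z i) b))

  -- Supplies the zero block: by adjointness the pairing is computed from `π⁎ b`. The factor 2 is
  -- cancelled in the field, because `t i` is known only through its double.
  pairing-t-kernel : ∀ i b → b ∈ Kerπ⁎ → pairing F Γ̃ (t i) b ≈ 0#
  pairing-t-kernel i b (_ , π⁎b≡0) = *-cancelˡ ι2≉0 (begin
    ι (+ 2) * pairing F Γ̃ (t i) b
      ≈⟨ pairing-t i b ⟩
    ι (ν i) * pairing F Γ (z i) (π⁎ b)
      ≈⟨ *-congˡ (sum-zero λ e → reflexive (≡.trans (≡.cong (λ x → (z i e ℤ.* x) · T.length e) (π⁎b≡0 e)) (≡.cong (_· T.length e) (ℤ.*-zeroʳ (z i e))))) ⟩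
    ι (ν i) * 0#
      ≈⟨ trans (zeroʳ _) (sym (zeroʳ _)) ⟩
    ι (+ 2) * 0# ∎)

  module Volume (connected : T.Connected) (dilated : Dilated) {d} (components : HasDilatedComponents d) where
    open Lifting (proj₂ (dilated-vertex dilated)) connected

    module _ {g} {γ : Fin g → T.E → ℤ} (γ-basis : IsBasis T.H₁ IsZero γ) where

      pairing-t-lift : ∀ i j → ι (+ 2) * pairing F Γ̃ (t i) (lift (γ j)) ≈ ι (ν i) * pairing F Γ (z i) (γ j)
      pairing-t-lift i j = trans (pairing-t i (lift (γ j)))
        (*-congˡ (pairing-cong Γ {z i} {z i} {π⁎ (lift (γ j))} {γ j} (λ _ → ≡.refl) (π⁎-lift (γ j) (IsBasis.member γ-basis j))))

      upper-rows : ∀ i j → gram Γ z γ (i ↑ˡ s) j ≈ 2# * gram Γ̃ t (lift ∘ γ) (i ↑ˡ s) j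
      upper-rows i j = begin
        pairing F Γ (z (i ↑ˡ s)) (γ j)                       ≈⟨ trans (sym (*-identityˡ _)) (*-congʳ (sym ι-1)) ⟩
        ι 1ℤ * pairing F Γ (z (i ↑ˡ s)) (γ j)                ≡⟨ ≡.cong (λ k → ι k * pairing F Γ (z (i ↑ˡ s)) (γ j)) (Vector.lookup-++ˡ (λ (_ : Fin r) → 1ℤ) (λ (_ : Fin s) → + 2) i) ⟨
        ι (ν (i ↑ˡ s)) * pairing F Γ (z (i ↑ˡ s)) (γ j)      ≈⟨ pairing-t-lift (i ↑ˡ s) j ⟨
        ι (+ 2) * pairing F Γ̃ (t (i ↑ˡ s)) (lift (γ j))      ≈⟨ *-congʳ ι-2 ⟩
        2# * pairing F Γ̃ (t (i ↑ˡ s)) (lift (γ j))           ∎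

      lower-rows : ∀ i j → gram Γ z γ (r ↑ʳ i) j ≈ gram Γ̃ t (lift ∘ γ) (r ↑ʳ i) j
      lower-rows i j = *-cancelˡ ι2≉0 (begin
        ι (+ 2) * pairing F Γ (z (r ↑ʳ i)) (γ j)             ≡⟨ ≡.cong (λ k → ι k * pairing F Γ (z (r ↑ʳ i)) (γ j)) (Vector.lookup-++ʳ (λ (_ : Fin r) → 1ℤ) (λ (_ : Fin s) → + 2) i) ⟨
        ι (ν (r ↑ʳ i)) * pairing F Γ (z (r ↑ʳ i)) (γ j)      ≈⟨ pairing-t-lift (r ↑ʳ i) j ⟨
        ι (+ 2) * pairing F Γ̃ (t (r ↑ʳ i)) (lift (γ j))      ∎)

    -- The relations between the sizes are arguments so that matching on them turns the rectangular
    -- Gram matrices of `t` and `rows` into square ones.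
    prym-volume : ∀ {g̃ g h} → g ≡ r ℕ.+ s → g̃ ≡ g ℕ.+ h →
      (γ̃ : Fin g̃ → S.E → ℤ) → IsBasisOfH₁ F Γ̃ õ γ̃ → (γ : Fin g → T.E → ℤ) → IsBasisOfH₁ F Γ o γ →
      (κ l : Fin h → S.E → ℤ) → IsBasisOfK κ → IsBasisOfK′ l →
      prymVol² κ l ≈ 2# ^ r * (jacVol² F Γ̃ γ̃ / jacVol² F Γ γ)
    prym-volume {h = h} ≡.refl ≡.refl γ̃ γ̃-basis γ γ-basis κ l κ-basis l-basis =
      ∣sign*∣ (sign-* (sign-* σ₁-sign σ₂-sign) σ₃-sign)
        (*-pos (^-pos r 0<2) (*-pos 0<J̃ (⁻¹-pos 0<J))) (*-cancelˡ J≉0 scaled)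
      where
      rows = t ++ κ
      columns = (lift ∘ γ) ++ l
      rows-basis : IsBasis S.H₁ IsZero rows
      rows-basis = quotient-basis proj₁ Torsion.combination-torsion Torsion.torsion-basis κ-basis
      columns-basis : IsBasis S.H₁ IsZero columns
      columns-basis = basis-swap l (lift ∘ γ) (lift-basis γ-basis l-basis)
      J̃ = jacVol² F Γ̃ γ̃
      J = jacVol² F Γ γ
      B = det (gram Γ̃ t (lift ∘ γ))
      D = det (gram Γ̃ κ l)
      0<J̃ = JacobianVolume.jacVol²-positive F Γ̃ õ γ̃ γ̃-basis
      0<J = JacobianVolume.jacVol²-positive F Γ o γ γ-basis
      J≉0 : ¬ (J ≈ 0#)
      J≉0 eq = <⇒≉ 0<J (sym eq)
      change₁ = gram-det-rows Γ̃ γ̃-basis rows-basis γ̃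
      change₂ = gram-det-columns Γ̃ γ̃-basis columns-basis rows
      change₃ = gram-det-rows Γ γ-basis z-basis γ
      σ₁ = proj₁ change₁
      σ₂ = proj₁ change₂
      σ₃ = proj₁ change₃
      σ₁-sign = proj₁ (proj₂ change₁)
      σ₂-sign = proj₁ (proj₂ change₂)
      σ₃-sign = proj₁ (proj₂ change₃)
      block : det (gram Γ̃ rows columns) ≈ B * D
      block = det-block (gram Γ̃ rows columns) (gram Γ̃ t (lift ∘ γ)) (gram Γ̃ κ l)
        (λ i j → reflexive (≡.cong₂ (pairing F Γ̃) (Vector.lookup-++ˡ t κ i) (Vector.lookup-++ˡ (lift ∘ γ) l j)))
        (λ i j → trans (reflexive (≡.cong₂ (pairing F Γ̃) (Vector.lookup-++ˡ t κ i) (Vector.lookup-++ʳ (lift ∘ γ) l j)))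
                       (pairing-t-kernel i (l j) (IsBasis.member l-basis j)))
        (λ i j → reflexive (≡.cong₂ (pairing F Γ̃) (Vector.lookup-++ʳ t κ i) (Vector.lookup-++ʳ (lift ∘ γ) l j)))
      BD : B * D ≈ σ₂ * (σ₁ * J̃)
      BD = trans (sym block) (trans (proj₂ (proj₂ change₂)) (*-congˡ (proj₂ (proj₂ change₁))))
      2B : 2# ^ r * B ≈ σ₃ * J
      2B = trans (sym (det-scale 2# (gram Γ z γ) (gram Γ̃ t (lift ∘ γ)) (upper-rows γ-basis) (lower-rows γ-basis)))
                 (proj₂ (proj₂ change₃))
      -- Multiplying by `J` and inserting σ₃² = 1 produces σ₃ J, which `2B` replaces by 2^r B; then
      -- `BD` eliminates both `B` and `D`.
      scaled : J * D ≈ J * (σ₁ * σ₂ * σ₃ * (2# ^ r * (J̃ * J ⁻¹)))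
      scaled = begin
        J * D
          ≈⟨ trans (sym (*-identityˡ _)) (*-congʳ (sym (sign-square σ₃-sign))) ⟩
        σ₃ * σ₃ * (J * D)
          ≈⟨ solve 3 (λ s j d → s :* s :* (j :* d) := s :* (s :* j) :* d) refl σ₃ J D ⟩
        σ₃ * (σ₃ * J) * D
          ≈⟨ *-congʳ (*-congˡ 2B) ⟨
        σ₃ * (2# ^ r * B) * D
          ≈⟨ solve 4 (λ s p b d → s :* (p :* b) :* d := s :* p :* (b :* d)) refl σ₃ (2# ^ r) B D ⟩
        σ₃ * 2# ^ r * (B * D)
          ≈⟨ *-congˡ BD ⟩
        σ₃ * 2# ^ r * (σ₂ * (σ₁ * J̃))
          ≈⟨ *-identityʳ _ ⟨
        σ₃ * 2# ^ r * (σ₂ * (σ₁ * J̃)) * 1#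
          ≈⟨ *-congˡ (⁻¹-inverseʳ J≉0) ⟨
        σ₃ * 2# ^ r * (σ₂ * (σ₁ * J̃)) * (J * J ⁻¹)
          ≈⟨ solve 7 (λ a b c p j̃ j k → c :* p :* (b :* (a :* j̃)) :* (j :* k) := j :* (a :* b :* c :* (p :* (j̃ :* k)))) refl σ₁ σ₂ σ₃ (2# ^ r) J̃ J (J ⁻¹) ⟩
        J * (σ₁ * σ₂ * σ₃ * (2# ^ r * (J̃ * J ⁻¹))) ∎

    sizes : ∀ {g̃ g h} {γ̃ : Fin g̃ → S.E → ℤ} {γ : Fin g → T.E → ℤ} {l : Fin h → S.E → ℤ} →
      IsBasisOfH₁ F Γ̃ õ γ̃ → IsBasisOfH₁ F Γ o γ → IsBasisOfK′ l → g ≡ r ℕ.+ s × g̃ ≡ g ℕ.+ h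
    sizes {g = g} {h} γ̃-basis γ-basis l-basis =
      basis-size-unique γ-basis z-basis ,
      ≡.trans (basis-size-unique γ̃-basis (lift-basis γ-basis l-basis)) (ℕ.+-comm h g)

theorem3p11 :
    ∀ {c ℓ₁ ℓ₂} (F : OrderedField c ℓ₁ ℓ₂) {Γ̃ Γ : MetricGraph F}
    (π : DoubleCover F Γ̃ Γ) →
    MetricGraph.Connected Γ → DoubleCover.Dilated π →
    (õ : Orientation (MetricGraph.graph Γ̃)) (o : Orientation (MetricGraph.graph Γ)) →
    DoubleCover.Compatible π õ o →
    (d : ℕ) → DoubleCover.HasDilatedComponents π d →
    {g̃ g h : ℕ}
    (γ̃ : Fin g̃ → MetricGraph.E Γ̃ → ℤ) → IsBasisOfH₁ F Γ̃ õ γ̃ →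
    (γ : Fin g → MetricGraph.E Γ → ℤ) → IsBasisOfH₁ F Γ o γ →
    (κ l : Fin h → MetricGraph.E Γ̃ → ℤ) →
    Prym.IsBasisOfK F π õ o κ → Prym.IsBasisOfK′ F π õ o l →
    let open OrderedField F
        open DoubleCover π
    in Prym.prymVol² F π õ o κ l
         ≈ 2# ^ℤ ((+ #dilatedE ℤ.- + #dilatedV) ℤ.+ + d) * (jacVol² F Γ̃ γ̃ / jacVol² F Γ γ)
theorem3p11 F {Γ̃} {Γ} π connected dilated õ o compatible d components γ̃ γ̃-basis γ γ-basis κ l κ-basis l-basis =
  trans (prym-volume (proj₁ sizes′) (proj₂ sizes′) γ̃ γ̃-basis γ γ-basis κ l κ-basis l-basis)
        -- An integer power with exponent `+ r` computes to the natural power, so the equation of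
        -- exponents is all that remains.
        (reflexive (≡.cong (λ k → 2# ^ℤ k * (jacVol² F Γ̃ γ̃ / jacVol² F Γ γ)) (≡.sym exponent)))
  where
  open FieldProperties F
  open Dilation F π õ o compatible
  open Count components
  open Volume connected dilated components
  sizes′ = sizes γ̃-basis γ-basis l-basis
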